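{- Let $k > \ell \ge 1$ be integers and let $\mathcal{F}$ be a family of $k$-graphs. For any $\varepsilon > 0$, there exist $\delta = \delta(\varepsilon,\mathcal{F}) > 0$ and $N$ such that every $k$-graph $H_n$ on $n > N$ vertices with $\delta_{\ell}(H_n) > (\pi_{\ell}(\mathcal{F}) + \varepsilon)\binom{n}{k-\ell}$ contains at least $\delta\binom{n}{f}$ copies of $F$ for some $F \in \mathcal{F}$, where $f=|V(F)|$. Moreover, $\pi_{\ell}(\mathcal{F}) = \pi_{\ell}(\mathcal{F}(s))$ for all integers $s \ge 1$.
   Context: A $k$-graph $H$ is a pair $(V(H),E(H))$ where $V(H)$ is a finite set and $E(H)$ is a set of $k$-subsets of $V(H)$. For $0\le \ell<k$ and an $\ell$-subset $T$ of $V(H)$, $\deg^H(T)$ is the number of $(k-\ell)$-subsets $S$ of $V(H)$ with $S\cup T\in E(H)$, and $\delta_\ell(H)=\min\{\deg^H(T): T\subseteq V(H), |T|=\ell\}$. For a (possibly infinite) family $\mathcal{F}$ of $k$-graphs, a $k$-graph is $\mathcal{F}$-free if it contains no copy of any member of $\mathcal{F}$ as a (not necessarily induced) subgraph. Let $\mathrm{ex}_\ell(n,\mathcal{F})$ be the maximum of $\delta_\ell(H)$ over all $\mathcal{F}$-free $k$-graphs $H$ on $n$ vertices (taken to be $0$ if there are none), and let $\pi_\ell(\mathcal{F})=\limsup_{n\to\infty}\mathrm{ex}_\ell(n,\mathcal{F})/\binom{n}{k-\ell}$. For an integer $s\ge 1$ and a $k$-graph $F$, the $s$-blow-up $F(s)$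 is the $k$-graph $(V',E')$ where $V'$ is obtained by replacing each $v_i\in V(F)$ by a set $V_i$ of size $s$ (the sets $V_i$ pairwise disjoint) and $E'=\{u_1\cdots u_k : u_j\in V_{i_j},\ v_{i_1}\cdots v_{i_k}\in E(F)\}$. For a family $\mathcal{F}$, $\mathcal{F}(s)=\{F(s):F\in\mathcal{F}\}$. -}

module Defs where

open import Axiom.ExcludedMiddle using (ExcludedMiddle)
open import Data.Bool.Base using (Bool; true; false; T; _∧_)
open import Data.Bool.Properties using (T?)
open import Data.Empty using (⊥-elim)
open import Data.Fin.Base using (Fin; quotient)
open import Data.Fin.Properties using (any?) renaming (_≟_ to _≟ᶠ_)
open import Data.Fin.Subset using (Subset; inside; outside; ∣_∣; _∪_; ⊤)
open import Data.Fin.Subset.Properties using (_∈?_)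
import Data.Integer.Base as ℤ
import Data.Integer.Properties as ℤ
open import Data.List.Base using (List; []; _∷_; _++_; map; filter; length; upTo)
open import Data.List.Extrema.Nat using (max; min; max≤v⁺; v≤max⁺; min≤⊤)
open import Data.List.Membership.Propositional.Properties using (∈-filter⁺; ∈-upTo⁺)
open import Data.List.Properties using (filter-++; length-++)
open import Data.List.Relation.Unary.All as All using (All)
import Data.List.Relation.Unary.All.Properties as All
open import Data.List.Relation.Unary.AllPairs using (AllPairs)
import Data.List.Relation.Unary.Any as Any
open import Data.Nat.Base as ℕ using (ℕ; zero; suc; _∸_; z≤n; s≤s; _≡ᵇ_)
open import Data.Nat.Combinatorics using (_C_; nCk+nC[k+1]≡[n+1]C[k+1])
import Data.Nat.Properties as ℕ
open import Data.Product.Base using (Σ; ∃; _×_; _,_; proj₁; proj₂)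
open import Data.Rational.Base as ℚ using (ℚ; 0ℚ; 1ℚ; _/_)
import Data.Rational.Properties as ℚ
import Data.Rational.Unnormalised.Base as ℚᵘ
import Data.Rational.Unnormalised.Properties as ℚᵘ
open import Data.Sum.Base using (inj₁; inj₂)
open import Data.Vec.Base using ([]; _∷_; tabulate)
open import Function.Bundles using (_↣_; Injection; _⇔_)
open import Level using (0ℓ)
open import Relation.Binary.PropositionalEquality
  using (_≡_; refl; sym; trans; cong; cong₂; subst; subst₂)
open import Relation.Nullary using (¬_; Dec; yes; no; does; _×-dec_)

-- A Dedekind cut given by its lower set alone, with no locatedness
-- requirement: these are the real numbers of classical mathematics, and are
-- only used in the presence of excluded middle.

record ℝ : Set₁ where
  field
    Below     : ℚ → Set
    inhabited : ∃ λ q → Below q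
    proper    : ∃ λ q → ¬ Below q
    lower     : ∀ {p q} → p ℚ.< q → Below q → Below p
    rounded   : ∀ {p} → Below p → ∃ λ q → p ℚ.< q × Below q

open ℝ public

infix  4 _<ᴿ_ _≤ᴿ_ _≈ᴿ_
infixl 6 _+ᴿ_
infixl 7 _·_

_<ᴿ_ : ℝ → ℝ → Set
x <ᴿ y = ∃ λ q → ¬ Below x q × Below y q

_≤ᴿ_ : ℝ → ℝ → Set
x ≤ᴿ y = ∀ q → Below x q → Below y q

_≈ᴿ_ : ℝ → ℝ → Set
x ≈ᴿ y = x ≤ᴿ y × y ≤ᴿ x

private
  q-1<q : ∀ q → q ℚ.- 1ℚ ℚ.< q
  q-1<q q = subst (q ℚ.- 1ℚ ℚ.<_) (ℚ.+-identityʳ q)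
              (ℚ.+-monoʳ-< q (ℚ.negative⁻¹ (ℚ.- 1ℚ)))

  outside⇒≤ : (x : ℝ) → ∀ {p q} → ¬ Below x q → Below x p → p ℚ.≤ q
  outside⇒≤ x q∉x p∈x = ℚ.≮⇒≥ λ q<p → q∉x (lower x q<p p∈x)

fromℚ : ℚ → ℝ
fromℚ r = record
  { Below     = λ q → q ℚ.< r
  ; inhabited = r ℚ.- 1ℚ , q-1<q r
  ; proper    = r , ℚ.<-irrefl refl
  ; lower     = ℚ.<-trans
  ; rounded   = ℚ.<-dense
  }

ℕ⇒ℚ : ℕ → ℚ
ℕ⇒ℚ n = ℤ.+ n / 1

fromℕ : ℕ → ℝ
fromℕ n = fromℚ (ℕ⇒ℚ n)

0ᴿ : ℝ
0ᴿ = fromℚ 0ℚ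

_+ᴿ_ : ℝ → ℝ → ℝ
x +ᴿ y = record
  { Below     = λ q → ∃ λ a → ∃ λ b → Below x a × Below y b × q ℚ.< a ℚ.+ b
  ; inhabited = let a , a∈x = inhabited x ; b , b∈y = inhabited y in
                _ , a , b , a∈x , b∈y , q-1<q (a ℚ.+ b)
  ; proper    = let s , s∉x = proper x ; t , t∉y = proper y in
                s ℚ.+ t , λ (a , b , a∈x , b∈y , s+t<a+b) →
                ℚ.<-irrefl refl (ℚ.<-≤-trans s+t<a+b
                  (ℚ.+-mono-≤ (outside⇒≤ x s∉x a∈x) (outside⇒≤ y t∉y b∈y)))
  ; lower     = λ p<q (a , b , a∈x , b∈y , q<a+b) →
                a , b , a∈x , b∈y , ℚ.<-trans p<q q<a+b
  ; rounded   = λ (a , b , a∈x , b∈y , p<a+b) →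
                let q , p<q , q<a+b = ℚ.<-dense p<a+b in
                q , p<q , a , b , a∈x , b∈y , q<a+b
  }

_·_ : ℝ → ℕ → ℝ
x · n = record
  { Below     = λ q → ∃ λ a → Below x a × q ℚ.< a ℚ.* ℕ⇒ℚ n
  ; inhabited = let a , a∈x = inhabited x in _ , a , a∈x , q-1<q (a ℚ.* ℕ⇒ℚ n)
  ; proper    = let s , s∉x = proper x in
                s ℚ.* ℕ⇒ℚ n , λ (a , a∈x , sn<an) →
                ℚ.<-irrefl refl (ℚ.<-≤-trans sn<an
                  (ℚ.*-monoʳ-≤-nonNeg (ℕ⇒ℚ n) {{ℚ.normalize-nonNeg n 1}}
                    (outside⇒≤ x s∉x a∈x)))
  ; lower     = λ p<q (a , a∈x , q<an) → a , a∈x , ℚ.<-trans p<q q<an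
  ; rounded   = λ (a , a∈x , p<an) →
                let q , p<q , q<an = ℚ.<-dense p<an in q , p<q , a , a∈x , q<an
  }

-- inf_N sup_{n ≥ N} xₙ; q lies strictly below it iff some r > q is, for every
-- N, strictly below the supremum of the tail from N on.

limsup : (x : ℕ → ℚ) → (∃ λ a → ∀ n → a ℚ.≤ x n) → (∃ λ b → ∀ n → x n ℚ.≤ b) → ℝ
limsup x (a , a≤x) (b , x≤b) = record
  { Below     = λ q → ∃ λ r → q ℚ.< r × (∀ N → ∃ λ n → N ℕ.≤ n × r ℚ.< x n)
  ; inhabited = a ℚ.- 1ℚ ℚ.- 1ℚ , a ℚ.- 1ℚ , q-1<q (a ℚ.- 1ℚ) ,
                λ N → N , ℕ.≤-refl , ℚ.<-≤-trans (q-1<q a) (a≤x N)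
  ; proper    = b , λ (r , b<r , freq) →
                let n , _ , r<xn = freq 0 in
                ℚ.<-irrefl refl (ℚ.<-≤-trans (ℚ.<-trans b<r r<xn) (x≤b n))
  ; lower     = λ p<q (r , q<r , freq) → r , ℚ.<-trans p<q q<r , freq
  ; rounded   = λ (r , p<r , freq) →
                let q , p<q , q<r = ℚ.<-dense p<r in q , p<q , r , q<r , freq
  }

subsets : ∀ n → List (Subset n)
subsets zero    = [] ∷ []
subsets (suc n) = map (inside ∷_) (subsets n) ++ map (outside ∷_) (subsets n)

image : ∀ {m n} → (Fin m → Fin n) → Subset m → Subset n
image φ A = tabulate λ j → does (any? λ i → (i ∈? A) ×-dec (φ i ≟ᶠ j))

record KGraph (k n : ℕ) : Set where
  field
    edge    : Subset n → Bool
    uniform : ∀ e → T (edge e) → ∣ e ∣ ≡ k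

open KGraph public

deg : ∀ {k n} → KGraph k n → Subset n → ℕ
deg {k} {n} H A =
  length (filter (λ S → (∣ S ∣ ℕ.≟ k ∸ ∣ A ∣) ×-dec T? (edge H (S ∪ A))) (subsets n))

-- The minimum of the empty list is taken to be 0.

minimum : List ℕ → ℕ
minimum []       = 0
minimum (x ∷ xs) = min x xs

minDegree : ∀ {k n} → ℕ → KGraph k n → ℕ
minDegree {n = n} ℓ H =
  minimum (map (deg H) (filter (λ A → ∣ A ∣ ℕ.≟ ℓ) (subsets n)))

record Embedding {k f n} (F : KGraph k f) (H : KGraph k n) : Set where
  field
    injection : Fin f ↣ Fin n

  to : Fin f → Fin n
  to = Injection.to injection

  field
    preserves : ∀ e → T (edge F e) → T (edge H (image to e))

  imageVertices : Subset n
  imageVertices = image to ⊤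

  IsImageEdge : Subset n → Set
  IsImageEdge D = ∃ λ e → T (edge F e) × image to e ≡ D

open Embedding public

SameCopy : ∀ {k f n} {F : KGraph k f} {H : KGraph k n} (φ ψ : Embedding F H) → Set
SameCopy φ ψ =
  imageVertices φ ≡ imageVertices ψ × (∀ D → IsImageEdge φ D ⇔ IsImageEdge ψ D)

-- A copy of F in H is a subgraph of H isomorphic to F, i.e. the image of an
-- embedding; embeddings with the same image are counted once.

AtLeastCopies : ∀ {k f n} → ℝ → KGraph k f → KGraph k n → Set
AtLeastCopies x F H =
  Σ (List (Embedding F H)) λ φs →
    AllPairs (λ φ ψ → ¬ SameCopy φ ψ) φs × x ≤ᴿ fromℕ (length φs)

Family : ℕ → Set₁
Family k = ∀ {f} → KGraph k f → Set

Free : ∀ {k n} → Family k → KGraph k n → Set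
Free {k} 𝓕 H = ∀ {f} (F : KGraph k f) → 𝓕 F → ¬ Embedding F H

-- The fibre of quotient s over i ∈ Fin f is the class Vᵢ, of size s.  A k-set
-- projecting onto an edge (also a k-set) meets each of its k classes once.

blowUp : ∀ {k f} (s : ℕ) → KGraph k f → KGraph k (f ℕ.* s)
blowUp {k} {f} s F = record
  { edge    = λ e → (∣ e ∣ ≡ᵇ k) ∧ edge F (image (quotient s) e)
  ; uniform = λ e → unif e
  }
  where
  T-∧ˡ : ∀ {a b} → T (a ∧ b) → T a
  T-∧ˡ {true} _ = _

  unif : ∀ e → T ((∣ e ∣ ≡ᵇ k) ∧ edge F (image (quotient s) e)) → ∣ e ∣ ≡ k
  unif e t = ℕ.≡ᵇ⇒≡ ∣ e ∣ k (T-∧ˡ t)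

data BlowUps {k} (s : ℕ) (𝓕 : Family k) : Family k where
  blow : ∀ {f} {F : KGraph k f} → 𝓕 F → BlowUps s 𝓕 (blowUp s F)

module _ (em : ExcludedMiddle 0ℓ) {k : ℕ} (ℓ : ℕ) (𝓕 : Family k) where

  Attained : ℕ → ℕ → Set
  Attained n d = Σ (KGraph k n) λ H → Free 𝓕 H × minDegree ℓ H ≡ d

  -- Candidates above n C (k ∸ ℓ) need not be considered: see minDegree≤C and
  -- minDegree≤ex below.

  ex : ℕ → ℕ
  ex n = max 0 (filter (λ d → em {Attained n d}) (upTo (suc (n C (k ∸ ℓ)))))

  ex≤C : ∀ n → ex n ℕ.≤ n C (k ∸ ℓ)
  ex≤C n = max≤v⁺ {xs = filter (λ d → em {Attained n d}) (upTo (suc (n C (k ∸ ℓ))))} z≤n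
             (All.map ℕ.≤-pred
               (All.filter⁺ (λ d → em {Attained n d}) (All.all-upTo (suc (n C (k ∸ ℓ))))))

-- The value at denominator 0 is junk, met only when n < k ∸ ℓ.

ratio : ℕ → ℕ → ℚ
ratio m zero    = 0ℚ
ratio m (suc d) = ℤ.+ m / suc d

0≤ratio : ∀ m d → 0ℚ ℚ.≤ ratio m d
0≤ratio m zero    = ℚ.≤-refl
0≤ratio m (suc d) = ℚ.nonNegative⁻¹ _ {{ℚ.normalize-nonNeg m (suc d)}}

ratio≤1 : ∀ {m d} → m ℕ.≤ d → ratio m d ℚ.≤ 1ℚ
ratio≤1 {m} {zero}  _   = ℚ.nonNegative⁻¹ 1ℚ
ratio≤1 {m} {suc d} m≤d = ℚ.toℚᵘ-cancel-≤
  (ℚᵘ.≤-respˡ-≃ (ℚᵘ.≃-sym (ℚ.toℚᵘ-fromℚᵘ (ℚᵘ.mkℚᵘ (ℤ.+ m) d)))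
    (ℚᵘ.*≤* (subst₂ ℤ._≤_ (sym (ℤ.*-identityʳ (ℤ.+ m))) (sym (ℤ.*-identityˡ (ℤ.+ suc d)))
      (ℤ.+≤+ m≤d))))

π : ExcludedMiddle 0ℓ → ∀ {k} → ℕ → Family k → ℝ
π em {k} ℓ 𝓕 = limsup (λ n → ratio (ex em ℓ 𝓕 n) (n C (k ∸ ℓ)))
  (0ℚ , λ n → 0≤ratio (ex em ℓ 𝓕 n) (n C (k ∸ ℓ)))
  (1ℚ , λ n → ratio≤1 (ex≤C em ℓ 𝓕 n))

private
  sized : ∀ {n} → ℕ → List (Subset n) → ℕ
  sized j xs = length (filter (λ S → ∣ S ∣ ℕ.≟ j) xs)

  sized-outside : ∀ {n} j (xs : List (Subset n)) → sized j (map (outside ∷_) xs) ≡ sized j xs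
  sized-outside j []       = refl
  sized-outside j (x ∷ xs) with ∣ x ∣ ≡ᵇ j
  ... | true  = cong suc (sized-outside j xs)
  ... | false = sized-outside j xs

  sized-inside : ∀ {n} j (xs : List (Subset n)) → sized (suc j) (map (inside ∷_) xs) ≡ sized j xs
  sized-inside j []       = refl
  sized-inside j (x ∷ xs) with ∣ x ∣ ≡ᵇ j
  ... | true  = cong suc (sized-inside j xs)
  ... | false = sized-inside j xs

  sized-inside0 : ∀ {n} (xs : List (Subset n)) → sized 0 (map (inside ∷_) xs) ≡ 0
  sized-inside0 []       = refl
  sized-inside0 (x ∷ xs) = sized-inside0 xs

  sized-++ : ∀ {n} j (xs ys : List (Subset n)) → sized j (xs ++ ys) ≡ sized j xs ℕ.+ sized j ys
  sized-++ j xs ys = trans (cong length (filter-++ (λ S → ∣ S ∣ ℕ.≟ j) xs ys))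
                       (length-++ (filter (λ S → ∣ S ∣ ℕ.≟ j) xs))

sized-subsets : ∀ n j → length (filter (λ S → ∣ S ∣ ℕ.≟ j) (subsets n)) ≡ n C j
sized-subsets zero    zero    = refl
sized-subsets zero    (suc j) = refl
sized-subsets (suc n) zero    =
  trans (sized-++ 0 (map (inside ∷_) (subsets n)) _)
    (trans (cong₂ ℕ._+_ (sized-inside0 (subsets n)) (sized-outside 0 (subsets n)))
      (sized-subsets n 0))
sized-subsets (suc n) (suc j) =
  trans (sized-++ (suc j) (map (inside ∷_) (subsets n)) _)
    (trans (cong₂ ℕ._+_
             (trans (sized-inside j (subsets n)) (sized-subsets n j))
             (trans (sized-outside (suc j) (subsets n)) (sized-subsets n (suc j))))
      (nCk+nC[k+1]≡[n+1]C[k+1] n j))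

private
  length-filter-mono : ∀ {A : Set} {P Q : A → Set} (P? : ∀ a → Dec (P a)) (Q? : ∀ a → Dec (Q a)) →
    (∀ a → P a → Q a) → ∀ xs → length (filter P? xs) ℕ.≤ length (filter Q? xs)
  length-filter-mono P? Q? P⇒Q []       = z≤n
  length-filter-mono P? Q? P⇒Q (x ∷ xs) with P? x | Q? x
  ... | yes p | yes q = s≤s (length-filter-mono P? Q? P⇒Q xs)
  ... | yes p | no ¬q = ⊥-elim (¬q (P⇒Q x p))
  ... | no ¬p | yes q = ℕ.m≤n⇒m≤1+n (length-filter-mono P? Q? P⇒Q xs)
  ... | no ¬p | no ¬q = length-filter-mono P? Q? P⇒Q xs

  minimum-bound : ∀ {b xs} → All (ℕ._≤ b) xs → minimum xs ℕ.≤ b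
  minimum-bound All.[]                          = z≤n
  minimum-bound (All._∷_ {x = x} {xs = xs} p _) = ℕ.≤-trans (min≤⊤ x xs) p

deg≤C : ∀ {k n} (H : KGraph k n) A → deg H A ℕ.≤ n C (k ∸ ∣ A ∣)
deg≤C {k} {n} H A = subst (deg H A ℕ.≤_) (sized-subsets n (k ∸ ∣ A ∣))
  (length-filter-mono _ _ (λ _ → proj₁) (subsets n))

minDegree≤C : ∀ {k n} ℓ (H : KGraph k n) → minDegree ℓ H ℕ.≤ n C (k ∸ ℓ)
minDegree≤C {k} {n} ℓ H = minimum-bound (All.map⁺
  (All.map (λ {A} ∣A∣≡ℓ → subst (λ j → deg H A ℕ.≤ n C (k ∸ j)) ∣A∣≡ℓ (deg≤C H A))
    (All.all-filter (λ A → ∣ A ∣ ℕ.≟ ℓ) (subsets n))))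

minDegree≤ex : ∀ (em : ExcludedMiddle 0ℓ) {k n} ℓ (𝓕 : Family k) (H : KGraph k n) →
               Free 𝓕 H → minDegree ℓ H ℕ.≤ ex em ℓ 𝓕 n
minDegree≤ex em {k} {n} ℓ 𝓕 H free =
  v≤max⁺ 0 (filter (λ d → em {Attained em ℓ 𝓕 n d}) (upTo (suc (n C (k ∸ ℓ)))))
    (inj₂ (Any.map ℕ.≤-reflexive
      (∈-filter⁺ (λ d → em {Attained em ℓ 𝓕 n d})
        (∈-upTo⁺ (s≤s (minDegree≤C ℓ H))) (H , free , refl))))

{-# OPTIONS --safe #-}
module Submission where

-- Fix m large.  Let x be a random m-tuple of vertices of H.  For an ℓ-set of
-- positions, the degree in H[x] of the corresponding ℓ-set of vertices is, up
-- to a small loss, at least as dense as in H, except with probability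
-- exponentially small in m: expose the remaining k − ℓ coordinates of an edge
-- one at a time, applying a Chernoff bound to each.  The union bound over the
-- polynomially many ℓ-sets shows that half of all x induce a graph of large
-- minimum ℓ-degree, hence one containing a member of 𝓕.  Finitely many bits
-- describe H[x], so a positive proportion of the x induce the same graph G ⊇ F.
-- Each vertex set of a copy of F arises from few x, which gives many copies;
-- and by Erdős' theorem on complete m-partite m-graphs these x contain a box
-- S₁ × … × Sₘ with |Sᵢ| = s, which spans a copy of F(s).

open import Defs
open import Axiom.ExcludedMiddle using (ExcludedMiddle)
open import Data.Nat.Base using (ℕ; _≤_; _<_; _>_; _∸_)
open import Data.Nat.Combinatorics using (_C_)
open import Data.Product.Base using (Σ; ∃; _×_)
open import Level using (0ℓ)

open import Data.Bool.Base using (Bool; true; false; T; _∧_; not; if_then_else_)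
open import Data.Bool.Properties as Bool using (T?)
open import Data.Empty using (⊥-elim)
open import Data.Fin.Base as Fin using (Fin; zero; suc; quotient; remainder; combine)
import Data.Fin.Properties as Fin
open import Data.Fin.Subset using (Subset; inside; outside; ∣_∣; _∪_; ⁅_⁆; ∁; _∈_)
import Data.Fin.Subset as Subset
import Data.Fin.Subset.Properties as Subset
import Data.Integer.Base as ℤ
import Data.Integer.Properties as ℤ
open import Data.List.Base
  using (List; []; _∷_; _++_; map; filter; length; concatMap; allFin; upTo)
import Data.List.Base as List
import Data.List.Extrema.Nat as Extrema
import Data.List.Properties as List
open import Data.List.Membership.Propositional using (find; lose) renaming (_∈_ to _∈ˡ_)
import Data.List.Membership.Propositional.Properties as List∈
open import Data.List.Relation.Unary.All as All using (All; []; _∷_)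
import Data.List.Relation.Unary.All.Properties as All
open import Data.List.Relation.Unary.AllPairs using (AllPairs; []; _∷_)
open import Data.List.Relation.Unary.Any as Any using (here; there)
open import Data.List.Relation.Unary.Unique.Propositional using (Unique)
import Data.List.Relation.Unary.Unique.Propositional.Properties as Unique
open import Data.Nat.Base
  using (zero; suc; _+_; _*_; _^_; _/_; _%_; _!; z≤n; s≤s; _≡ᵇ_; NonZero)
import Data.Nat.Base as ℕ
import Data.Nat.Combinatorics as ℕ
import Data.Nat.DivMod as ℕ
import Data.Nat.Properties as ℕ
open import Data.Nat.Tactic.RingSolver using (solve-∀)
open import Data.Product.Base using (_,_; proj₁; proj₂)
open import Data.Rational.Base as ℚ using (ℚ; 0ℚ; 1ℚ)
import Data.Rational.Properties as ℚ
import Data.Rational.Unnormalised.Base as ℚᵘ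
import Data.Rational.Unnormalised.Properties as ℚᵘ
open import Data.Sum.Base using (_⊎_; inj₁; inj₂)
open import Data.Unit.Base using (tt)
open import Data.Vec.Base using (Vec; []; _∷_; lookup; toList; removeAt)
import Data.Vec.Base as Vec
import Data.Vec.Properties as Vec
open import Function.Base using (_∘_; id)
open import Function.Bundles using (Injection; mk↣)
open import Function.Definitions using (Injective)
open import Relation.Binary.PropositionalEquality
  using (_≡_; _≢_; refl; sym; trans; cong; cong₂; subst; subst₂)
open import Relation.Nullary using (¬_; Dec; yes; no; does; contradiction; _×-dec_)

-- The concentration has to beat a union bound over roughly m^ℓ position sets, which is why
-- exponential moments are used. Every probability is a count over all words of length m,
-- repetitions allowed: sums over words factor exactly, so independence is an identity, and words
-- with a repeated vertex are discarded at the end, being at most a quarter of all words once n ≥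
-- 4m². All estimates stay in ℕ. Densities are compared as u/Q against (u + 1)/Q, and edge
-- indicators are scaled by D = 8Qj with j = k - ℓ, so that rounding the conditional means to
-- integers costs only a fraction of the gap 1/Q. The family may be infinite, and the member found
-- may vary with x and with H, so the pigeonhole runs over the at most 2^(2^m) edge predicates on
-- the positions and not over the members of 𝓕. The constants then depend on m alone, and every
-- member found has at most m vertices.

private
  variable
    A B : Set
    k m n f : ℕ

-- Sums and indicators

∑ : List A → (A → ℕ) → ℕ
∑ []       f = 0
∑ (x ∷ xs) f = f x + ∑ xs f

∑-cong : ∀ (xs : List A) {f g : A → ℕ} → (∀ x → f x ≡ g x) → ∑ xs f ≡ ∑ xs g
∑-cong []       f≗g = refl
∑-cong (x ∷ xs) f≗g = cong₂ _+_ (f≗g x) (∑-cong xs f≗g)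

∑-mono : ∀ (xs : List A) {f g : A → ℕ} → (∀ x → f x ≤ g x) → ∑ xs f ≤ ∑ xs g
∑-mono []       f≤g = z≤n
∑-mono (x ∷ xs) f≤g = ℕ.+-mono-≤ (f≤g x) (∑-mono xs f≤g)

∑-+ : ∀ (xs : List A) (f g : A → ℕ) → ∑ xs (λ x → f x + g x) ≡ ∑ xs f + ∑ xs g
∑-+ []       f g = refl
∑-+ (x ∷ xs) f g = trans (cong (f x + g x +_) (∑-+ xs f g)) (interchange (f x) (g x) (∑ xs f) (∑ xs g))
  where
  interchange : ∀ a b c d → (a + b) + (c + d) ≡ (a + c) + (b + d)
  interchange = solve-∀

∑-*ˡ : ∀ (xs : List A) c (f : A → ℕ) → ∑ xs (λ x → c * f x) ≡ c * ∑ xs f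
∑-*ˡ []       c f = sym (ℕ.*-zeroʳ c)
∑-*ˡ (x ∷ xs) c f = trans (cong (c * f x +_) (∑-*ˡ xs c f)) (sym (ℕ.*-distribˡ-+ c (f x) _))

∑-*ʳ : ∀ (xs : List A) c (f : A → ℕ) → ∑ xs (λ x → f x * c) ≡ ∑ xs f * c
∑-*ʳ xs c f = trans (∑-cong xs (λ x → ℕ.*-comm (f x) c)) (trans (∑-*ˡ xs c f) (ℕ.*-comm c _))

∑-const : ∀ (xs : List A) c → ∑ xs (λ _ → c) ≡ length xs * c
∑-const []       c = refl
∑-const (x ∷ xs) c = cong (c +_) (∑-const xs c)

∑-0 : ∀ (xs : List A) → ∑ xs (λ _ → 0) ≡ 0
∑-0 xs = trans (∑-const xs 0) (ℕ.*-zeroʳ (length xs))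

∑-≤ : ∀ (xs : List A) {f : A → ℕ} {c} → (∀ x → f x ≤ c) → ∑ xs f ≤ length xs * c
∑-≤ xs {c = c} f≤c = ℕ.≤-trans (∑-mono xs f≤c) (ℕ.≤-reflexive (∑-const xs c))

∑-swap : ∀ (xs : List A) (ys : List B) (f : A → B → ℕ) →
         ∑ xs (λ x → ∑ ys (f x)) ≡ ∑ ys (λ y → ∑ xs (λ x → f x y))
∑-swap []       ys f = sym (∑-0 ys)
∑-swap (x ∷ xs) ys f =
  trans (cong (∑ ys (f x) +_) (∑-swap xs ys f)) (sym (∑-+ ys (f x) (λ y → ∑ xs (λ x → f x y))))

∑-++ : ∀ (xs ys : List A) (f : A → ℕ) → ∑ (xs ++ ys) f ≡ ∑ xs f + ∑ ys f
∑-++ []       ys f = refl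
∑-++ (x ∷ xs) ys f = trans (cong (f x +_) (∑-++ xs ys f)) (sym (ℕ.+-assoc (f x) _ _))

∑-map : ∀ (h : A → B) xs (f : B → ℕ) → ∑ (map h xs) f ≡ ∑ xs (f ∘ h)
∑-map h []       f = refl
∑-map h (x ∷ xs) f = cong (f (h x) +_) (∑-map h xs f)

∑-concatMap : ∀ (h : A → List B) xs (f : B → ℕ) → ∑ (concatMap h xs) f ≡ ∑ xs (λ x → ∑ (h x) f)
∑-concatMap h []       f = refl
∑-concatMap h (x ∷ xs) f = trans (∑-++ (h x) _ f) (cong (∑ (h x) f +_) (∑-concatMap h xs f))

∑-∈ : ∀ {x} {xs : List A} (f : A → ℕ) → x ∈ˡ xs → f x ≤ ∑ xs f
∑-∈ f (here refl)  = ℕ.m≤m+n _ _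
∑-∈ f (there x∈xs) = ℕ.≤-trans (∑-∈ f x∈xs) (ℕ.m≤n+m _ _)

∑-tabulate : ∀ (g : Fin n → A) (f : A → ℕ) → ∑ (List.tabulate g) f ≡ ∑ (allFin n) (f ∘ g)
∑-tabulate g f = ∑-tabulate₂ g id (λ _ → refl)
  where
  ∑-tabulate₂ : ∀ {n} {A B : Set} (g : Fin n → A) (h : Fin n → B) {f e} → (∀ i → f (g i) ≡ e (h i)) →
                ∑ (List.tabulate g) f ≡ ∑ (List.tabulate h) e
  ∑-tabulate₂ {zero}  g h eq = refl
  ∑-tabulate₂ {suc n} g h eq = cong₂ _+_ (eq zero) (∑-tabulate₂ (g ∘ suc) (h ∘ suc) (eq ∘ suc))

∑-toList : ∀ (x : Vec A n) (f : A → ℕ) → ∑ (toList x) f ≡ ∑ (allFin n) (f ∘ lookup x)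
∑-toList x f = trans (tabulated x) (∑-tabulate (lookup x) f)
  where
  tabulated : ∀ {n} (x : Vec _ n) → ∑ (toList x) f ≡ ∑ (List.tabulate (lookup x)) f
  tabulated []      = refl
  tabulated (v ∷ x) = cong (f v +_) (tabulated x)

ι : Bool → ℕ
ι b = if b then 1 else 0

ι≤1 : ∀ b → ι b ≤ 1
ι≤1 true  = ℕ.≤-refl
ι≤1 false = z≤n

ι≤ : ∀ b {m} → (T b → 1 ≤ m) → ι b ≤ m
ι≤ true  1≤m = 1≤m tt
ι≤ false 1≤m = z≤n

T⇒1≤ι : ∀ {b} → T b → 1 ≤ ι b
T⇒1≤ι {true} _ = ℕ.≤-refl

ι-false : ∀ {b} → ¬ T b → ι b ≡ 0
ι-false {true}  ¬t = ⊥-elim (¬t tt)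
ι-false {false} _  = refl

ι-mono : ∀ {a b} → (T a → T b) → ι a ≤ ι b
ι-mono {a} a⇒b = ι≤ a (λ t → T⇒1≤ι (a⇒b t))

ι-cong : ∀ {a b} → (T a → T b) → (T b → T a) → ι a ≡ ι b
ι-cong a⇒b b⇒a = ℕ.≤-antisym (ι-mono a⇒b) (ι-mono b⇒a)

T-does⁺ : ∀ {P : Set} (d : Dec P) → P → T (does d)
T-does⁺ (yes _) _ = tt
T-does⁺ (no ¬p) p = ¬p p

T-does⁻ : ∀ {P : Set} (d : Dec P) → T (does d) → P
T-does⁻ (yes p) _ = p

ι*≤ : ∀ {P : Set} (d : Dec P) {t w} → (P → t ≤ w) → ι (does d) * t ≤ w
ι*≤ (yes p) t≤w = ℕ.≤-trans (ℕ.≤-reflexive (ℕ.*-identityˡ _)) (t≤w p)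
ι*≤ (no  _) t≤w = z≤n

T-∧⁺ : ∀ {a b} → T a → T b → T (a ∧ b)
T-∧⁺ {true} _ t = t

T-∧⁻ : ∀ {a b} → T (a ∧ b) → T a × T b
T-∧⁻ {true} t = tt , t

T-not⁻ : ∀ {b} → T (not b) → ¬ T b
T-not⁻ {false} _ ()

length-filter : ∀ {P : A → Set} (P? : ∀ x → Dec (P x)) xs →
                length (filter P? xs) ≡ ∑ xs (λ x → ι (does (P? x)))
length-filter P? []       = refl
length-filter P? (x ∷ xs) with does (P? x)
... | true  = cong suc (length-filter P? xs)
... | false = length-filter P? xs

-- Words over a list, and Fubini identities for sums over them

words : List A → (j : ℕ) → List (Vec A j)
words xs zero    = [] ∷ []
words xs (suc j) = concatMap (λ v → map (v ∷_) (words xs j)) xs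

∑-words : ∀ (xs : List A) {j} (f : Vec A (suc j) → ℕ) →
          ∑ (words xs (suc j)) f ≡ ∑ xs (λ v → ∑ (words xs j) (λ y → f (v ∷ y)))
∑-words xs {j} f =
  trans (∑-concatMap _ xs f) (∑-cong xs (λ v → ∑-map (v ∷_) (words xs j) f))

length-words : ∀ (xs : List A) j → length (words xs j) ≡ length xs ^ j
length-words xs j = trans (sym (trans (∑-const (words xs j) 1) (ℕ.*-identityʳ _))) (count j)
  where
  count : ∀ j → ∑ (words xs j) (λ _ → 1) ≡ length xs ^ j
  count zero    = refl
  count (suc j) = trans (∑-words xs (λ _ → 1))
                    (trans (∑-cong xs (λ _ → count j)) (∑-const xs _))

length-words-allFin : ∀ n j → length (words (allFin n) j) ≡ n ^ j
length-words-allFin n j = trans (length-words (allFin n) j) (cong (_^ j) (List.length-tabulate {n = n} id))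

∈-words : ∀ {xs : List A} {j} (y : Vec A j) → (∀ i → lookup y i ∈ˡ xs) → y ∈ˡ words xs j
∈-words []      y∈ = here refl
∈-words (v ∷ y) y∈ = List∈.∈-concatMap⁺ _
  (Any.map (λ { refl → List∈.∈-map⁺ (v ∷_) (∈-words y (y∈ ∘ suc)) }) (y∈ zero))

∏ : ∀ {j} → (Fin j → A → ℕ) → Vec A j → ℕ
∏ w []      = 1
∏ w (v ∷ y) = w zero v * ∏ (w ∘ suc) y

∑-∏ : ∀ (xs : List A) {j} (w : Fin (suc j) → A → ℕ) →
      ∑ (words xs (suc j)) (∏ w) ≡ ∑ xs (w zero) * ∑ (words xs j) (∏ (w ∘ suc))
∑-∏ xs {j} w = trans (∑-words xs (∏ w))
  (trans (∑-cong xs (λ v → ∑-*ˡ (words xs j) (w zero v) _)) (∑-*ʳ xs _ (w zero)))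

-- Fubini with the `a`-th entry outermost. It makes the section at a sampled vertex independent of
-- the rest of the sample.
∑-removeAt : ∀ (xs : List A) {m} (a : Fin (suc m)) (f : A → Vec A m → ℕ) →
             ∑ (words xs (suc m)) (λ x → f (lookup x a) (removeAt x a)) ≡
             ∑ xs (λ v → ∑ (words xs m) (f v))
∑-removeAt xs         zero    f = ∑-words xs _
∑-removeAt xs {suc m} (suc a) f =
  trans (∑-words xs _)
    (trans (∑-cong xs (λ w → trans (∑-cong (words xs (suc m)) (λ { (_ ∷ _) → refl }))
                                   (∑-removeAt xs a (λ v x → f v (w ∷ x)))))
      (trans (∑-swap xs xs _) (∑-cong xs (λ v → sym (∑-words xs (f v))))))

sel : ∀ {m} (P : Subset m) → Vec A m → Vec A ∣ P ∣
sel []            []      = []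
sel (inside  ∷ P) (v ∷ x) = v ∷ sel P x
sel (outside ∷ P) (v ∷ x) = sel P x

∑-sel : ∀ (xs : List A) {m} (P : Subset m) (f : Vec A ∣ P ∣ → Vec A ∣ ∁ P ∣ → ℕ) →
        ∑ (words xs m) (λ x → f (sel P x) (sel (∁ P) x)) ≡
        ∑ (words xs ∣ P ∣) (λ u → ∑ (words xs ∣ ∁ P ∣) (f u))
∑-sel xs []            f = sym (ℕ.+-identityʳ _)
∑-sel xs (inside  ∷ P) f = trans (∑-words xs _)
  (trans (∑-cong xs (λ v → ∑-sel xs P (λ u → f (v ∷ u)))) (sym (∑-words xs _)))
∑-sel xs (outside ∷ P) f = trans (∑-words xs _)
  (trans (∑-cong xs (λ v → ∑-sel xs P (λ u y → f u (v ∷ y))))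
    (trans (∑-swap xs (words xs ∣ P ∣) _)
      (∑-cong (words xs ∣ P ∣) (λ u → sym (∑-words xs (f u))))))

-- Numerical estimates

-- Bernoulli's inequality (1 - k/M)^j ≥ 1 - jk/M with M = b + k, multiplied by M^(j+1).
^-+-bound : ∀ b k j → (b + k) ^ suc j ≤ (b + k) * b ^ j + j * k * (b + k) ^ j
^-+-bound b k zero    = ℕ.m≤m+n _ 0
^-+-bound b k (suc j) = begin
  (b + k) * (b + k) ^ suc j
    ≤⟨ ℕ.*-monoʳ-≤ (b + k) (^-+-bound b k j) ⟩
  (b + k) * ((b + k) * b ^ j + j * k * (b + k) ^ j)
    ≡⟨ expand b k j (b ^ j) ((b + k) ^ j) ⟩
  (b + k) * (b * b ^ j) + (k * ((b + k) * b ^ j) + j * k * ((b + k) * (b + k) ^ j))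
    ≤⟨ ℕ.+-monoʳ-≤ ((b + k) * b ^ suc j) (ℕ.+-monoˡ-≤ _
         (ℕ.*-monoʳ-≤ k (ℕ.*-monoʳ-≤ (b + k) (ℕ.^-monoˡ-≤ j (ℕ.m≤m+n b k))))) ⟩
  (b + k) * (b * b ^ j) + (k * ((b + k) * (b + k) ^ j) + j * k * ((b + k) * (b + k) ^ j))
    ≡⟨ cong ((b + k) * (b * b ^ j) +_) (collect k j ((b + k) * (b + k) ^ j)) ⟩
  (b + k) * b ^ suc j + suc j * k * (b + k) ^ suc j ∎
  where
  open ℕ.≤-Reasoning
  expand : ∀ b k j p q → (b + k) * ((b + k) * p + j * k * q) ≡
                         (b + k) * (b * p) + (k * ((b + k) * p) + j * k * ((b + k) * q))
  expand = solve-∀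
  collect : ∀ k j q → k * q + j * k * q ≡ suc j * k * q
  collect = solve-∀

-- The loss jk/(b + k) in `^-+-bound` is below 1/(c + 1), so (b/(b + k))^j exceeds c/(c + 1). It
-- serves both for n^j against (n - j)^j and for size^j against b^j.
^-+-< : ∀ c b k j → suc c * (j * k) < b + k → c * (b + k) ^ j < suc c * b ^ j
^-+-< c b k j big = ℕ.≰⇒> λ small → ℕ.<-irrefl refl (begin-strict
  suc c * (M * M ^ j)
    ≤⟨ ℕ.*-monoʳ-≤ (suc c) (^-+-bound b k j) ⟩
  suc c * (M * b ^ j + j * k * M ^ j)
    ≡⟨ expand c M (b ^ j) j k (M ^ j) ⟩
  M * (suc c * b ^ j) + suc c * (j * k) * M ^ j
    ≤⟨ ℕ.+-monoˡ-≤ _ (ℕ.*-monoʳ-≤ M small) ⟩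
  M * (c * M ^ j) + suc c * (j * k) * M ^ j
    <⟨ ℕ.+-monoʳ-< (M * (c * M ^ j)) (ℕ.*-monoˡ-< (M ^ j) {{ℕ.m^n≢0 M j}} big) ⟩
  M * (c * M ^ j) + M * M ^ j
    ≡⟨ collect c M (M ^ j) ⟩
  suc c * (M * M ^ j) ∎)
  where
  open ℕ.≤-Reasoning
  M = b + k
  instance
    M≢0 : NonZero M
    M≢0 = ℕ.>-nonZero (ℕ.≤-<-trans z≤n big)
  expand : ∀ c M p j k q → suc c * (M * p + j * k * q) ≡ M * (suc c * p) + suc c * (j * k) * q
  expand = solve-∀
  collect : ∀ c M q → M * (c * q) + M * q ≡ suc c * (M * q)
  collect = solve-∀

-- (1 + 1/a)^e ≥ 1 + e/a with denominators cleared.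
bernoulli : ∀ a e → a ^ e * (a + e) ≤ a * suc a ^ e
bernoulli a zero    = ℕ.≤-reflexive (base a)
  where
  base : ∀ a → 1 * (a + 0) ≡ a * 1
  base = solve-∀
bernoulli a (suc e) = begin
  a * a ^ e * (a + suc e)            ≤⟨ ℕ.m≤m+n _ (a ^ e * e) ⟩
  a * a ^ e * (a + suc e) + a ^ e * e ≡⟨ rearrange a (a ^ e) e ⟩
  suc a * (a ^ e * (a + e))          ≤⟨ ℕ.*-monoʳ-≤ (suc a) (bernoulli a e) ⟩
  suc a * (a * suc a ^ e)            ≡⟨ swap a (suc a ^ e) ⟩
  a * (suc a * suc a ^ e)            ∎
  where
  open ℕ.≤-Reasoning
  rearrange : ∀ a p e → a * p * (a + suc e) + p * e ≡ suc a * (p * (a + e))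
  rearrange = solve-∀
  swap : ∀ a p → suc a * (a * p) ≡ a * (suc a * p)
  swap = solve-∀

-- (1 + 1/a)^e ≤ 1 + e/a + (e/a)², the counterpart of `bernoulli`. In the induction the new term
-- e²/a³ is absorbed by (e + 1)/a², which is where e ≤ a enters.
suc-^-upper : ∀ a e → e ≤ a → a * a * suc a ^ e ≤ a ^ e * (a * a + e * a + e * e)
suc-^-upper a zero    _   = ℕ.≤-reflexive (base a)
  where
  base : ∀ a → a * a * 1 ≡ 1 * (a * a + 0 * a + 0 * 0)
  base = solve-∀
suc-^-upper a (suc e) e<a = begin
  a * a * (suc a * suc a ^ e)                     ≡⟨ swap a (suc a ^ e) ⟩
  suc a * (a * a * suc a ^ e)                     ≤⟨ ℕ.*-monoʳ-≤ (suc a) (suc-^-upper a e (ℕ.<⇒≤ e<a)) ⟩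
  suc a * (a ^ e * (a * a + e * a + e * e))       ≡⟨ expand a (a ^ e) e ⟩
  a ^ e * (a * (a * a + suc e * a + (e + e * e)) + e * e)
    ≤⟨ ℕ.*-monoʳ-≤ (a ^ e) (ℕ.+-monoʳ-≤ _ (ℕ.*-mono-≤ (ℕ.<⇒≤ e<a) (ℕ.n≤1+n e))) ⟩
  a ^ e * (a * (a * a + suc e * a + (e + e * e)) + a * suc e) ≡⟨ collect a (a ^ e) e ⟩
  a * a ^ e * (a * a + suc e * a + suc e * suc e) ∎
  where
  open ℕ.≤-Reasoning
  swap : ∀ a p → a * a * (suc a * p) ≡ suc a * (a * a * p)
  swap = solve-∀
  expand : ∀ a p e → suc a * (p * (a * a + e * a + e * e)) ≡
                     p * (a * (a * a + suc e * a + (e + e * e)) + e * e)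
  expand = solve-∀
  collect : ∀ a p e → p * (a * (a * a + suc e * a + (e + e * e)) + a * suc e) ≡
                      a * p * (a * a + suc e * a + suc e * suc e)
  collect = solve-∀

*-square-^ : ∀ x e → x ^ (2 * e) ≡ (x * x) ^ e
*-square-^ x e = trans (sym (ℕ.^-*-assoc x 2 e)) (cong (λ y → (x * y) ^ e) (ℕ.*-identityʳ x))

*-^ : ∀ x y e → (x * y) ^ e ≡ x ^ e * y ^ e
*-^ x y zero    = refl
*-^ x y (suc e) = trans (cong (x * y *_) (*-^ x y e)) (swap x y (x ^ e) (y ^ e))
  where
  swap : ∀ x y p q → x * y * (p * q) ≡ x * p * (y * q)
  swap = solve-∀

-- Bernoulli gives q R^q ≤ R (R + 1)^q; its (2e)-th power beats (b + s)^e for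
-- b = 2eq once q² exceeds R² (b + s).
exponential-dominates : ∀ R c e s B → 1 ≤ R → 1 ≤ e →
                        ∃ λ b → B ≤ b × (c * (b + s)) ^ e * R ^ b ≤ suc R ^ b
exponential-dominates R c e s B 1≤R 1≤e = b , B≤b ,
  ℕ.*-cancelˡ-≤ (R ^ (2 * e)) {{ℕ.m^n≢0 R (2 * e) {{ℕ.>-nonZero 1≤R}}}} (begin
    R ^ (2 * e) * ((c * (b + s)) ^ e * R ^ b)     ≡⟨ ℕ.*-assoc (R ^ (2 * e)) _ _ ⟨
    R ^ (2 * e) * (c * (b + s)) ^ e * R ^ b       ≡⟨ cong (λ z → z * (c * (b + s)) ^ e * R ^ b) (*-square-^ R e) ⟩
    (R * R) ^ e * (c * (b + s)) ^ e * R ^ b       ≡⟨ cong (_* R ^ b) (*-^ (R * R) (c * (b + s)) e) ⟨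
    (R * R * (c * (b + s))) ^ e * R ^ b           ≤⟨ ℕ.*-monoˡ-≤ (R ^ b) (ℕ.^-monoˡ-≤ e square) ⟩
    (q * q) ^ e * R ^ b                           ≡⟨ cong₂ _*_ (sym (*-square-^ q e)) (sym (ℕ.^-*-assoc R q (2 * e))) ⟩
    q ^ (2 * e) * (R ^ q) ^ (2 * e)               ≡⟨ *-^ q (R ^ q) (2 * e) ⟨
    (q * R ^ q) ^ (2 * e)                         ≤⟨ ℕ.^-monoˡ-≤ (2 * e) linear ⟩
    (R * suc R ^ q) ^ (2 * e)                     ≡⟨ *-^ R (suc R ^ q) (2 * e) ⟩
    R ^ (2 * e) * (suc R ^ q) ^ (2 * e)           ≡⟨ cong (R ^ (2 * e) *_) (ℕ.^-*-assoc (suc R) q (2 * e)) ⟩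
    R ^ (2 * e) * suc R ^ b                       ∎)
  where
  open ℕ.≤-Reasoning
  q = suc (R * R * (c * (2 * e + s)) + B)
  b = q * (2 * e)
  B≤b : B ≤ b
  B≤b = ℕ.≤-trans (ℕ.m≤n⇒m≤1+n (ℕ.m≤n+m B _))
          (ℕ.m≤m*n q (2 * e) {{ℕ.>-nonZero (ℕ.≤-trans 1≤e (ℕ.m≤n*m e 2))}})
  square : R * R * (c * (b + s)) ≤ q * q
  square = begin
    R * R * (c * (q * (2 * e) + s))     ≤⟨ ℕ.*-monoʳ-≤ (R * R) (ℕ.*-monoʳ-≤ c (ℕ.+-monoʳ-≤ b (ℕ.m≤n*m s q))) ⟩
    R * R * (c * (q * (2 * e) + q * s)) ≡⟨ factor R c q e s ⟩
    R * R * (c * (2 * e + s)) * q       ≤⟨ ℕ.*-monoˡ-≤ q {R * R * (c * (2 * e + s))} (ℕ.m≤n⇒m≤1+n (ℕ.m≤m+n _ B)) ⟩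
    q * q                               ∎
    where
    factor : ∀ R c q e s → R * R * (c * (q * (2 * e) + q * s)) ≡ R * R * (c * (2 * e + s)) * q
    factor = solve-∀
  linear : q * R ^ q ≤ R * suc R ^ q
  linear = begin
    q * R ^ q       ≡⟨ ℕ.*-comm q _ ⟩
    R ^ q * q       ≤⟨ ℕ.*-monoʳ-≤ (R ^ q) (ℕ.m≤n+m q R) ⟩
    R ^ q * (R + q) ≤⟨ bernoulli R q ⟩
    R * suc R ^ q   ∎

C-absorb : ∀ n k → suc k * (suc n C suc k) ≡ suc n * (n C k)
C-absorb zero    zero    = refl
C-absorb zero    (suc k) = ℕ.*-zeroʳ k
C-absorb (suc n) zero    = trans (ℕ.*-identityˡ _) (trans (ℕ.nC1≡n (suc (suc n))) (sym (ℕ.*-identityʳ _)))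
C-absorb (suc n) (suc k) = begin-equality
  suc (suc k) * (suc (suc n) C suc (suc k))
    ≡⟨ cong (suc (suc k) *_) (sym (ℕ.nCk+nC[k+1]≡[n+1]C[k+1] (suc n) (suc k))) ⟩
  suc (suc k) * (c + (suc n C suc (suc k)))
    ≡⟨ expand k c (suc n C suc (suc k)) ⟩
  suc k * c + c + suc (suc k) * (suc n C suc (suc k))
    ≡⟨ cong₂ (λ p q → p + c + q) (C-absorb n k) (C-absorb n (suc k)) ⟩
  suc n * (n C k) + c + suc n * (n C suc k)
    ≡⟨ collect n (n C k) c (n C suc k) ⟩
  c + suc n * ((n C k) + (n C suc k))
    ≡⟨ cong (λ p → c + suc n * p) (ℕ.nCk+nC[k+1]≡[n+1]C[k+1] n k) ⟩
  suc (suc n) * c ∎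
  where
  open ℕ.≤-Reasoning
  c = suc n C suc k
  expand : ∀ k c d → suc (suc k) * (c + d) ≡ suc k * c + c + suc (suc k) * d
  expand = solve-∀
  collect : ∀ n p c d → suc n * p + c + suc n * d ≡ c + suc n * (p + d)
  collect = solve-∀

!*C-suc : ∀ n j → suc j ! * (suc n C suc j) ≡ suc n * (j ! * (n C j))
!*C-suc n j = trans (regroup (suc j) (j !) _) (trans (cong (j ! *_) (C-absorb n j)) (swap (j !) (suc n) _))
  where
  regroup : ∀ a b c → a * b * c ≡ b * (a * c)
  regroup = solve-∀
  swap : ∀ a b c → a * (b * c) ≡ b * (a * c)
  swap = solve-∀

!*C≤^ : ∀ n j → j ! * (n C j) ≤ n ^ j
!*C≤^ n       zero    = ℕ.≤-refl
!*C≤^ zero    (suc j) = ℕ.≤-reflexive (ℕ.*-zeroʳ (suc j !))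
!*C≤^ (suc n) (suc j) = begin
  suc j ! * (suc n C suc j)  ≡⟨ !*C-suc n j ⟩
  suc n * (j ! * (n C j))    ≤⟨ ℕ.*-monoʳ-≤ (suc n) (!*C≤^ n j) ⟩
  suc n * n ^ j              ≤⟨ ℕ.*-monoʳ-≤ (suc n) (ℕ.^-monoˡ-≤ j (ℕ.n≤1+n n)) ⟩
  suc n * suc n ^ j          ∎
  where open ℕ.≤-Reasoning

-- The right side is the product (b + 1)⋯(b + j). With `!*C≤^` this sandwiches j! C(n, j) between (n
-- - j)^j and n^j.
^≤!*C : ∀ b j → b ^ j ≤ j ! * ((b + j) C j)
^≤!*C b zero    = ℕ.≤-refl
^≤!*C b (suc j) = begin
  b * b ^ j                          ≤⟨ ℕ.*-mono-≤ (ℕ.m≤n⇒m≤1+n (ℕ.m≤m+n b j)) (^≤!*C b j) ⟩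
  suc (b + j) * (j ! * ((b + j) C j)) ≡⟨ !*C-suc (b + j) j ⟨
  suc j ! * (suc (b + j) C suc j)    ≡⟨ cong (λ z → suc j ! * (z C suc j)) (ℕ.+-suc b j) ⟨
  suc j ! * ((b + suc j) C suc j)    ∎
  where open ℕ.≤-Reasoning

C≤^ : ∀ n j → n C j ≤ n ^ j
C≤^ n j = ℕ.≤-trans (ℕ.m≤n*m (n C j) (j !) {{j !≢0}}) (!*C≤^ n j)
  where open import Data.Nat.Properties using (_!≢0)

-- Chernoff bound

-- With R = `rate D`, each sampled vertex contributes a factor R/(R + 1) to the tail bound. This is
-- 2a + 2D + 1 for a = 2D², chosen large enough for every threshold at once.
rate : ℕ → ℕ
rate D = 2 * (2 * (D * D)) + 2 * D + 1

-- The moment generating function at A/(A + 1), scaled by (A + 1)^D: a value d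
-- gets the weight A^d (A + 1)^(D ∸ d).  With A = 2D² the second-order terms
-- are too small to hide a deviation of 1 from the mean.
module Chernoff {A : Set} (V : List A) (D : ℕ) (1≤D : 1 ≤ D)
                (d : A → ℕ) (d≤D : ∀ v → d v ≤ D) where

  a = 2 * (D * D)
  R = rate D

  φ : A → ℕ
  φ v = a ^ d v * suc a ^ (D ∸ d v)

  private
    N = length V

    D≤a : D ≤ a
    D≤a = ℕ.≤-trans (ℕ.m≤m*n D D {{ℕ.>-nonZero 1≤D}}) (ℕ.m≤n*m (D * D) 2)

    instance
      a≢0 : NonZero a
      a≢0 = ℕ.>-nonZero (ℕ.≤-trans 1≤D D≤a)

  -- Divided by a² a^D, the bound is 1 + e/a + D²/a² with e = D - d(v). It is affine in e, so the
  -- sum of the weights is controlled by the mean of `d` alone.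
  φ-upper : ∀ v → a * a * φ v ≤ a ^ D * (a * a + D * D) + a ^ D * a * (D ∸ d v)
  φ-upper v = begin
    a * a * (a ^ d v * suc a ^ e)               ≡⟨ swap a (a ^ d v) (suc a ^ e) ⟩
    a ^ d v * (a * a * suc a ^ e)               ≤⟨ ℕ.*-monoʳ-≤ (a ^ d v) (suc-^-upper a e (ℕ.≤-trans e≤D D≤a)) ⟩
    a ^ d v * (a ^ e * (a * a + e * a + e * e)) ≡⟨ ℕ.*-assoc (a ^ d v) (a ^ e) _ ⟨
    a ^ d v * a ^ e * (a * a + e * a + e * e)   ≡⟨ cong (_* (a * a + e * a + e * e)) power ⟩
    a ^ D * (a * a + e * a + e * e)             ≤⟨ ℕ.*-monoʳ-≤ (a ^ D) (ℕ.+-monoʳ-≤ (a * a + e * a) (ℕ.*-mono-≤ e≤D e≤D)) ⟩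
    a ^ D * (a * a + e * a + D * D)             ≡⟨ collect (a ^ D) a e D ⟩
    a ^ D * (a * a + D * D) + a ^ D * a * e     ∎
    where
    open ℕ.≤-Reasoning
    e = D ∸ d v
    e≤D : e ≤ D
    e≤D = ℕ.m∸n≤m D (d v)
    power : a ^ d v * a ^ e ≡ a ^ D
    power = trans (sym (ℕ.^-distribˡ-+-* a (d v) e)) (cong (a ^_) (ℕ.m+[n∸m]≡n (d≤D v)))
    swap : ∀ a p q → a * a * (p * q) ≡ p * (a * a * q)
    swap = solve-∀
    collect : ∀ p a e D → p * (a * a + e * a + D * D) ≡ p * (a * a + D * D) + p * a * e
    collect = solve-∀

  module _ (c h : ℕ) (1+c+h≡D : suc c + h ≡ D) (mean : suc c * N ≤ ∑ V d) where

    -- The weight that a value exactly `c` would have, since c + (h + 1) = D. The mean is at least c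
    -- + 1, one more than that.
    τ = a ^ c * suc a ^ suc h

    private
      deficit : ∑ V (λ v → D ∸ d v) ≤ N * h
      deficit = ℕ.+-cancelʳ-≤ (suc c * N) _ _ (begin
        ∑ V (λ v → D ∸ d v) + suc c * N       ≤⟨ ℕ.+-monoʳ-≤ (∑ V (λ v → D ∸ d v)) mean ⟩
        ∑ V (λ v → D ∸ d v) + ∑ V d           ≡⟨ ∑-+ V (λ v → D ∸ d v) d ⟨
        ∑ V (λ v → D ∸ d v + d v)             ≡⟨ ∑-cong V (λ v → ℕ.m∸n+n≡m (d≤D v)) ⟩
        ∑ V (λ _ → D)                         ≡⟨ ∑-const V D ⟩
        N * D                                 ≡⟨ cong (N *_) (sym 1+c+h≡D) ⟩
        N * (suc c + h)                       ≡⟨ expand N c h ⟩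
        N * h + suc c * N                     ∎)
        where
        open ℕ.≤-Reasoning
        expand : ∀ N c h → N * (suc c + h) ≡ N * h + suc c * N
        expand = solve-∀

      -- The average weight is at most a^D r/(2a) by `φ-sum`, while τ is at least a^D (r + 1)/(2a)
      -- by `τ-lower`; their quotient is therefore at most r/(r + 1).
      r = 2 * a + 2 * h + 1

      φ-sum : 2 * (a * a * ∑ V φ) ≤ N * (a ^ D * a) * r
      φ-sum = begin
        2 * (a * a * ∑ V φ)
          ≡⟨ cong (2 *_) (∑-*ˡ V (a * a) φ) ⟨
        2 * ∑ V (λ v → a * a * φ v)
          ≤⟨ ℕ.*-monoʳ-≤ 2 (∑-mono V φ-upper) ⟩
        2 * ∑ V (λ v → a ^ D * (a * a + D * D) + a ^ D * a * (D ∸ d v))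
          ≡⟨ cong (2 *_) (∑-+ V (λ _ → a ^ D * (a * a + D * D)) (λ v → a ^ D * a * (D ∸ d v))) ⟩
        2 * (∑ V (λ _ → a ^ D * (a * a + D * D)) + ∑ V (λ v → a ^ D * a * (D ∸ d v)))
          ≡⟨ cong (2 *_) (cong₂ _+_ (∑-const V _) (∑-*ˡ V (a ^ D * a) (λ v → D ∸ d v))) ⟩
        2 * (N * (a ^ D * (a * a + D * D)) + a ^ D * a * ∑ V (λ v → D ∸ d v))
          ≤⟨ ℕ.*-monoʳ-≤ 2 (ℕ.+-monoʳ-≤ (N * (a ^ D * (a * a + D * D))) (ℕ.*-monoʳ-≤ (a ^ D * a) deficit)) ⟩
        2 * (N * (a ^ D * (a * a + D * D)) + a ^ D * a * (N * h))
          ≡⟨ collect N (a ^ D) a (D * D) h ⟩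
        N * a ^ D * (2 * a * a + 2 * (D * D) + 2 * h * a)
          -- Here `2 * (D * D)` is `a` by definition: the quadratic error amounts to half of a unit
          -- step in `h`, leaving the other half as gain.
          ≡⟨ collect′ N (a ^ D) a h ⟩
        N * (a ^ D * a) * r ∎
        where
        open ℕ.≤-Reasoning
        collect : ∀ N p a s h → 2 * (N * (p * (a * a + s)) + p * a * (N * h)) ≡
                                N * p * (2 * a * a + 2 * s + 2 * h * a)
        collect = solve-∀
        collect′ : ∀ N p a h → N * p * (2 * a * a + a + 2 * h * a) ≡ N * (p * a) * (2 * a + 2 * h + 1)
        collect′ = solve-∀

      τ-lower : a ^ D * a * suc r ≤ 2 * (a * a * τ)
      τ-lower = begin
        a ^ D * a * suc r                       ≡⟨ cong (λ e → a ^ e * a * suc r) 1+c+h≡D ⟨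
        a ^ suc (c + h) * a * suc r             ≡⟨ cong (λ e → a ^ e * a * suc r) (ℕ.+-suc c h) ⟨
        a ^ (c + suc h) * a * suc r             ≡⟨ cong (λ p → p * a * suc r) (ℕ.^-distribˡ-+-* a c (suc h)) ⟩
        a ^ c * a ^ suc h * a * suc r           ≡⟨ regroup (a ^ c) (a ^ suc h) a h ⟩
        2 * (a * (a ^ c * (a ^ suc h * (a + suc h))))
          ≤⟨ ℕ.*-monoʳ-≤ 2 (ℕ.*-monoʳ-≤ a (ℕ.*-monoʳ-≤ (a ^ c) (bernoulli a (suc h)))) ⟩
        2 * (a * (a ^ c * (a * suc a ^ suc h))) ≡⟨ collect a (a ^ c) (suc a ^ suc h) ⟩
        2 * (a * a * τ)                         ∎
        where
        open ℕ.≤-Reasoning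
        regroup : ∀ p q a h → p * q * a * suc (2 * a + 2 * h + 1) ≡ 2 * (a * (p * (q * (a + suc h))))
        regroup = solve-∀
        collect : ∀ a p q → 2 * (a * (p * (a * q))) ≡ 2 * (a * a * (p * q))
        collect = solve-∀

      r-bound : ∑ V φ * suc r ≤ N * τ * r
      r-bound = ℕ.*-cancelˡ-≤ (2 * (a * a)) {{ℕ.m*n≢0 2 (a * a) {{_}} {{ℕ.m*n≢0 a a}}}} (begin
        2 * (a * a) * (∑ V φ * suc r)     ≡⟨ regroup a (∑ V φ) (suc r) ⟩
        2 * (a * a * ∑ V φ) * suc r       ≤⟨ ℕ.*-monoˡ-≤ (suc r) φ-sum ⟩
        N * (a ^ D * a) * r * suc r       ≡⟨ swap N (a ^ D * a) r (suc r) ⟩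
        N * r * (a ^ D * a * suc r)       ≤⟨ ℕ.*-monoʳ-≤ (N * r) τ-lower ⟩
        N * r * (2 * (a * a * τ))         ≡⟨ regroup′ N r a τ ⟩
        2 * (a * a) * (N * τ * r)         ∎)
        where
        open ℕ.≤-Reasoning
        regroup : ∀ a s r → 2 * (a * a) * (s * r) ≡ 2 * (a * a * s) * r
        regroup = solve-∀
        swap : ∀ N p r r′ → N * p * r * r′ ≡ N * r * (p * r′)
        swap = solve-∀
        regroup′ : ∀ N r a τ → N * r * (2 * (a * a * τ)) ≡ 2 * (a * a) * (N * τ * r)
        regroup′ = solve-∀

    -- Since x/(x + 1) increases with x, `r` may be replaced by r + 2(c + 1) = R, which removes the
    -- dependence on the threshold `c`.
    R-bound : ∑ V φ * suc R ≤ N * τ * R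
    R-bound = subst (λ R → ∑ V φ * suc R ≤ N * τ * R) r+2c+2≡R (begin
      ∑ V φ * suc (r + p)           ≡⟨ ℕ.*-distribˡ-+ (∑ V φ) (suc r) p ⟩
      ∑ V φ * suc r + ∑ V φ * p     ≤⟨ ℕ.+-mono-≤ r-bound (ℕ.*-monoˡ-≤ p φ≤τ) ⟩
      N * τ * r + N * τ * p         ≡⟨ ℕ.*-distribˡ-+ (N * τ) r p ⟨
      N * τ * (r + p)               ∎)
      where
      open ℕ.≤-Reasoning
      p = 2 * suc c
      φ≤τ : ∑ V φ ≤ N * τ
      φ≤τ = ℕ.*-cancelʳ-≤ _ _ (suc r) (ℕ.≤-trans r-bound (ℕ.*-monoʳ-≤ (N * τ) (ℕ.n≤1+n r)))
      r+2c+2≡R : r + p ≡ R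
      r+2c+2≡R = trans (regroup a h c) (cong (λ z → 2 * a + 2 * z + 1) 1+c+h≡D)
        where
        regroup : ∀ a h c → 2 * a + 2 * h + 1 + 2 * suc c ≡ 2 * a + 2 * (suc c + h) + 1
        regroup = solve-∀

    private
      φ-product : ∀ {b} (x : Vec A b) → ∏ (λ _ → φ) x ≡
                  a ^ ∑ (toList x) d * suc a ^ ∑ (toList x) (λ v → D ∸ d v)
      φ-product []      = refl
      φ-product (v ∷ x) = trans (cong (φ v *_) (φ-product x))
        (trans (interchange (a ^ d v) _ _ _)
          (sym (cong₂ _*_ (ℕ.^-distribˡ-+-* a (d v) _) (ℕ.^-distribˡ-+-* (suc a) (D ∸ d v) _))))
        where
        interchange : ∀ p q r s → p * q * (r * s) ≡ p * r * (q * s)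
        interchange = solve-∀

      total : ∀ {b} (x : Vec A b) → ∑ (toList x) d + ∑ (toList x) (λ v → D ∸ d v) ≡ D * b
      total {b} x = trans (sym (∑-+ (toList x) d (λ v → D ∸ d v)))
        (trans (∑-cong (toList x) (λ v → ℕ.m+[n∸m]≡n (d≤D v)))
          (trans (∑-const (toList x) D)
            (trans (cong (_* D) (Vec.length-toList x)) (ℕ.*-comm b D))))

      exchange : ∀ s e s′ e′ → s + e ≡ s′ + e′ → s ≤ s′ →
                 a ^ s′ * suc a ^ e′ ≤ a ^ s * suc a ^ e
      exchange s e s′ e′ eq s≤s′ = begin
        a ^ s′ * suc a ^ e′             ≡⟨ cong (λ z → a ^ z * suc a ^ e′) s+p≡s′ ⟨
        a ^ (s + p) * suc a ^ e′        ≡⟨ cong (_* suc a ^ e′) (ℕ.^-distribˡ-+-* a s p) ⟩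
        a ^ s * a ^ p * suc a ^ e′      ≤⟨ ℕ.*-monoˡ-≤ _ (ℕ.*-monoʳ-≤ (a ^ s) (ℕ.^-monoˡ-≤ p (ℕ.n≤1+n a))) ⟩
        a ^ s * suc a ^ p * suc a ^ e′  ≡⟨ ℕ.*-assoc (a ^ s) _ _ ⟩
        a ^ s * (suc a ^ p * suc a ^ e′) ≡⟨ cong (a ^ s *_) (ℕ.^-distribˡ-+-* (suc a) p e′) ⟨
        a ^ s * suc a ^ (p + e′)        ≡⟨ cong (λ z → a ^ s * suc a ^ z) p+e′≡e ⟩
        a ^ s * suc a ^ e               ∎
        where
        open ℕ.≤-Reasoning
        p = s′ ∸ s
        s+p≡s′ : s + p ≡ s′
        s+p≡s′ = ℕ.m+[n∸m]≡n s≤s′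
        p+e′≡e : p + e′ ≡ e
        p+e′≡e = ℕ.+-cancelˡ-≡ s _ _ (trans (sym (ℕ.+-assoc s p e′)) (trans (cong (_+ e′) s+p≡s′) (sym eq)))

      τ^≡ : ∀ b → τ ^ b ≡ a ^ (c * b) * suc a ^ (suc h * b)
      τ^≡ b = trans (*-^ (a ^ c) (suc a ^ suc h) b)
        (cong₂ _*_ (ℕ.^-*-assoc a c b) (ℕ.^-*-assoc (suc a) (suc h) b))

      low⇒τ≤φ : ∀ {b} (x : Vec A b) → ∑ (toList x) d < c * b → τ ^ b ≤ ∏ (λ _ → φ) x
      low⇒τ≤φ {b} x low = subst₂ _≤_ (sym (τ^≡ b)) (sym (φ-product x))
        (exchange (∑ (toList x) d) _ (c * b) (suc h * b)
          (trans (total x) (trans (cong (_* b) (sym (trans (ℕ.+-suc c h) 1+c+h≡D))) (ℕ.*-distribʳ-+ b c (suc h))))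
          (ℕ.<⇒≤ low))

      ∑-φ^ : ∀ b → ∑ (words V b) (∏ (λ _ → φ)) ≡ ∑ V φ ^ b
      ∑-φ^ zero    = refl
      ∑-φ^ (suc b) = trans (∑-∏ V {b} (λ _ → φ)) (cong (∑ V φ *_) (∑-φ^ b))

    -- Markov's inequality for the product weight: a word with a low sum weighs at least τ^b, the
    -- total weight is the b-th power of the one-letter sum, and `R-bound` compares the two.
    chernoff⁺ : ∀ b → ∑ (words V b) (λ x → ι (does (∑ (toList x) d ℕ.<? c * b))) * suc R ^ b ≤
                     R ^ b * N ^ b
    chernoff⁺ b = ℕ.*-cancelʳ-≤ _ _ (τ ^ b)
      {{ℕ.m^n≢0 τ b {{ℕ.m*n≢0 (a ^ c) _ {{ℕ.m^n≢0 a c}} {{ℕ.m^n≢0 (suc a) (suc h)}}}}}} (begin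
      ∑ (words V b) low * suc R ^ b * τ ^ b       ≡⟨ swap (∑ (words V b) low) (suc R ^ b) (τ ^ b) ⟩
      ∑ (words V b) low * τ ^ b * suc R ^ b       ≡⟨ cong (_* suc R ^ b) (∑-*ʳ (words V b) (τ ^ b) low) ⟨
      ∑ (words V b) (λ x → low x * τ ^ b) * suc R ^ b
        ≤⟨ ℕ.*-monoˡ-≤ (suc R ^ b) (∑-mono (words V b) weigh) ⟩
      ∑ (words V b) (∏ (λ _ → φ)) * suc R ^ b     ≡⟨ cong (_* suc R ^ b) (∑-φ^ b) ⟩
      ∑ V φ ^ b * suc R ^ b                       ≡⟨ *-^ (∑ V φ) (suc R) b ⟨
      (∑ V φ * suc R) ^ b                         ≤⟨ ℕ.^-monoˡ-≤ b R-bound ⟩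
      (N * τ * R) ^ b                             ≡⟨ *-^ (N * τ) R b ⟩
      (N * τ) ^ b * R ^ b                         ≡⟨ cong (_* R ^ b) (*-^ N τ b) ⟩
      N ^ b * τ ^ b * R ^ b                       ≡⟨ rotate (N ^ b) (τ ^ b) (R ^ b) ⟩
      R ^ b * N ^ b * τ ^ b                       ∎)
      where
      open ℕ.≤-Reasoning
      low : Vec A b → ℕ
      low x = ι (does (∑ (toList x) d ℕ.<? c * b))
      weigh : ∀ x → low x * τ ^ b ≤ ∏ (λ _ → φ) x
      weigh x = ι*≤ (∑ (toList x) d ℕ.<? c * b) (low⇒τ≤φ x)
      swap : ∀ p q r → p * q * r ≡ p * r * q
      swap = solve-∀
      rotate : ∀ p q r → p * q * r ≡ r * p * q
      rotate = solve-∀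

  chernoff : .{{_ : NonZero N}} → ∀ c b → c * N ≤ ∑ V d →
             ∑ (words V b) (λ x → ι (does (∑ (toList x) d ℕ.<? (c ∸ 1) * b))) * suc R ^ b ≤ R ^ b * N ^ b
  -- The threshold is `0 ∸ 1 = 0` here, and no sum lies below it.
  chernoff zero    b _    = ℕ.≤-trans (ℕ.≤-reflexive (cong (_* suc R ^ b) (∑-0 (words V b)))) z≤n
  chernoff (suc c) b mean = chernoff⁺ c (D ∸ suc c) (ℕ.m+[n∸m]≡n c<D) mean b
    where
    c<D : suc c ≤ D
    c<D = ℕ.*-cancelʳ-≤ _ _ N (ℕ.≤-trans mean
            (ℕ.≤-trans (∑-≤ V d≤D) (ℕ.≤-reflexive (ℕ.*-comm N D))))

-- Concentration of the density of g in a random sample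

infix 4 _≼_

-- Plays the role of inclusion of multisets, in the only form needed: every sum of natural weights
-- grows.
_≼_ : List A → List A → Set
xs ≼ ys = ∀ f → ∑ xs f ≤ ∑ ys f

words-≼ : ∀ {xs ys : List A} → xs ≼ ys → ∀ j → words xs j ≼ words ys j
words-≼           xs≼ys zero    f = ℕ.≤-refl
words-≼ {xs = xs} {ys} xs≼ys (suc j) f = begin
  ∑ (words xs (suc j)) f                            ≡⟨ ∑-words xs f ⟩
  ∑ xs (λ v → ∑ (words xs j) (λ y → f (v ∷ y)))     ≤⟨ ∑-mono xs (λ v → words-≼ xs≼ys j _) ⟩
  ∑ xs (λ v → ∑ (words ys j) (λ y → f (v ∷ y)))     ≤⟨ xs≼ys _ ⟩
  ∑ ys (λ v → ∑ (words ys j) (λ y → f (v ∷ y)))     ≡⟨ ∑-words ys f ⟨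
  ∑ (words ys (suc j)) f                            ∎
  where open ℕ.≤-Reasoning

removeAt-≼ : ∀ {m} (x : Vec A (suc m)) a → toList (removeAt x a) ≼ toList x
removeAt-≼ (v ∷ x)     zero    f = ℕ.m≤n+m _ (f v)
removeAt-≼ (v ∷ w ∷ x) (suc a) f = ℕ.+-monoʳ-≤ (f v) (removeAt-≼ (w ∷ x) a f)

sel-≼ : ∀ {m} (P : Subset m) (x : Vec A m) → toList (sel P x) ≼ toList x
sel-≼ []            []      f = z≤n
sel-≼ (inside  ∷ P) (v ∷ x) f = ℕ.+-monoʳ-≤ (f v) (sel-≼ P x f)
sel-≼ (outside ∷ P) (v ∷ x) f = ℕ.≤-trans (sel-≼ P x f) (ℕ.m≤n+m _ (f v))

module Typical (V : List A) .{{_ : NonZero (length V)}} (D : ℕ) (1≤D : 1 ≤ D) (b : ℕ) where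

  private
    N = length V
    R = rate D

  -- A lower bound for the mean of g over V^j, rounded at every coordinate so
  -- that it can be used as an integer threshold for a typical sample.
  level : ∀ j → (Vec A j → ℕ) → ℕ
  level zero    g = g []
  level (suc j) g = ∑ V (λ v → level j (λ y → g (v ∷ y))) / N ∸ 1

  level≤D : ∀ j {g} → (∀ y → g y ≤ D) → level j g ≤ D
  level≤D zero        g≤D = g≤D []
  level≤D (suc j) {g} g≤D = ℕ.≤-trans (ℕ.m∸n≤m (∑ V l / N) 1) (ℕ.*-cancelʳ-≤ (∑ V l / N) D N (begin
    ∑ V l / N * N   ≤⟨ ℕ.m/n*n≤m (∑ V l) N ⟩
    ∑ V l           ≤⟨ ∑-≤ V (λ v → level≤D j (λ y → g≤D (v ∷ y))) ⟩
    N * D           ≡⟨ ℕ.*-comm N D ⟩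
    D * N           ∎))
    where
    open ℕ.≤-Reasoning
    l = λ v → level j (λ y → g (v ∷ y))

  -- Each coordinate costs at most 2: less than 1 for the floor of the mean and 1 for the deviation
  -- allowed by `chernoff`.
  level-lower : ∀ j g → ∑ (words V j) g ≤ N ^ j * (level j g + 2 * j)
  level-lower zero    g = ℕ.≤-reflexive (base (g []))
    where
    base : ∀ x → x + 0 ≡ 1 * (x + 2 * 0)
    base = solve-∀
  level-lower (suc j) g = begin
    ∑ (words V (suc j)) g                           ≡⟨ ∑-words V g ⟩
    ∑ V (λ v → ∑ (words V j) (λ y → g (v ∷ y)))     ≤⟨ ∑-mono V (λ v → level-lower j _) ⟩
    ∑ V (λ v → N ^ j * (l v + 2 * j))               ≡⟨ ∑-*ˡ V (N ^ j) _ ⟩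
    N ^ j * ∑ V (λ v → l v + 2 * j)                 ≡⟨ cong (N ^ j *_) (trans (∑-+ V l _) (cong (∑ V l +_) (∑-const V (2 * j)))) ⟩
    N ^ j * (∑ V l + N * (2 * j))                   ≤⟨ ℕ.*-monoʳ-≤ (N ^ j) (ℕ.+-monoˡ-≤ (N * (2 * j)) floor) ⟩
    N ^ j * (N * (c ∸ 1 + 2) + N * (2 * j))         ≡⟨ collect (N ^ j) N (c ∸ 1) j ⟩
    N * N ^ j * (c ∸ 1 + 2 * suc j)                 ∎
    where
    open ℕ.≤-Reasoning
    l = λ v → level j (λ y → g (v ∷ y))
    c = ∑ V l / N
    floor : ∑ V l ≤ N * (c ∸ 1 + 2)
    floor = begin
      ∑ V l               ≡⟨ ℕ.m≡m%n+[m/n]*n (∑ V l) N ⟩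
      ∑ V l % N + c * N   ≤⟨ ℕ.+-monoˡ-≤ (c * N) (ℕ.<⇒≤ (ℕ.m%n<n (∑ V l) N)) ⟩
      suc c * N           ≤⟨ ℕ.*-monoˡ-≤ N (ℕ.s≤s (ℕ.m≤n+m∸n c 1)) ⟩
      (2 + (c ∸ 1)) * N   ≡⟨ trans (ℕ.*-comm _ N) (cong (N *_) (ℕ.+-comm 2 (c ∸ 1))) ⟩
      N * (c ∸ 1 + 2)     ∎
    collect : ∀ p N c j → p * (N * (c + 2) + N * (2 * j)) ≡ N * p * (c + 2 * suc j)
    collect = solve-∀

  -- The threshold is normalised by `b ^ j` and not by the length of the sample, because the
  -- recursion removes entries; at least `b` of them always remain.
  atypical : ∀ j → (Vec A j → ℕ) → List A → Bool
  atypical j g xs = does (∑ (words xs j) g ℕ.<? level j g * b ^ j)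

  -- Chernoff is applied to the last `b` entries. The earlier ones can only raise the sum, so each
  -- of them just contributes a factor N.
  low-count : ∀ (d : A → ℕ) → (∀ v → d v ≤ D) → ∀ {m} → b ≤ m →
              ∑ (words V m) (λ x → ι (does (∑ (toList x) d ℕ.<? (∑ V d / N ∸ 1) * b))) * suc R ^ b ≤
              R ^ b * N ^ m
  low-count d d≤D {m} b≤m =
    subst (λ m → ∑ (words V m) low * suc R ^ b ≤ R ^ b * N ^ m) (ℕ.m∸n+n≡m b≤m) (extend (m ∸ b))
    where
    open ℕ.≤-Reasoning
    c = ∑ V d / N
    low : ∀ {m} → Vec A m → ℕ
    low x = ι (does (∑ (toList x) d ℕ.<? (c ∸ 1) * b))
    extend : ∀ i → ∑ (words V (i + b)) low * suc R ^ b ≤ R ^ b * N ^ (i + b)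
    extend zero    = Chernoff.chernoff V D 1≤D d d≤D c b (ℕ.m/n*n≤m (∑ V d) N)
    extend (suc i) = begin
      ∑ (words V (suc i + b)) low * suc R ^ b
        ≡⟨ cong (_* suc R ^ b) (∑-words V low) ⟩
      ∑ V (λ v → ∑ (words V (i + b)) (λ x → low (v ∷ x))) * suc R ^ b
        ≤⟨ ℕ.*-monoˡ-≤ (suc R ^ b) (∑-≤ V (λ v → ∑-mono (words V (i + b)) (λ x →
             ι-mono (T-does⁺ (_ ℕ.<? (c ∸ 1) * b) ∘ ℕ.≤-<-trans (ℕ.m≤n+m (∑ (toList x) d) (d v)) ∘ T-does⁻ (_ ℕ.<? (c ∸ 1) * b))))) ⟩
      N * ∑ (words V (i + b)) low * suc R ^ b
        ≡⟨ ℕ.*-assoc N _ _ ⟩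
      N * (∑ (words V (i + b)) low * suc R ^ b)
        ≤⟨ ℕ.*-monoʳ-≤ N (extend i) ⟩
      N * (R ^ b * N ^ (i + b))
        ≡⟨ swap N (R ^ b) _ ⟩
      R ^ b * (N * N ^ (i + b)) ∎
      where
      swap : ∀ p q r → p * (q * r) ≡ q * (p * r)
      swap = solve-∀

  -- If the levels of the sections have a large sum over the sample and every section is typical for
  -- the remaining entries, multiplying the two bounds shows that `g` is typical. Entry `a` is
  -- removed from the sample that tests its own section to keep the two independent; by `removeAt-≼`
  -- this only loses terms.
  atypical-suc : ∀ {m} j g (x : Vec A (suc m)) →
    let l = λ v → level j (λ y → g (v ∷ y)) in
    ι (atypical (suc j) g (toList x)) ≤
    ι (does (∑ (toList x) l ℕ.<? (∑ V l / N ∸ 1) * b)) +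
    ∑ (allFin (suc m)) (λ a → ι (atypical j (λ y → g (lookup x a ∷ y)) (toList (removeAt x a))))
  atypical-suc {m} j g x = ι≤ _ λ t → ℕ.≰⇒> λ none → ℕ.<⇒≱ (T-does⁻ (_ ℕ.<? _) t) (typical none)
    where
    open ℕ.≤-Reasoning
    l = λ v → level j (λ y → g (v ∷ y))
    low = does (∑ (toList x) l ℕ.<? (∑ V l / N ∸ 1) * b)
    bad = λ a → atypical j (λ y → g (lookup x a ∷ y)) (toList (removeAt x a))
    module _ (none : ι low + ∑ (allFin (suc m)) (ι ∘ bad) ≤ 0) where
      high : (∑ V l / N ∸ 1) * b ≤ ∑ (toList x) l
      high = ℕ.≮⇒≥ λ p → ℕ.<⇒≱ (T⇒1≤ι (T-does⁺ (_ ℕ.<? _) p)) (ℕ.≤-trans (ℕ.m≤m+n (ι low) _) none)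
      section : ∀ a → l (lookup x a) * b ^ j ≤ ∑ (words (toList x) j) (λ y → g (lookup x a ∷ y))
      section a = ℕ.≤-trans
        (ℕ.≮⇒≥ λ p → ℕ.<⇒≱ (T⇒1≤ι (T-does⁺ (_ ℕ.<? _) p))
          (ℕ.≤-trans (∑-∈ (ι ∘ bad) (List∈.∈-allFin a)) (ℕ.≤-trans (ℕ.m≤n+m _ (ι low)) none)))
        (words-≼ (removeAt-≼ x a) j _)
      typical : (∑ V l / N ∸ 1) * b ^ suc j ≤ ∑ (words (toList x) (suc j)) g
      typical = begin
        (∑ V l / N ∸ 1) * (b * b ^ j)   ≡⟨ ℕ.*-assoc (∑ V l / N ∸ 1) b (b ^ j) ⟨
        (∑ V l / N ∸ 1) * b * b ^ j     ≤⟨ ℕ.*-monoˡ-≤ (b ^ j) high ⟩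
        ∑ (toList x) l * b ^ j          ≡⟨ ∑-*ʳ (toList x) (b ^ j) l ⟨
        ∑ (toList x) (λ v → l v * b ^ j) ≡⟨ ∑-toList x _ ⟩
        ∑ (allFin (suc m)) (λ a → l (lookup x a) * b ^ j) ≤⟨ ∑-mono (allFin (suc m)) section ⟩
        ∑ (allFin (suc m)) (λ a → ∑ (words (toList x) j) (λ y → g (lookup x a ∷ y))) ≡⟨ ∑-toList x _ ⟨
        ∑ (toList x) (λ v → ∑ (words (toList x) j) (λ y → g (v ∷ y))) ≡⟨ ∑-words (toList x) g ⟨
        ∑ (words (toList x) (suc j)) g  ∎

  -- Each coordinate costs a factor M + 1 in the union bound: one Chernoff event for the sum of
  -- levels, and at most M events for the sections at the sampled entries.
  atypical-count : ∀ {M} j g → (∀ y → g y ≤ D) → ∀ m → m ≤ M → b + j ≤ m →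
                   ∑ (words V m) (λ x → ι (atypical j g (toList x))) * suc R ^ b ≤
                   suc M ^ j * (R ^ b * N ^ m)
  atypical-count zero g _ m _ _ = ℕ.≤-trans (ℕ.≤-reflexive (cong (_* suc R ^ b)
    (ℕ.n≤0⇒n≡0 (ℕ.≤-trans (∑-mono (words V m) never) (ℕ.≤-reflexive (∑-0 (words V m))))))) z≤n
    where
    never : ∀ x → ι (atypical 0 g (toList x)) ≤ 0
    never x = ι≤ _ λ t → contradiction (T-does⁻ (_ ℕ.<? _) t)
      (ℕ.≤⇒≯ (ℕ.≤-reflexive (trans (ℕ.*-identityʳ (g [])) (sym (ℕ.+-identityʳ (g []))))))
  atypical-count {M} (suc j) g g≤D zero    _   b+j≤m =
    contradiction (ℕ.≤-trans (ℕ.m≤n+m (suc j) b) b+j≤m) λ ()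
  atypical-count {M} (suc j) g g≤D (suc m) m≤M b+j≤m = begin
    ∑ (words V (suc m)) (λ x → ι (atypical (suc j) g (toList x))) * suc R ^ b
      ≤⟨ ℕ.*-monoˡ-≤ (suc R ^ b) (∑-mono (words V (suc m)) (atypical-suc j g)) ⟩
    ∑ (words V (suc m)) (λ x → low x + ∑ (allFin (suc m)) (bad x)) * suc R ^ b
      ≡⟨ cong (_* suc R ^ b) (trans (∑-+ (words V (suc m)) low _)
           (cong (∑ (words V (suc m)) low +_) (∑-swap (words V (suc m)) (allFin (suc m)) bad))) ⟩
    (∑ (words V (suc m)) low + ∑ (allFin (suc m)) (λ a → ∑ (words V (suc m)) (λ x → bad x a))) * suc R ^ b
      ≡⟨ cong (λ z → (∑ (words V (suc m)) low + z) * suc R ^ b)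
           (∑-cong (allFin (suc m)) (λ a → ∑-removeAt V a
             (λ v x → ι (atypical j (λ y → g (v ∷ y)) (toList x))))) ⟩
    (∑ (words V (suc m)) low + ∑ (allFin (suc m)) (λ _ → ∑ V sections)) * suc R ^ b
      ≡⟨ cong (λ z → (∑ (words V (suc m)) low + z) * suc R ^ b)
           (trans (∑-const (allFin (suc m)) _) (cong (_* ∑ V sections) (List.length-tabulate {n = suc m} id))) ⟩
    (∑ (words V (suc m)) low + suc m * ∑ V sections) * suc R ^ b
      ≡⟨ expand (∑ (words V (suc m)) low) (suc m) (∑ V sections) (suc R ^ b) ⟩
    ∑ (words V (suc m)) low * suc R ^ b + suc m * (∑ V sections * suc R ^ b)
      ≡⟨ cong (λ z → ∑ (words V (suc m)) low * suc R ^ b + suc m * z) (∑-*ʳ V (suc R ^ b) sections) ⟨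
    ∑ (words V (suc m)) low * suc R ^ b + suc m * ∑ V (λ v → sections v * suc R ^ b)
      ≤⟨ ℕ.+-mono-≤
           (low-count l (λ v → level≤D j (λ y → g≤D (v ∷ y))) (ℕ.≤-trans (ℕ.m≤m+n b (suc j)) b+j≤m))
           (ℕ.*-mono-≤ m≤M (∑-≤ V (λ v → atypical-count j _ (λ y → g≤D (v ∷ y)) m (ℕ.<⇒≤ m≤M)
             (ℕ.≤-pred (ℕ.≤-trans (ℕ.≤-reflexive (sym (ℕ.+-suc b j))) b+j≤m))))) ⟩
    R ^ b * N ^ suc m + M * (N * (suc M ^ j * (R ^ b * N ^ m)))
      ≤⟨ ℕ.+-monoˡ-≤ _ (ℕ.m≤n*m (R ^ b * N ^ suc m) (suc M ^ j) {{ℕ.m^n≢0 (suc M) j}}) ⟩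
    suc M ^ j * (R ^ b * N ^ suc m) + M * (N * (suc M ^ j * (R ^ b * N ^ m)))
      ≡⟨ collect (suc M ^ j) (R ^ b) N (N ^ m) M ⟩
    suc M * suc M ^ j * (R ^ b * (N * N ^ m)) ∎
    where
    open ℕ.≤-Reasoning
    l = λ v → level j (λ y → g (v ∷ y))
    low : Vec A (suc m) → ℕ
    low x = ι (does (∑ (toList x) l ℕ.<? (∑ V l / N ∸ 1) * b))
    bad : Vec A (suc m) → Fin (suc m) → ℕ
    bad x a = ι (atypical j (λ y → g (lookup x a ∷ y)) (toList (removeAt x a)))
    sections : A → ℕ
    sections v = ∑ (words V m) (λ x → ι (atypical j (λ y → g (v ∷ y)) (toList x)))
    expand : ∀ p m s r → (p + m * s) * r ≡ p * r + m * (s * r)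
    expand = solve-∀
    collect : ∀ p r N q M → p * (r * (N * q)) + M * (N * (p * (r * q))) ≡ suc M * p * (r * (N * q))
    collect = solve-∀

-- Finite sets of vertices

⊆-ext : {S U : Subset n} → (∀ i → i ∈ S → i ∈ U) → (∀ i → i ∈ U → i ∈ S) → S ≡ U
⊆-ext S⊆U U⊆S = Subset.⊆-antisym (S⊆U _) (U⊆S _)

∈⇒T : ∀ {i} {S : Subset n} → i ∈ S → T (lookup S i)
∈⇒T i∈S = subst T (sym (Vec.[]=⇒lookup i∈S)) tt

T⇒∈ : ∀ {i} {S : Subset n} → T (lookup S i) → i ∈ S
T⇒∈ {i = i} {S} t = Vec.lookup⇒[]= i S (true-if t)
  where
  true-if : ∀ {b} → T b → b ≡ true
  true-if {true} _ = refl

∈-image⁺ : ∀ {m n} (φ : Fin m → Fin n) {A i} → i ∈ A → φ i ∈ image φ A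
∈-image⁺ φ {A} {i} i∈A = T⇒∈ (subst T (sym (Vec.lookup∘tabulate _ (φ i)))
  (T-does⁺ (Fin.any? λ i′ → (i′ Subset.∈? A) ×-dec (φ i′ Fin.≟ φ i)) (i , i∈A , refl)))

∈-image⁻ : ∀ {m n} (φ : Fin m → Fin n) A {j} → j ∈ image φ A → ∃ λ i → i ∈ A × φ i ≡ j
∈-image⁻ φ A {j} j∈ =
  T-does⁻ (Fin.any? λ i → (i Subset.∈? A) ×-dec (φ i Fin.≟ j)) (subst T (Vec.lookup∘tabulate _ j) (∈⇒T j∈))

image-cong : ∀ {m n} {φ ψ : Fin m → Fin n} {A} → (∀ i → i ∈ A → φ i ≡ ψ i) → image φ A ≡ image ψ A
image-cong {φ = φ} {ψ} {A} eq = ⊆-ext (incl φ ψ eq) (incl ψ φ (λ i i∈A → sym (eq i i∈A)))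
  where
  incl : ∀ φ ψ → (∀ i → i ∈ A → φ i ≡ ψ i) → ∀ j → j ∈ image φ A → j ∈ image ψ A
  incl φ ψ eq j j∈ with i , i∈A , refl ← ∈-image⁻ φ A j∈ =
    subst (_∈ image ψ A) (sym (eq i i∈A)) (∈-image⁺ ψ i∈A)

image-∘ : ∀ {l m n} (ψ : Fin m → Fin n) (φ : Fin l → Fin m) A → image (ψ ∘ φ) A ≡ image ψ (image φ A)
image-∘ ψ φ A = ⊆-ext to′ from′
  where
  to′ : ∀ j → j ∈ image (ψ ∘ φ) A → j ∈ image ψ (image φ A)
  to′ j j∈ with i , i∈A , refl ← ∈-image⁻ (ψ ∘ φ) A j∈ = ∈-image⁺ ψ (∈-image⁺ φ i∈A)
  from′ : ∀ j → j ∈ image ψ (image φ A) → j ∈ image (ψ ∘ φ) A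
  from′ j j∈ with i , i∈ , refl ← ∈-image⁻ ψ (image φ A) j∈ with i′ , i′∈A , refl ← ∈-image⁻ φ A i∈ = ∈-image⁺ (ψ ∘ φ) i′∈A

image-id : ∀ {φ : Fin n → Fin n} A → (∀ i → φ i ≡ i) → image φ A ≡ A
image-id {φ = φ} A φ≗id = ⊆-ext
  (λ j j∈ → let i , i∈A , φi≡j = ∈-image⁻ φ A j∈ in subst (_∈ A) (trans (sym (φ≗id i)) φi≡j) i∈A)
  (λ j j∈A → subst (_∈ image φ A) (φ≗id j) (∈-image⁺ φ j∈A))

image-∪ : ∀ {m n} (φ : Fin m → Fin n) A B → image φ (A ∪ B) ≡ image φ A ∪ image φ B
image-∪ φ A B = ⊆-ext to′ from′
  where
  to′ : ∀ j → j ∈ image φ (A ∪ B) → j ∈ image φ A ∪ image φ B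
  to′ j j∈ with i , i∈ , refl ← ∈-image⁻ φ (A ∪ B) j∈ with Subset.x∈p∪q⁻ A B i∈
  ... | inj₁ i∈A = Subset.x∈p∪q⁺ (inj₁ (∈-image⁺ φ i∈A))
  ... | inj₂ i∈B = Subset.x∈p∪q⁺ (inj₂ (∈-image⁺ φ i∈B))
  from′ : ∀ j → j ∈ image φ A ∪ image φ B → j ∈ image φ (A ∪ B)
  from′ j j∈ with Subset.x∈p∪q⁻ (image φ A) (image φ B) j∈
  ... | inj₁ j∈A with i , i∈ , refl ← ∈-image⁻ φ A j∈A = ∈-image⁺ φ (Subset.x∈p∪q⁺ (inj₁ i∈))
  ... | inj₂ j∈B with i , i∈ , refl ← ∈-image⁻ φ B j∈B = ∈-image⁺ φ (Subset.x∈p∪q⁺ (inj₂ i∈))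

image-⁅⁆ : ∀ {m n} (φ : Fin m → Fin n) i → image φ ⁅ i ⁆ ≡ ⁅ φ i ⁆
image-⁅⁆ φ i = ⊆-ext to′ from′
  where
  to′ : ∀ j → j ∈ image φ ⁅ i ⁆ → j ∈ ⁅ φ i ⁆
  to′ j j∈ with i′ , i′∈ , refl ← ∈-image⁻ φ ⁅ i ⁆ j∈ with refl ← Subset.x∈⁅y⁆⇒x≡y i i′∈ = Subset.x∈⁅x⁆ (φ i)
  from′ : ∀ j → j ∈ ⁅ φ i ⁆ → j ∈ image φ ⁅ i ⁆
  from′ j j∈ with refl ← Subset.x∈⁅y⁆⇒x≡y (φ i) j∈ = ∈-image⁺ φ (Subset.x∈⁅x⁆ i)

image-⊥ : ∀ {m n} (φ : Fin m → Fin n) → image φ Subset.⊥ ≡ Subset.⊥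
image-⊥ φ = ⊆-ext (λ j j∈ → ⊥-elim (Subset.∉⊥ (proj₁ (proj₂ (∈-image⁻ φ Subset.⊥ j∈)))))
                  (λ j j∈ → ⊥-elim (Subset.∉⊥ j∈))

image-inside : ∀ {m n} (φ : Fin (suc m) → Fin n) A → image φ (inside ∷ A) ≡ ⁅ φ zero ⁆ ∪ image (φ ∘ suc) A
image-inside φ A = ⊆-ext to′ from′
  where
  to′ : ∀ j → j ∈ image φ (inside ∷ A) → j ∈ ⁅ φ zero ⁆ ∪ image (φ ∘ suc) A
  to′ j j∈ with ∈-image⁻ φ (inside ∷ A) j∈
  ... | zero  , _  , refl = Subset.x∈p∪q⁺ (inj₁ (Subset.x∈⁅x⁆ _))
  ... | suc i , i∈ , refl = Subset.x∈p∪q⁺ (inj₂ (∈-image⁺ (φ ∘ suc) (Subset.drop-there i∈)))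
  from′ : ∀ j → j ∈ ⁅ φ zero ⁆ ∪ image (φ ∘ suc) A → j ∈ image φ (inside ∷ A)
  from′ j j∈ with Subset.x∈p∪q⁻ ⁅ φ zero ⁆ _ j∈
  ... | inj₁ j∈0 with refl ← Subset.x∈⁅y⁆⇒x≡y (φ zero) j∈0 = ∈-image⁺ φ {inside ∷ A} Vec.here
  ... | inj₂ j∈A with i , i∈A , refl ← ∈-image⁻ (φ ∘ suc) A j∈A = ∈-image⁺ φ {inside ∷ A} (Vec.there i∈A)

image-outside : ∀ {m n} (φ : Fin (suc m) → Fin n) A → image φ (outside ∷ A) ≡ image (φ ∘ suc) A
image-outside φ A = ⊆-ext to′ from′
  where
  to′ : ∀ j → j ∈ image φ (outside ∷ A) → j ∈ image (φ ∘ suc) A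
  to′ j j∈ with ∈-image⁻ φ (outside ∷ A) j∈
  ... | suc i , i∈ , refl = ∈-image⁺ (φ ∘ suc) (Subset.drop-there i∈)
  from′ : ∀ j → j ∈ image (φ ∘ suc) A → j ∈ image φ (outside ∷ A)
  from′ j j∈ with i , i∈A , refl ← ∈-image⁻ (φ ∘ suc) A j∈ = ∈-image⁺ φ {outside ∷ A} (Vec.there i∈A)

∣∪∣≤ : (S U : Subset n) → ∣ S ∪ U ∣ ≤ ∣ S ∣ + ∣ U ∣
∣∪∣≤ []            []            = z≤n
∣∪∣≤ (inside  ∷ S) (inside  ∷ U) = s≤s (ℕ.≤-trans (∣∪∣≤ S U) (ℕ.+-monoʳ-≤ ∣ S ∣ (ℕ.n≤1+n _)))
∣∪∣≤ (inside  ∷ S) (outside ∷ U) = s≤s (∣∪∣≤ S U)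
∣∪∣≤ (outside ∷ S) (inside  ∷ U) = ℕ.≤-trans (s≤s (∣∪∣≤ S U)) (ℕ.≤-reflexive (sym (ℕ.+-suc ∣ S ∣ _)))
∣∪∣≤ (outside ∷ S) (outside ∷ U) = ∣∪∣≤ S U

∣⁅v⁆∪S∣-∉ : ∀ (v : Fin n) S → ¬ T (lookup S v) → ∣ ⁅ v ⁆ ∪ S ∣ ≡ suc ∣ S ∣
∣⁅v⁆∪S∣-∉ zero    (inside  ∷ S) v∉S = ⊥-elim (v∉S tt)
∣⁅v⁆∪S∣-∉ zero    (outside ∷ S) v∉S = cong (suc ∘ ∣_∣) (Subset.∪-identityˡ S)
∣⁅v⁆∪S∣-∉ (suc v) (inside  ∷ S) v∉S = cong suc (∣⁅v⁆∪S∣-∉ v S v∉S)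
∣⁅v⁆∪S∣-∉ (suc v) (outside ∷ S) v∉S = ∣⁅v⁆∪S∣-∉ v S v∉S

∣⁅v⁆∪S∣-∈ : ∀ (v : Fin n) S → T (lookup S v) → ∣ ⁅ v ⁆ ∪ S ∣ ≡ ∣ S ∣
∣⁅v⁆∪S∣-∈ zero    (inside  ∷ S) v∈S = cong (suc ∘ ∣_∣) (Subset.∪-identityˡ S)
∣⁅v⁆∪S∣-∈ (suc v) (inside  ∷ S) v∈S = cong suc (∣⁅v⁆∪S∣-∈ v S v∈S)
∣⁅v⁆∪S∣-∈ (suc v) (outside ∷ S) v∈S = ∣⁅v⁆∪S∣-∈ v S v∈S

∣⁅v⁆∪S∣≤ : ∀ (v : Fin n) S → ∣ ⁅ v ⁆ ∪ S ∣ ≤ suc ∣ S ∣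
∣⁅v⁆∪S∣≤ v S = ℕ.≤-trans (∣∪∣≤ ⁅ v ⁆ S) (ℕ.≤-reflexive (cong (_+ ∣ S ∣) (Subset.∣⁅x⁆∣≡1 v)))

∣image-⊥∣ : ∀ {n} (φ : Fin 0 → Fin n) → ∣ image φ [] ∣ ≡ 0
∣image-⊥∣ {n} φ = trans (cong ∣_∣ (image-⊥ φ)) (Subset.∣⊥∣≡0 n)

∣image∣≤ : ∀ {m n} (φ : Fin m → Fin n) A → ∣ image φ A ∣ ≤ ∣ A ∣
∣image∣≤ φ []            = ℕ.≤-reflexive (∣image-⊥∣ φ)
∣image∣≤ φ (inside  ∷ A) = ℕ.≤-trans (ℕ.≤-reflexive (cong ∣_∣ (image-inside φ A)))
  (ℕ.≤-trans (∣⁅v⁆∪S∣≤ (φ zero) _) (s≤s (∣image∣≤ (φ ∘ suc) A)))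
∣image∣≤ φ (outside ∷ A) = ℕ.≤-trans (ℕ.≤-reflexive (cong ∣_∣ (image-outside φ A))) (∣image∣≤ (φ ∘ suc) A)

∣image∣≡ : ∀ {m n} {φ : Fin m → Fin n} → Injective _≡_ _≡_ φ → ∀ A → ∣ image φ A ∣ ≡ ∣ A ∣
∣image∣≡ {φ = φ} inj []            = ∣image-⊥∣ φ
∣image∣≡ {φ = φ} inj (inside  ∷ A) = trans (cong ∣_∣ (image-inside φ A))
  (trans (∣⁅v⁆∪S∣-∉ (φ zero) _ λ t → 0∉ (∈-image⁻ (φ ∘ suc) A (T⇒∈ t)))
    (cong suc (∣image∣≡ (Fin.suc-injective ∘ inj) A)))
  where
  0∉ : ¬ ∃ λ i → i ∈ A × φ (suc i) ≡ φ zero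
  0∉ (i , _ , eq) with () ← inj eq
∣image∣≡ {φ = φ} inj (outside ∷ A) = trans (cong ∣_∣ (image-outside φ A)) (∣image∣≡ (Fin.suc-injective ∘ inj) A)

-- If two elements of `A` had the same value, deleting one of them would leave the image unchanged,
-- so the image would have fewer than ∣A∣ elements.
∣image∣≡⇒injective : ∀ {m n} (φ : Fin m → Fin n) A → ∣ image φ A ∣ ≡ ∣ A ∣ →
                     ∀ {i i′} → i ∈ A → i′ ∈ A → φ i ≡ φ i′ → i ≡ i′
∣image∣≡⇒injective φ A eq {i} {i′} i∈A i′∈A φi≡φi′ with i Fin.≟ i′
... | yes i≡i′ = i≡i′
... | no  i≢i′ = contradiction (Subset.x∈p⇒∣p-x∣<∣p∣ i∈A) (ℕ.≤⇒≯ (begin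
  ∣ A ∣                      ≡⟨ eq ⟨
  ∣ image φ A ∣              ≤⟨ Subset.p⊆q⇒∣p∣≤∣q∣ (λ {j} → without j) ⟩
  ∣ image φ (A Subset.- i) ∣ ≤⟨ ∣image∣≤ φ (A Subset.- i) ⟩
  ∣ A Subset.- i ∣           ∎))
  where
  open ℕ.≤-Reasoning
  without : ∀ j → j ∈ image φ A → j ∈ image φ (A Subset.- i)
  without j j∈ with i″ , i″∈A , refl ← ∈-image⁻ φ A j∈ with i″ Fin.≟ i
  ... | yes refl = subst (_∈ image φ (A Subset.- i)) (sym φi≡φi′)
                     (∈-image⁺ φ (Subset.x∈p∧x≢y⇒x∈p-y i′∈A (i≢i′ ∘ sym)))
  ... | no  i″≢i = ∈-image⁺ φ (Subset.x∈p∧x≢y⇒x∈p-y i″∈A i″≢i)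

∣S∣≡∑ : (S : Subset n) → ∣ S ∣ ≡ ∑ (allFin n) (ι ∘ lookup S)
∣S∣≡∑ S = trans (listed S) (∑-toList S ι)
  where
  listed : ∀ {n} (S : Subset n) → ∣ S ∣ ≡ ∑ (toList S) ι
  listed []            = refl
  listed (inside  ∷ S) = cong suc (listed S)
  listed (outside ∷ S) = listed S

set : ∀ {j} → Vec (Fin n) j → Subset n
set []      = Subset.⊥
set (v ∷ y) = ⁅ v ⁆ ∪ set y

∣set∣≤ : ∀ {j} (y : Vec (Fin n) j) → ∣ set y ∣ ≤ j
∣set∣≤ {n} []  = ℕ.≤-reflexive (Subset.∣⊥∣≡0 n)
∣set∣≤ (v ∷ y) = ℕ.≤-trans (∣⁅v⁆∪S∣≤ v (set y)) (s≤s (∣set∣≤ y))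

∈-set⁺ : ∀ {j} (y : Vec (Fin n) j) i → lookup y i ∈ set y
∈-set⁺ (v ∷ y) zero    = Subset.x∈p∪q⁺ (inj₁ (Subset.x∈⁅x⁆ v))
∈-set⁺ (v ∷ y) (suc i) = Subset.x∈p∪q⁺ (inj₂ (∈-set⁺ y i))

image-set : ∀ {m n j} (φ : Fin m → Fin n) (y : Vec (Fin m) j) → image φ (set y) ≡ set (Vec.map φ y)
image-set φ []      = image-⊥ φ
image-set φ (v ∷ y) = trans (image-∪ φ ⁅ v ⁆ (set y)) (cong₂ _∪_ (image-⁅⁆ φ v) (image-set φ y))

image-lookup : ∀ {m} (x : Vec (Fin n) m) (P : Subset m) → image (lookup x) P ≡ set (sel P x)
image-lookup x@[]    []            = image-⊥ (lookup x)
image-lookup (v ∷ x) (inside  ∷ P) = trans (image-inside (lookup (v ∷ x)) P) (cong (⁅ v ⁆ ∪_) (image-lookup x P))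
image-lookup (v ∷ x) (outside ∷ P) = trans (image-outside (lookup (v ∷ x)) P) (image-lookup x P)

distinct : ∀ {m} → Vec (Fin n) m → Bool
distinct []      = true
distinct (v ∷ x) = not (lookup (set x) v) ∧ distinct x

distinct⇒injective : ∀ {m} (x : Vec (Fin n) m) → T (distinct x) → Injective _≡_ _≡_ (lookup x)
distinct⇒injective (v ∷ x) t {zero}  {zero}   eq = refl
distinct⇒injective (v ∷ x) t {zero}  {suc i′} eq =
  ⊥-elim (T-not⁻ (proj₁ (T-∧⁻ t)) (∈⇒T (subst (_∈ set x) (sym eq) (∈-set⁺ x i′))))
distinct⇒injective (v ∷ x) t {suc i} {zero}   eq =
  ⊥-elim (T-not⁻ (proj₁ (T-∧⁻ t)) (∈⇒T (subst (_∈ set x) eq (∈-set⁺ x i))))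
distinct⇒injective (v ∷ x) t {suc i} {suc i′} eq =
  cong suc (distinct⇒injective x (proj₂ (T-∧⁻ {not (lookup (set x) v)} t)) eq)

-- The birthday bound: a new first vertex repeats one of the others for at most m of its n values,
-- and m + m² ≤ (m + 1)².
non-distinct-count : ∀ n m → n * ∑ (words (allFin n) m) (ι ∘ not ∘ distinct) ≤ m * m * n ^ m
non-distinct-count n zero    = ℕ.≤-reflexive (ℕ.*-zeroʳ n)
non-distinct-count n (suc m) = begin
  n * ∑ (words V (suc m)) (ι ∘ not ∘ distinct)
    ≡⟨ cong (n *_) (∑-words V _) ⟩
  n * ∑ V (λ v → ∑ (words V m) (λ x → ι (not (distinct (v ∷ x)))))
    ≤⟨ ℕ.*-monoʳ-≤ n (∑-mono V (λ v → ∑-mono (words V m) (λ x → union (lookup (set x) v) (distinct x)))) ⟩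
  n * ∑ V (λ v → ∑ (words V m) (λ x → ι (lookup (set x) v) + ι (not (distinct x))))
    ≡⟨ cong (n *_) (trans (∑-cong V (λ v → ∑-+ (words V m) (λ x → ι (lookup (set x) v)) _)) (∑-+ V _ _)) ⟩
  n * (∑ V (λ v → ∑ (words V m) (λ x → ι (lookup (set x) v))) + ∑ V (λ _ → W))
    ≡⟨ cong (n *_) (cong₂ _+_ (trans (∑-swap V (words V m) _) (∑-cong (words V m) (λ x → sym (∣S∣≡∑ (set x)))))
         (trans (∑-const V W) (cong (_* W) (List.length-tabulate {n = n} id)))) ⟩
  n * (∑ (words V m) (λ x → ∣ set x ∣) + n * W)
    ≤⟨ ℕ.*-monoʳ-≤ n (ℕ.+-mono-≤ (ℕ.≤-trans (∑-≤ (words V m) ∣set∣≤)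
         (ℕ.≤-reflexive (cong (_* m) (length-words-allFin n m)))) (non-distinct-count n m)) ⟩
  n * (n ^ m * m + m * m * n ^ m)
    ≤⟨ ℕ.m≤m+n _ (suc m * (n * n ^ m)) ⟩
  n * (n ^ m * m + m * m * n ^ m) + suc m * (n * n ^ m)
    ≡⟨ collect n (n ^ m) m ⟩
  suc m * suc m * n ^ suc m ∎
  where
  open ℕ.≤-Reasoning
  V = allFin n
  W = ∑ (words V m) (ι ∘ not ∘ distinct)
  union : ∀ p q → ι (not (not p ∧ q)) ≤ ι p + ι (not q)
  union true  true  = s≤s z≤n
  union true  false = s≤s z≤n
  union false true  = z≤n
  union false false = s≤s z≤n
  collect : ∀ n p m → n * (p * m + m * m * p) + suc m * (n * p) ≡ suc m * suc m * (n * p)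
  collect = solve-∀

-- Ordered and unordered counts of j-sets

ι-∧ : ∀ a b → ι (a ∧ b) ≡ ι a * ι b
ι-∧ true  b = sym (ℕ.+-identityʳ (ι b))
ι-∧ false b = refl

∑-subsets : ∀ n (f : Subset (suc n) → ℕ) →
  ∑ (subsets (suc n)) f ≡ ∑ (subsets n) (λ S → f (inside ∷ S)) + ∑ (subsets n) (λ S → f (outside ∷ S))
∑-subsets n f = trans (∑-++ (map (inside ∷_) (subsets n)) _ f)
  (cong₂ _+_ (∑-map _ (subsets n) f) (∑-map _ (subsets n) f))

-- The map S ↦ S ∪ {v} is a bijection from the sets avoiding v to the sets containing v.
∑-toggle : ∀ (v : Fin n) (M : Subset n → ℕ) →
  ∑ (subsets n) (λ S → ι (lookup S v) * M S) ≡ ∑ (subsets n) (λ S → ι (not (lookup S v)) * M (⁅ v ⁆ ∪ S))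
∑-toggle {suc n} zero M = trans (∑-subsets n _) (trans
  (trans (cong (∑ (subsets n) (λ S → 1 * M (inside ∷ S)) +_) (∑-0 (subsets n)))
    (trans (ℕ.+-comm _ 0)
      (cong₂ _+_ (sym (∑-0 (subsets n)))
        (∑-cong (subsets n) (λ S → cong (λ U → 1 * M (inside ∷ U)) (sym (Subset.∪-identityˡ S)))))))
  (sym (∑-subsets n (λ S → ι (not (lookup S zero)) * M (⁅ zero ⁆ ∪ S)))))
∑-toggle {suc n} (suc v) M = trans (∑-subsets n _) (trans
  (cong₂ _+_ (∑-toggle v (M ∘ (inside ∷_))) (∑-toggle v (M ∘ (outside ∷_))))
  (sym (∑-subsets n (λ S → ι (not (lookup S (suc v))) * M (⁅ suc v ⁆ ∪ S)))))

∑-∅ : ∀ n (L : Subset n → ℕ) → ∑ (subsets n) (λ S → ι (∣ S ∣ ≡ᵇ 0) * L S) ≡ L Subset.⊥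
∑-∅ zero    L = trans (ℕ.+-identityʳ _) (ℕ.+-identityʳ _)
∑-∅ (suc n) L = trans (∑-subsets n _) (cong₂ _+_ (∑-0 (subsets n)) (∑-∅ n (L ∘ (outside ∷_))))

private
  size-step : ∀ (v : Fin n) S j → ∣ S ∣ ≤ j → ∀ l →
    ι (∣ ⁅ v ⁆ ∪ S ∣ ≡ᵇ suc j) * l ≡ ι (∣ S ∣ ≡ᵇ j) * (ι (not (lookup S v)) * l)
  size-step v S j S≤j l with T? (lookup S v)
  ... | yes t rewrite ∣⁅v⁆∪S∣-∈ v S t = trans
    (cong (λ i → i * l) (ι-false (λ t′ → ℕ.<⇒≢ (s≤s S≤j) (ℕ.≡ᵇ⇒≡ ∣ S ∣ (suc j) t′))))
    (sym (trans (cong (λ i → ι (∣ S ∣ ≡ᵇ j) * (i * l)) (ι-false (λ t′ → T-not⁻ t′ t))) (ℕ.*-zeroʳ (ι (∣ S ∣ ≡ᵇ j)))))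
  ... | no ¬t rewrite ∣⁅v⁆∪S∣-∉ v S ¬t =
    cong (ι (∣ S ∣ ≡ᵇ j) *_) (sym (trans (cong (_* l) (ι-not ¬t)) (ℕ.*-identityˡ l)))
    where
    ι-not : ∀ {b} → ¬ T b → ι (not b) ≡ 1
    ι-not {true}  ¬t = ⊥-elim (¬t tt)
    ι-not {false} _  = refl

  size-step′ : ∀ (v : Fin n) S j l →
    ι (not (lookup S v)) * (ι (∣ ⁅ v ⁆ ∪ S ∣ ≡ᵇ suc j) * l) ≡ ι (∣ S ∣ ≡ᵇ j) * (ι (not (lookup S v)) * l)
  size-step′ v S j l with lookup S v in eq
  ... | true  = sym (ℕ.*-zeroʳ (ι (∣ S ∣ ≡ᵇ j)))
  ... | false rewrite ∣⁅v⁆∪S∣-∉ v S (subst (¬_ ∘ T) (sym eq) id) = swap (ι (∣ S ∣ ≡ᵇ j)) l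
    where
    swap : ∀ p l → 1 * (p * l) ≡ p * (1 * l)
    swap = solve-∀

-- A j-set has j! orderings. The induction splits off the first letter v and uses a weight vanishing
-- on sets that contain v; after `∑-toggle`, every (j + 1)-set is counted once for each of its
-- elements.
ordered-count : ∀ j (L : Subset n → ℕ) →
  ∑ (words (allFin n) j) (λ y → ι (∣ set y ∣ ≡ᵇ j) * L (set y)) ≡
  j ! * ∑ (subsets n) (λ S → ι (∣ S ∣ ≡ᵇ j) * L S)
ordered-count {n} zero L = trans (ℕ.+-identityʳ _)
  (trans (trans (cong (λ i → ι (i ≡ᵇ 0) * L Subset.⊥) (Subset.∣⊥∣≡0 n)) (ℕ.*-identityˡ _))
    (trans (sym (∑-∅ n L)) (sym (ℕ.*-identityˡ _))))
ordered-count {n} (suc j) L = begin-equality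
  ∑ (words V (suc j)) (λ y → ι (∣ set y ∣ ≡ᵇ suc j) * L (set y))
    ≡⟨ ∑-words V _ ⟩
  ∑ V (λ v → ∑ (words V j) (λ y → ι (∣ ⁅ v ⁆ ∪ set y ∣ ≡ᵇ suc j) * L (⁅ v ⁆ ∪ set y)))
    ≡⟨ ∑-cong V (λ v → ∑-cong (words V j) (λ y → size-step v (set y) j (∣set∣≤ y) _)) ⟩
  ∑ V (λ v → ∑ (words V j) (λ y → ι (∣ set y ∣ ≡ᵇ j) * Lv v (set y)))
    ≡⟨ ∑-cong V (λ v → ordered-count j (Lv v)) ⟩
  ∑ V (λ v → j ! * ∑ (subsets n) (λ S → ι (∣ S ∣ ≡ᵇ j) * Lv v S))
    ≡⟨ ∑-*ˡ V (j !) _ ⟩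
  j ! * ∑ V (λ v → ∑ (subsets n) (λ S → ι (∣ S ∣ ≡ᵇ j) * Lv v S))
    ≡⟨ cong (j ! *_) (∑-cong V (λ v → ∑-cong (subsets n) (λ S → sym (size-step′ v S j _)))) ⟩
  j ! * ∑ V (λ v → ∑ (subsets n) (λ S → ι (not (lookup S v)) * M (⁅ v ⁆ ∪ S)))
    ≡⟨ cong (j ! *_) (∑-cong V (λ v → ∑-toggle v M)) ⟨
  j ! * ∑ V (λ v → ∑ (subsets n) (λ S → ι (lookup S v) * M S))
    ≡⟨ cong (j ! *_) (∑-swap V (subsets n) _) ⟩
  j ! * ∑ (subsets n) (λ S → ∑ V (λ v → ι (lookup S v) * M S))
    ≡⟨ cong (j ! *_) (∑-cong (subsets n) (λ S →
         trans (∑-*ʳ V (M S) (ι ∘ lookup S)) (trans (cong (_* M S) (sym (∣S∣≡∑ S))) (size S)))) ⟩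
  j ! * ∑ (subsets n) (λ S → suc j * M S)
    ≡⟨ cong (j ! *_) (∑-*ˡ (subsets n) (suc j) M) ⟩
  j ! * (suc j * ∑ (subsets n) M)
    ≡⟨ regroup (j !) (suc j) _ ⟩
  suc j ! * ∑ (subsets n) M ∎
  where
  open ℕ.≤-Reasoning
  V = allFin n
  Lv : Fin n → Subset n → ℕ
  Lv v S = ι (not (lookup S v)) * L (⁅ v ⁆ ∪ S)
  M : Subset n → ℕ
  M S = ι (∣ S ∣ ≡ᵇ suc j) * L S
  size : ∀ S → ∣ S ∣ * M S ≡ suc j * M S
  size S with ∣ S ∣ ≡ᵇ suc j in eq
  ... | true  = cong (_* (1 * L S)) (ℕ.≡ᵇ⇒≡ ∣ S ∣ (suc j) (subst T (sym eq) tt))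
  ... | false = trans (ℕ.*-zeroʳ ∣ S ∣) (sym (ℕ.*-zeroʳ (suc j)))
  regroup : ∀ a b c → a * (b * c) ≡ b * a * c
  regroup = solve-∀

-- Degrees of random induced subgraphs

-- Words with repetitions need not be excluded: an edge has k elements, so `set y` must supply at
-- least k - ∣A∣ of them and hence has exactly that size.
ordered-degree : ∀ (H : KGraph k n) A → ∣ A ∣ ≤ k →
  ∑ (words (allFin n) (k ∸ ∣ A ∣)) (λ y → ι (edge H (set y ∪ A))) ≡ (k ∸ ∣ A ∣) ! * deg H A
ordered-degree {k} {n} H A ∣A∣≤k = begin-equality
  ∑ (words (allFin n) j) (λ y → ι (edge H (set y ∪ A)))
    ≡⟨ ∑-cong (words (allFin n) j) (λ y → trans (ι-cong (λ t → T-∧⁺ (≡⇒≡ᵇ (size y t)) t) (proj₂ ∘ T-∧⁻ {∣ set y ∣ ≡ᵇ j})) (ι-∧ (∣ set y ∣ ≡ᵇ j) (edge H (set y ∪ A)))) ⟩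
  ∑ (words (allFin n) j) (λ y → ι (∣ set y ∣ ≡ᵇ j) * ι (edge H (set y ∪ A)))
    ≡⟨ ordered-count j (λ S → ι (edge H (S ∪ A))) ⟩
  j ! * ∑ (subsets n) (λ S → ι (∣ S ∣ ≡ᵇ j) * ι (edge H (S ∪ A)))
    ≡⟨ cong (j ! *_) (∑-cong (subsets n) (λ S → ι-∧ (∣ S ∣ ≡ᵇ j) _)) ⟨
  j ! * ∑ (subsets n) (λ S → ι ((∣ S ∣ ≡ᵇ j) ∧ edge H (S ∪ A)))
    ≡⟨ cong (j ! *_) (length-filter (λ S → (∣ S ∣ ℕ.≟ j) ×-dec T? (edge H (S ∪ A))) (subsets n)) ⟨
  j ! * deg H A ∎
  where
  open ℕ.≤-Reasoning
  j = k ∸ ∣ A ∣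
  ≡⇒≡ᵇ : ∀ {i} → i ≡ j → T (i ≡ᵇ j)
  ≡⇒≡ᵇ = ℕ.≡⇒≡ᵇ _ _
  size : ∀ (y : Vec (Fin n) j) → T (edge H (set y ∪ A)) → ∣ set y ∣ ≡ j
  size y t = ℕ.≤-antisym (∣set∣≤ y) (ℕ.≤-trans (ℕ.∸-monoˡ-≤ ∣ A ∣ (ℕ.≤-trans
    (ℕ.≤-reflexive (sym (uniform H _ t))) (∣∪∣≤ (set y) A))) (ℕ.≤-reflexive (ℕ.m+n∸n≡m ∣ set y ∣ ∣ A ∣)))

-- The induced graph H[x], carried by the positions so that different samples can be compared. The
-- size test keeps it k-uniform when x repeats a vertex.
pullback : KGraph k n → Vec (Fin n) m → KGraph k m
pullback {k} H x = record
  { edge    = λ e → (∣ e ∣ ≡ᵇ k) ∧ edge H (image (lookup x) e)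
  ; uniform = λ e t → ℕ.≡ᵇ⇒≡ ∣ e ∣ k (proj₁ (T-∧⁻ t))
  }

∑-words-map : ∀ {xs : List B} {ys : List A} (h : A → B) → (∀ f → ∑ xs f ≡ ∑ ys (f ∘ h)) →
              ∀ j (g : Vec B j → ℕ) → ∑ (words xs j) g ≡ ∑ (words ys j) (g ∘ Vec.map h)
∑-words-map           h eq zero    g = refl
∑-words-map {xs = xs} {ys} h eq (suc j) g = trans (∑-words xs g) (trans (eq _)
  (trans (∑-cong ys (λ v → ∑-words-map h eq j (λ y → g (h v ∷ y)))) (sym (∑-words ys _))))

sample-degree : ∀ (H : KGraph k n) (x : Vec (Fin n) m) → T (distinct x) → ∀ P → ∣ P ∣ ≤ k →
  ∑ (words (toList x) (k ∸ ∣ P ∣)) (λ y → ι (edge H (set y ∪ set (sel P x)))) ≤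
  (k ∸ ∣ P ∣) ! * deg (pullback H x) P
sample-degree {k} {n} {m} H x t P ∣P∣≤k = begin
  ∑ (words (toList x) j) (λ y → ι (edge H (set y ∪ set (sel P x))))
    ≡⟨ ∑-words-map (lookup x) (∑-toList x) j _ ⟩
  ∑ (words (allFin m) j) (λ y → ι (edge H (set (Vec.map (lookup x) y) ∪ set (sel P x))))
    ≤⟨ ∑-mono (words (allFin m) j) (λ y → ι-mono (pulled y)) ⟩
  ∑ (words (allFin m) j) (λ y → ι (edge (pullback H x) (set y ∪ P)))
    ≡⟨ ordered-degree (pullback H x) P ∣P∣≤k ⟩
  j ! * deg (pullback H x) P ∎
  where
  open ℕ.≤-Reasoning
  j = k ∸ ∣ P ∣
  pulled : ∀ y → T (edge H (set (Vec.map (lookup x) y) ∪ set (sel P x))) → T (edge (pullback H x) (set y ∪ P))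
  pulled y e = T-∧⁺ (ℕ.≡⇒≡ᵇ _ _ (trans (sym (∣image∣≡ (distinct⇒injective x t) (set y ∪ P))) (uniform H _ e′))) e′
    where
    e′ : T (edge H (image (lookup x) (set y ∪ P)))
    e′ = subst (T ∘ edge H)
      (sym (trans (image-∪ (lookup x) (set y) P) (cong₂ _∪_ (image-set (lookup x) y) (image-lookup x P)))) e

∈-subsets : ∀ {n} (A : Subset n) → A ∈ˡ subsets n
∈-subsets []            = here refl
∈-subsets (inside  ∷ A) = List∈.∈-++⁺ˡ (List∈.∈-map⁺ (inside ∷_) (∈-subsets A))
∈-subsets (outside ∷ A) = List∈.∈-++⁺ʳ _ (List∈.∈-map⁺ (outside ∷_) (∈-subsets A))

minDegree≤deg : ∀ ℓ (H : KGraph k n) A → ∣ A ∣ ≡ ℓ → minDegree ℓ H ≤ deg H A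
minDegree≤deg {n = n} ℓ H A eq = minimum≤ (List∈.∈-map⁺ (deg H)
  (List∈.∈-filter⁺ (λ A → ∣ A ∣ ℕ.≟ ℓ) (∈-subsets A) eq))
  where
  minimum≤ : ∀ {d ds} → d ∈ˡ ds → minimum ds ≤ d
  minimum≤ {ds = d ∷ ds} (here refl)  = Extrema.min≤⊤ d ds
  minimum≤ {ds = d ∷ ds} (there d∈ds) = All.lookup (Extrema.min≤xs d ds) d∈ds

-- With ℓ ≤ n there is at least one ℓ-set, so the minimum is a genuine degree and not the default 0.
minDegree-elim : ∀ ℓ (H : KGraph k n) → ℓ ≤ n → (P : ℕ → Set) →
                 (∀ A → ∣ A ∣ ≡ ℓ → P (deg H A)) → P (minDegree ℓ H)
minDegree-elim {n = n} ℓ H ℓ≤n P Pdeg = minimum-elim _ nonempty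
  (All.map⁺ (All.map (Pdeg _) (All.all-filter (λ A → ∣ A ∣ ℕ.≟ ℓ) (subsets n))))
  where
  minimum-elim : ∀ ds → 0 < length ds → All P ds → P (minimum ds)
  minimum-elim (d ∷ ds) _ (p ∷ ps) = Extrema.argmin-all id p ps
  nonempty : 0 < length (map (deg H) (filter (λ A → ∣ A ∣ ℕ.≟ ℓ) (subsets n)))
  nonempty = ℕ.≤-trans (ℕ.>-nonZero⁻¹ (n C ℓ) {{≢0}}) (ℕ.≤-reflexive (sym
    (trans (List.length-map (deg H) (filter (λ A → ∣ A ∣ ℕ.≟ ℓ) (subsets n))) (sized-subsets n ℓ))))
    where
    positive : (n ∸ ℓ + ℓ) C ℓ ≢ 0
    positive = C-positive (n ∸ ℓ) ℓ
      where
      C-positive : ∀ i ℓ → (i + ℓ) C ℓ ≢ 0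
      C-positive i zero    ()
      C-positive i (suc ℓ) eq = C-positive i ℓ (ℕ.m+n≡0⇒m≡0 _
        (trans (ℕ.nCk+nC[k+1]≡[n+1]C[k+1] (i + ℓ) ℓ) (trans (cong (_C suc ℓ) (sym (ℕ.+-suc i ℓ))) eq)))
    ≢0 : NonZero (n C ℓ)
    ≢0 = ℕ.≢-nonZero (subst (λ i → i C ℓ ≢ 0) (ℕ.m∸n+n≡m ℓ≤n) positive)

∑-≤-All : ∀ {xs : List A} {f : A → ℕ} {c} → All (λ x → f x ≤ c) xs → ∑ xs f ≤ length xs * c
∑-≤-All []         = z≤n
∑-≤-All (p ∷ ps) = ℕ.+-mono-≤ p (∑-≤-All ps)

-- D = 8Qj leaves room for the rounding errors in the level, and the estimates
-- for n and b for the passage between n^j and j! C(n, j).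
level-transfer : ∀ {u Q j D p lev w dH dG Cₙ Cₘ bʲ mʲ} → D ≡ 8 * (Q * j) →
  .{{_ : NonZero D}} → .{{_ : NonZero p}} → .{{_ : NonZero w}} →
  lev * bʲ ≤ D * (w * dG) → D * (w * dH) ≤ p * (lev + 2 * j) →
  suc u * Cₙ ≤ Q * dH → suc (2 * u) * p ≤ suc (suc (2 * u)) * (w * Cₙ) →
  4 * u * mʲ < suc (4 * u) * bʲ → w * Cₘ ≤ mʲ → u * Cₘ < Q * dG
level-transfer {u} {Q} {j} {D} {p} {lev} {w} {dH} {dG} {Cₙ} {Cₘ} {bʲ} {mʲ} D≡ typ low degH n-large b-large m-bound =
  ℕ.*-cancelˡ-< (4 * w) (u * Cₘ) (Q * dG) (begin-strict
    4 * w * (u * Cₘ)      ≡⟨ e₁ w u Cₘ ⟩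
    4 * u * (w * Cₘ)      ≤⟨ ℕ.*-monoʳ-≤ (4 * u) m-bound ⟩
    4 * u * mʲ            <⟨ b-large ⟩
    suc (4 * u) * bʲ      ≤⟨ ℕ.*-cancelˡ-≤ D (begin
      D * (suc (4 * u) * bʲ)   ≡⟨ ℕ.*-assoc D _ bʲ ⟨
      D * suc (4 * u) * bʲ     ≤⟨ ℕ.*-monoˡ-≤ bʲ level-large ⟩
      4 * Q * lev * bʲ         ≡⟨ ℕ.*-assoc (4 * Q) lev bʲ ⟩
      4 * Q * (lev * bʲ)       ≤⟨ ℕ.*-monoʳ-≤ (4 * Q) typ ⟩
      4 * Q * (D * (w * dG))   ≡⟨ e₂ Q D w dG ⟩
      D * (4 * w * (Q * dG))   ∎) ⟩
    4 * w * (Q * dG)      ∎)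
  where
  open ℕ.≤-Reasoning
  e₁ : ∀ w u c → 4 * w * (u * c) ≡ 4 * u * (w * c)
  e₁ = solve-∀
  e₂ : ∀ Q D w d → 4 * Q * (D * (w * d)) ≡ D * (4 * w * (Q * d))
  e₂ = solve-∀
  mean : D * suc (2 * u) ≤ 2 * Q * (lev + 2 * j)
  mean = ℕ.*-cancelʳ-≤ _ _ p (begin
    D * suc (2 * u) * p                  ≡⟨ ℕ.*-assoc D _ p ⟩
    D * (suc (2 * u) * p)                ≤⟨ ℕ.*-monoʳ-≤ D n-large ⟩
    D * (suc (suc (2 * u)) * (w * Cₙ))   ≡⟨ e₃ D u w Cₙ ⟩
    2 * (D * w) * (suc u * Cₙ)           ≤⟨ ℕ.*-monoʳ-≤ (2 * (D * w)) degH ⟩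
    2 * (D * w) * (Q * dH)               ≡⟨ e₄ D w Q dH ⟩
    2 * Q * (D * (w * dH))               ≤⟨ ℕ.*-monoʳ-≤ (2 * Q) low ⟩
    2 * Q * (p * (lev + 2 * j))          ≡⟨ e₅ Q p (lev + 2 * j) ⟩
    2 * Q * (lev + 2 * j) * p            ∎)
    where
    e₃ : ∀ D u w c → D * (suc (suc (2 * u)) * (w * c)) ≡ 2 * (D * w) * (suc u * c)
    e₃ = solve-∀
    e₄ : ∀ D w Q d → 2 * (D * w) * (Q * d) ≡ 2 * Q * (D * (w * d))
    e₄ = solve-∀
    e₅ : ∀ Q p l → 2 * Q * (p * l) ≡ 2 * Q * l * p
    e₅ = solve-∀
  level-large : D * suc (4 * u) ≤ 4 * Q * lev
  level-large = ℕ.+-cancelʳ-≤ D _ _ (begin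
    D * suc (4 * u) + D               ≡⟨ e₆ D u ⟩
    2 * (D * suc (2 * u))             ≤⟨ ℕ.*-monoʳ-≤ 2 mean ⟩
    2 * (2 * Q * (lev + 2 * j))       ≡⟨ e₇ Q lev j ⟩
    4 * Q * lev + 8 * (Q * j)         ≡⟨ cong (4 * Q * lev +_) D≡ ⟨
    4 * Q * lev + D                   ∎)
    where
    e₆ : ∀ D u → D * suc (4 * u) + D ≡ 2 * (D * suc (2 * u))
    e₆ = solve-∀
    e₇ : ∀ Q l j → 2 * (2 * Q * (l + 2 * j)) ≡ 4 * Q * l + 8 * (Q * j)
    e₇ = solve-∀

-- Half of all samples have large minimum degree

module Sampling (k ℓ : ℕ) (ℓ<k : ℓ < k) (u Q : ℕ) (1≤Q : 1 ≤ Q) (B : ℕ) where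

  private
    j = k ∸ ℓ
    D = 8 * (Q * j)
    R = rate D

    1≤j : 1 ≤ j
    1≤j = ℕ.m<n⇒0<n∸m ℓ<k

    1≤D : 1 ≤ D
    1≤D = ℕ.≤-trans (ℕ.*-mono-≤ 1≤Q 1≤j) (ℕ.m≤n*m (Q * j) 8)

    abstract
      -- The first bound makes (b/size)^j exceed 4u/(4u + 1) and the sample size at least B. The
      -- second pays for the union bound: (size + 1)^ℓ for the ℓ-sets, (size + 1)^j from
      -- `atypical-count`, and a factor 4 to keep the failures to a quarter.
      choice : ∃ λ b → suc (suc (4 * u) * (j * k)) + B ≤ b × (4 * (b + suc k)) ^ k * R ^ b ≤ suc R ^ b
      choice = exponential-dominates R 4 k (suc k) _ (ℕ.m≤n+m 1 _) (ℕ.≤-trans (s≤s z≤n) ℓ<k)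

    b = proj₁ choice

  size : ℕ
  size = b + k

  B≤size : B ≤ size
  B≤size = ℕ.≤-trans (ℕ.m≤n+m B _) (ℕ.≤-trans (proj₁ (proj₂ choice)) (ℕ.m≤m+n b k))

  -- The summands ensure, in turn, that at most a quarter of the words repeat a vertex, that j! C(n,
  -- j) is close to n^j (`n-large`), and that n is positive.
  threshold : ℕ
  threshold = 4 * (size * size) + suc (suc (suc (2 * u)) * (j * j)) + 1

  good : ∀ {n} → KGraph k n → Vec (Fin n) size → Bool
  good H x = distinct x ∧ does (u * (size C j) ℕ.<? Q * minDegree ℓ (pullback H x))

  private
    ℓ≤size : ℓ ≤ size
    ℓ≤size = ℕ.≤-trans (ℕ.<⇒≤ ℓ<k) (ℕ.m≤n+m k b)

  module _ {n : ℕ} (threshold≤n : threshold ≤ n) (H : KGraph k n)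
           (dense : suc u * (n C j) ≤ Q * minDegree ℓ H) where

    private
      V = allFin n

      ∣V∣≡n : length V ≡ n
      ∣V∣≡n = List.length-tabulate {n = n} id

      1≤n : 1 ≤ n
      1≤n = ℕ.≤-trans (ℕ.m≤n+m 1 _) threshold≤n

      instance
        n≢0 : NonZero n
        n≢0 = ℕ.>-nonZero 1≤n

        V≢[] : NonZero (length V)
        V≢[] = subst NonZero (sym ∣V∣≡n) n≢0

        D≢0 : NonZero D
        D≢0 = ℕ.>-nonZero 1≤D

      open Typical V D 1≤D b

      -- The indicator is scaled to the values 0 and D so that the loss of 2 per coordinate in
      -- `level` is small compared with the range.
      link : ∀ {i} → Vec (Fin n) i → Vec (Fin n) j → ℕ
      link t y = D * ι (edge H (set y ∪ set t))

      link≤D : ∀ {i} (t : Vec (Fin n) i) y → link t y ≤ D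
      link≤D t y = ℕ.≤-trans (ℕ.*-monoʳ-≤ D (ι≤1 (edge H (set y ∪ set t)))) (ℕ.≤-reflexive (ℕ.*-identityʳ D))

      -- The link of the vertices at `P` is tested on the entries outside `P` only, which are
      -- independent of it.
      bad : Vec (Fin n) size → Subset size → Bool
      bad x P = atypical j (link (sel P x)) (toList (sel (∁ P) x))

      n-large : suc (2 * u) * n ^ j ≤ suc (suc (2 * u)) * (j ! * (n C j))
      n-large = begin
        suc (2 * u) * n ^ j                   ≡⟨ cong (λ i → suc (2 * u) * i ^ j) n′+j≡n ⟨
        suc (2 * u) * (n′ + j) ^ j            ≤⟨ ℕ.<⇒≤ (^-+-< (suc (2 * u)) n′ j j (ℕ.≤-trans big (ℕ.≤-reflexive (sym n′+j≡n)))) ⟩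
        suc (suc (2 * u)) * n′ ^ j            ≤⟨ ℕ.*-monoʳ-≤ (suc (suc (2 * u))) (^≤!*C n′ j) ⟩
        suc (suc (2 * u)) * (j ! * ((n′ + j) C j)) ≡⟨ cong (λ i → suc (suc (2 * u)) * (j ! * (i C j))) n′+j≡n ⟩
        suc (suc (2 * u)) * (j ! * (n C j))   ∎
        where
        open ℕ.≤-Reasoning
        n′ = n ∸ j
        big : suc (suc (2 * u)) * (j * j) < n
        big = ℕ.≤-trans (ℕ.≤-trans (ℕ.m≤n+m (suc (suc (suc (2 * u)) * (j * j))) (4 * (size * size))) (ℕ.m≤m+n _ 1)) threshold≤n
        j≤n : j ≤ n
        j≤n = ℕ.≤-trans (ℕ.≤-trans (ℕ.m≤m*n j j {{ℕ.>-nonZero 1≤j}}) (ℕ.m≤n*m (j * j) (suc (suc (2 * u))))) (ℕ.<⇒≤ big)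
        n′+j≡n : n′ + j ≡ n
        n′+j≡n = ℕ.m∸n+n≡m j≤n

      b-large : 4 * u * size ^ j < suc (4 * u) * b ^ j
      b-large = ^-+-< (4 * u) b k j (ℕ.≤-trans (ℕ.≤-trans (ℕ.m≤m+n (suc (suc (4 * u) * (j * k))) B) (proj₁ (proj₂ choice))) (ℕ.m≤m+n b k))

      typical⇒degree : ∀ x → T (distinct x) → ∀ P → ∣ P ∣ ≡ ℓ → ¬ T (bad x P) →
                       u * (size C j) < Q * deg (pullback H x) P
      typical⇒degree x t P ∣P∣≡ℓ typical = level-transfer {u} {Q} {j} {D} {n ^ j} {level j (link (sel P x))} {j !}
        refl {{D≢0}} {{ℕ.m^n≢0 n j}} {{j !≢0}}
        (begin
          level j (link (sel P x)) * b ^ j                     ≤⟨ ℕ.≮⇒≥ (typical ∘ T-does⁺ (_ ℕ.<? _)) ⟩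
          ∑ (words (toList (sel (∁ P) x)) j) (link (sel P x))  ≤⟨ words-≼ (sel-≼ (∁ P) x) j _ ⟩
          ∑ (words (toList x) j) (link (sel P x))              ≡⟨ ∑-*ˡ (words (toList x) j) D _ ⟩
          D * ∑ (words (toList x) j) (λ y → ι (edge H (set y ∪ set (sel P x))))
            ≤⟨ ℕ.*-monoʳ-≤ D (subst (λ i → ∑ (words (toList x) (k ∸ i)) (λ y → ι (edge H (set y ∪ set (sel P x)))) ≤ (k ∸ i) ! * deg (pullback H x) P)
                 ∣P∣≡ℓ (sample-degree H x t P (ℕ.≤-trans (ℕ.≤-reflexive ∣P∣≡ℓ) (ℕ.<⇒≤ ℓ<k)))) ⟩
          D * (j ! * deg (pullback H x) P)                     ∎)
        (begin
          D * (j ! * deg H S)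
            ≡⟨ cong (D *_) (subst (λ i → ∑ (words V (k ∸ i)) (λ y → ι (edge H (set y ∪ S))) ≡ (k ∸ i) ! * deg H S)
                 ∣S∣≡ℓ (ordered-degree H S (ℕ.≤-trans (ℕ.≤-reflexive ∣S∣≡ℓ) (ℕ.<⇒≤ ℓ<k)))) ⟨
          D * ∑ (words V j) (λ y → ι (edge H (set y ∪ S)))     ≡⟨ ∑-*ˡ (words V j) D _ ⟨
          ∑ (words V j) (link (sel P x))                       ≤⟨ level-lower j (link (sel P x)) ⟩
          length V ^ j * (level j (link (sel P x)) + 2 * j)    ≡⟨ cong (λ i → i ^ j * (level j (link (sel P x)) + 2 * j)) ∣V∣≡n ⟩
          n ^ j * (level j (link (sel P x)) + 2 * j)           ∎)
        (ℕ.≤-trans dense (ℕ.*-monoʳ-≤ Q (minDegree≤deg ℓ H S ∣S∣≡ℓ)))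
        n-large b-large (!*C≤^ size j)
        where
        open ℕ.≤-Reasoning
        open import Data.Nat.Properties using (_!≢0)
        S = set (sel P x)
        ∣S∣≡ℓ : ∣ S ∣ ≡ ℓ
        ∣S∣≡ℓ = trans (cong ∣_∣ (sym (image-lookup x P))) (trans (∣image∣≡ (distinct⇒injective x t) P) ∣P∣≡ℓ)

      ℓ-sets : List (Subset size)
      ℓ-sets = filter (λ P → ∣ P ∣ ℕ.≟ ℓ) (subsets size)

      not-good : ∀ x → ι (not (good H x)) ≤ ι (not (distinct x)) + ∑ ℓ-sets (ι ∘ bad x)
      not-good x = ι≤ _ λ ng → ℕ.≰⇒> λ none → T-not⁻ ng (is-good none)
        where
        module _ (none : ι (not (distinct x)) + ∑ ℓ-sets (ι ∘ bad x) ≤ 0) where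
          t : T (distinct x)
          t = true-if (distinct x) (ℕ.m+n≤o⇒m≤o (ι (not (distinct x))) none)
            where
            true-if : ∀ c → ι (not c) ≤ 0 → T c
            true-if true _ = tt
          is-good : T (good H x)
          is-good = T-∧⁺ t (T-does⁺ (_ ℕ.<? _) (minDegree-elim ℓ (pullback H x) ℓ≤size (λ d → u * (size C j) < Q * d)
            λ P ∣P∣≡ℓ → typical⇒degree x t P ∣P∣≡ℓ λ bd → ℕ.<⇒≱ (T⇒1≤ι bd)
              (ℕ.≤-trans (∑-∈ (ι ∘ bad x) (List∈.∈-filter⁺ (λ P → ∣ P ∣ ℕ.≟ ℓ) (∈-subsets P) ∣P∣≡ℓ))
                (ℕ.≤-trans (ℕ.m≤n+m _ (ι (not (distinct x)))) none))))

      W = words V size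

      bad-count : ∀ P → ∣ P ∣ ≡ ℓ → ∑ W (λ x → ι (bad x P)) * suc R ^ b ≤ suc size ^ j * (R ^ b * n ^ size)
      bad-count P ∣P∣≡ℓ = begin
        ∑ W (λ x → ι (bad x P)) * suc R ^ b
          ≡⟨ cong (_* suc R ^ b) (∑-sel V P (λ t y → ι (atypical j (link t) (toList y)))) ⟩
        ∑ (words V ∣ P ∣) (λ t → ∑ (words V ∣ ∁ P ∣) (λ y → ι (atypical j (link t) (toList y)))) * suc R ^ b
          ≡⟨ ∑-*ʳ (words V ∣ P ∣) (suc R ^ b) _ ⟨
        ∑ (words V ∣ P ∣) (λ t → ∑ (words V ∣ ∁ P ∣) (λ y → ι (atypical j (link t) (toList y))) * suc R ^ b)
          ≤⟨ ∑-≤ (words V ∣ P ∣) (λ t → atypical-count j (link t) (link≤D t) ∣ ∁ P ∣ (Subset.∣p∣≤n (∁ P)) room) ⟩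
        length (words V ∣ P ∣) * (suc size ^ j * (R ^ b * length V ^ ∣ ∁ P ∣))
          ≡⟨ cong₂ (λ p q → p * (suc size ^ j * (R ^ b * q ^ ∣ ∁ P ∣))) (length-words-allFin n ∣ P ∣) ∣V∣≡n ⟩
        n ^ ∣ P ∣ * (suc size ^ j * (R ^ b * n ^ ∣ ∁ P ∣))
          ≡⟨ regroup (n ^ ∣ P ∣) (suc size ^ j) (R ^ b) (n ^ ∣ ∁ P ∣) ⟩
        suc size ^ j * (R ^ b * (n ^ ∣ P ∣ * n ^ ∣ ∁ P ∣))
          ≡⟨ cong (λ p → suc size ^ j * (R ^ b * p)) (trans (sym (ℕ.^-distribˡ-+-* n ∣ P ∣ ∣ ∁ P ∣)) (cong (n ^_) sizes)) ⟩
        suc size ^ j * (R ^ b * n ^ size) ∎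
        where
        open ℕ.≤-Reasoning
        sizes : ∣ P ∣ + ∣ ∁ P ∣ ≡ size
        sizes = trans (cong (∣ P ∣ +_) (Subset.∣∁p∣≡n∸∣p∣ P)) (ℕ.m+[n∸m]≡n (Subset.∣p∣≤n P))
        -- This explains `size = b + k`: after ℓ positions are set aside, b + (k - ℓ) remain, enough
        -- to remove one entry per coordinate and still have `b` left.
        room : b + j ≤ ∣ ∁ P ∣
        room = ℕ.≤-reflexive (sym (trans (Subset.∣∁p∣≡n∸∣p∣ P) (trans (cong (size ∸_) ∣P∣≡ℓ) (ℕ.+-∸-assoc b (ℕ.<⇒≤ ℓ<k)))))
        regroup : ∀ p q r s → p * (q * (r * s)) ≡ q * (r * (p * s))
        regroup = solve-∀

      -- Union bound over at most (size + 1)^ℓ sets. The exponents ℓ and j = k - ℓ add up to k, and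
      -- 4 ≤ 4^k brings the product into the form dominated in `choice`.
      all-bad-count : 4 * ∑ W (λ x → ∑ ℓ-sets (ι ∘ bad x)) ≤ n ^ size
      all-bad-count = ℕ.*-cancelʳ-≤ _ _ (suc R ^ b) {{ℕ.m^n≢0 (suc R) b}} (begin
        4 * ∑ W (λ x → ∑ ℓ-sets (ι ∘ bad x)) * suc R ^ b
          ≡⟨ cong (λ z → 4 * z * suc R ^ b) (∑-swap W ℓ-sets (λ x P → ι (bad x P))) ⟩
        4 * ∑ ℓ-sets (λ P → ∑ W (λ x → ι (bad x P))) * suc R ^ b
          ≡⟨ trans (ℕ.*-assoc 4 (∑ ℓ-sets count) (suc R ^ b)) (cong (4 *_) (sym (∑-*ʳ ℓ-sets (suc R ^ b) count))) ⟩
        4 * ∑ ℓ-sets (λ P → ∑ W (λ x → ι (bad x P)) * suc R ^ b)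
          ≤⟨ ℕ.*-monoʳ-≤ 4 (∑-≤-All (All.map (λ {P} → bad-count P) (All.all-filter (λ P → ∣ P ∣ ℕ.≟ ℓ) (subsets size)))) ⟩
        4 * (length ℓ-sets * (suc size ^ j * (R ^ b * n ^ size)))
          ≤⟨ ℕ.*-mono-≤ 4≤4^k (ℕ.*-monoˡ-≤ _ few) ⟩
        4 ^ k * (suc size ^ ℓ * (suc size ^ j * (R ^ b * n ^ size)))
          ≡⟨ regroup (4 ^ k) (suc size ^ ℓ) (suc size ^ j) (R ^ b) (n ^ size) ⟩
        4 ^ k * (suc size ^ ℓ * suc size ^ j) * R ^ b * n ^ size
          ≡⟨ cong (λ p → 4 ^ k * p * R ^ b * n ^ size) (trans (sym (ℕ.^-distribˡ-+-* (suc size) ℓ j)) (cong (suc size ^_) (ℕ.m+[n∸m]≡n (ℕ.<⇒≤ ℓ<k)))) ⟩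
        4 ^ k * suc size ^ k * R ^ b * n ^ size
          ≡⟨ cong (λ p → p * R ^ b * n ^ size) (trans (sym (*-^ 4 (suc size) k)) (cong (λ s → (4 * s) ^ k) (sym (ℕ.+-suc b k)))) ⟩
        (4 * (b + suc k)) ^ k * R ^ b * n ^ size
          ≤⟨ ℕ.*-monoˡ-≤ (n ^ size) (proj₂ (proj₂ choice)) ⟩
        suc R ^ b * n ^ size
          ≡⟨ ℕ.*-comm (suc R ^ b) _ ⟩
        n ^ size * suc R ^ b ∎)
        where
        open ℕ.≤-Reasoning
        count : Subset size → ℕ
        count P = ∑ W (λ x → ι (bad x P))
        4≤4^k : 4 ≤ 4 ^ k
        4≤4^k = ℕ.^-monoʳ-≤ 4 (ℕ.≤-trans (s≤s z≤n) ℓ<k)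
        few : length ℓ-sets ≤ suc size ^ ℓ
        few = ℕ.≤-trans (ℕ.≤-reflexive (sized-subsets size ℓ))
          (ℕ.≤-trans (C≤^ size ℓ) (ℕ.^-monoˡ-≤ ℓ (ℕ.n≤1+n size)))
        regroup : ∀ p q r s t → p * (q * (r * (s * t))) ≡ p * (q * r) * s * t
        regroup = solve-∀

      non-distinct-rare : 4 * ∑ W (ι ∘ not ∘ distinct) ≤ n ^ size
      non-distinct-rare = ℕ.*-cancelˡ-≤ n (begin
        n * (4 * X)                     ≡⟨ swap n 4 X ⟩
        4 * (n * X)                     ≤⟨ ℕ.*-monoʳ-≤ 4 (non-distinct-count n size) ⟩
        4 * (size * size * n ^ size)    ≡⟨ ℕ.*-assoc 4 (size * size) _ ⟨
        4 * (size * size) * n ^ size    ≤⟨ ℕ.*-monoˡ-≤ (n ^ size) (ℕ.≤-trans (ℕ.≤-trans (ℕ.m≤m+n (4 * (size * size)) _) (ℕ.m≤m+n _ 1)) threshold≤n) ⟩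
        n * n ^ size                    ∎)
        where
        open ℕ.≤-Reasoning
        X = ∑ W (ι ∘ not ∘ distinct)
        swap : ∀ p q r → p * (q * r) ≡ q * (p * r)
        swap = solve-∀

    -- At most a quarter of the words fail by repeating a vertex, and at most another quarter by
    -- having an atypical ℓ-set.
    good-count : n ^ size ≤ 2 * ∑ W (ι ∘ good H)
    good-count = ℕ.*-cancelˡ-≤ 2 (ℕ.+-cancelʳ-≤ (2 * n ^ size) _ _ (begin
      2 * n ^ size + 2 * n ^ size                   ≡⟨ double (n ^ size) ⟩
      4 * n ^ size                                  ≡⟨ cong (4 *_) total ⟩
      4 * (∑ W (ι ∘ good H) + ∑ W (ι ∘ not ∘ good H))
        ≤⟨ ℕ.*-monoʳ-≤ 4 (ℕ.+-monoʳ-≤ (∑ W (ι ∘ good H)) (ℕ.≤-trans (∑-mono W not-good) (ℕ.≤-reflexive (∑-+ W _ _)))) ⟩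
      4 * (∑ W (ι ∘ good H) + (∑ W (ι ∘ not ∘ distinct) + ∑ W (λ x → ∑ ℓ-sets (ι ∘ bad x))))
        ≡⟨ expand (∑ W (ι ∘ good H)) (∑ W (ι ∘ not ∘ distinct)) _ ⟩
      2 * (2 * ∑ W (ι ∘ good H)) + (4 * ∑ W (ι ∘ not ∘ distinct) + 4 * ∑ W (λ x → ∑ ℓ-sets (ι ∘ bad x)))
        ≤⟨ ℕ.+-monoʳ-≤ (2 * (2 * ∑ W (ι ∘ good H))) (ℕ.+-mono-≤ non-distinct-rare all-bad-count) ⟩
      2 * (2 * ∑ W (ι ∘ good H)) + (n ^ size + n ^ size)
        ≡⟨ cong (2 * (2 * ∑ W (ι ∘ good H)) +_) (cong (n ^ size +_) (sym (ℕ.+-identityʳ _))) ⟩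
      2 * (2 * ∑ W (ι ∘ good H)) + 2 * n ^ size ∎))
      where
      open ℕ.≤-Reasoning
      double : ∀ p → 2 * p + 2 * p ≡ 4 * p
      double = solve-∀
      expand : ∀ p q r → 4 * (p + (q + r)) ≡ 2 * (2 * p) + (4 * q + 4 * r)
      expand = solve-∀
      complement : ∀ c → ι c + ι (not c) ≡ 1
      complement true  = refl
      complement false = refl
      total : n ^ size ≡ ∑ W (ι ∘ good H) + ∑ W (ι ∘ not ∘ good H)
      total = trans (sym (length-words-allFin n size)) (trans (sym (ℕ.*-identityʳ _))
        (trans (sym (∑-const W 1)) (trans (∑-cong W (λ x → sym (complement (good H x)))) (∑-+ W _ _))))

-- Homogeneous boxes

-- Pigeonhole one test at a time: keeping the more frequent answer loses a factor of at most 2. It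
-- is used both for the edge bits of H[x] and for the fibre pattern in the box argument.
agreeing : ∀ (W : List A) (test : B → A → Bool) (bs : List B) (X : A → Bool) →
  Σ (A → Bool) λ Y → (∀ a → T (Y a) → T (X a)) ×
    (∀ {a a′} → T (Y a) → T (Y a′) → ∀ {β} → β ∈ˡ bs → test β a ≡ test β a′) ×
    ∑ W (ι ∘ X) ≤ 2 ^ length bs * ∑ W (ι ∘ Y)
agreeing W test []       X = X , (λ _ t → t) , (λ _ _ ()) , ℕ.≤-reflexive (sym (ℕ.+-identityʳ _))
agreeing {A = A} W test (β ∷ bs) X = extend (ℕ.≤-total (∑ W (ι ∘ X₀)) (∑ W (ι ∘ X₁)))
  where
  X₀ X₁ : A → Bool
  X₀ a = X a ∧ not (test β a)
  X₁ a = X a ∧ test β a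

  split : ∑ W (ι ∘ X) ≡ ∑ W (ι ∘ X₀) + ∑ W (ι ∘ X₁)
  split = trans (∑-cong W (λ a → ι-split (X a) (test β a))) (∑-+ W (ι ∘ X₀) (ι ∘ X₁))
    where
    ι-split : ∀ p q → ι p ≡ ι (p ∧ not q) + ι (p ∧ q)
    ι-split true  true  = refl
    ι-split true  false = refl
    ι-split false q     = refl

  continue : ∀ Z → (∀ a → T (Z a) → T (X a)) → (∀ {a a′} → T (Z a) → T (Z a′) → test β a ≡ test β a′) →
             ∑ W (ι ∘ X) ≤ 2 * ∑ W (ι ∘ Z) →
             Σ (A → Bool) λ Y → (∀ a → T (Y a) → T (X a)) ×
               (∀ {a a′} → T (Y a) → T (Y a′) → ∀ {γ} → γ ∈ˡ β ∷ bs → test γ a ≡ test γ a′) ×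
               ∑ W (ι ∘ X) ≤ 2 ^ suc (length bs) * ∑ W (ι ∘ Y)
  continue Z Z⇒X same half with Y , Y⇒Z , agree , large ← agreeing W test bs Z =
    Y , (λ a → Z⇒X a ∘ Y⇒Z a) ,
    (λ { ya ya′ (here refl) → same (Y⇒Z _ ya) (Y⇒Z _ ya′)
       ; ya ya′ (there γ∈)  → agree ya ya′ γ∈ }) ,
    ℕ.≤-trans half (ℕ.≤-trans (ℕ.*-monoʳ-≤ 2 large) (ℕ.≤-reflexive (sym (ℕ.*-assoc 2 (2 ^ length bs) _))))

  double : ∀ {p q} → p ≤ q → p + q ≤ 2 * q
  double {p} {q} p≤q = ℕ.≤-trans (ℕ.+-monoˡ-≤ q p≤q) (ℕ.≤-reflexive (cong (q +_) (sym (ℕ.+-identityʳ q))))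

  T-true : ∀ {b} → T b → b ≡ true
  T-true {true} _ = refl

  T-false : ∀ {b} → T (not b) → b ≡ false
  T-false {false} _ = refl

  extend : ∑ W (ι ∘ X₀) ≤ ∑ W (ι ∘ X₁) ⊎ ∑ W (ι ∘ X₁) ≤ ∑ W (ι ∘ X₀) → _
  extend (inj₁ le) = continue X₁ (λ a t → proj₁ (T-∧⁻ t))
    (λ {a} {a′} t t′ → trans (T-true (proj₂ (T-∧⁻ {X a} t))) (sym (T-true (proj₂ (T-∧⁻ {X a′} t′)))))
    (ℕ.≤-trans (ℕ.≤-reflexive split) (double le))
  extend (inj₂ le) = continue X₀ (λ a t → proj₁ (T-∧⁻ t))
    (λ {a} {a′} t t′ → trans (T-false (proj₂ (T-∧⁻ {X a} t))) (sym (T-false (proj₂ (T-∧⁻ {X a′} t′)))))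
    (ℕ.≤-trans (ℕ.≤-reflexive (trans split (ℕ.+-comm (∑ W (ι ∘ X₀)) _))) (double le))

unique-lookup-injective : ∀ {xs : List A} → Unique xs → Injective _≡_ _≡_ (List.lookup xs)
unique-lookup-injective (_  ∷ _)  {zero}  {zero}  _  = refl
unique-lookup-injective (x≢ ∷ _)  {zero}  {suc j} eq = contradiction eq (All.lookup x≢ (List∈.∈-lookup j))
unique-lookup-injective (x≢ ∷ _)  {suc i} {zero}  eq = contradiction (sym eq) (All.lookup x≢ (List∈.∈-lookup i))
unique-lookup-injective (_  ∷ u)  {suc i} {suc j} eq = cong suc (unique-lookup-injective u eq)

Box : (m s n : ℕ) → (Vec (Fin n) m → Bool) → Set
Box m s n X = Σ (Fin m → Fin s → Fin n) λ S → (∀ i → Injective _≡_ _≡_ (S i)) ×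
                (∀ x → (∀ i → ∃ λ r → lookup x i ≡ S i r) → T (X x))

∑-≥-All : ∀ {xs : List A} {f : A → ℕ} {c} → All (λ x → c ≤ f x) xs → length xs * c ≤ ∑ xs f
∑-≥-All []       = z≤n
∑-≥-All (p ∷ ps) = ℕ.+-mono-≤ p (∑-≥-All ps)

-- One step of Erdős' induction.  Take t = 4Ks first coordinates v whose fibre
-- X(v, -) is dense; many y lie in at least s of these fibres, and a positive
-- proportion of those y lie in exactly the same ones.
module BoxStep (m K s : ℕ) (1≤K : 1 ≤ K) (1≤s : 1 ≤ s) (n : ℕ)
               (X : Vec (Fin n) (suc m) → Bool) where

  private
    V = allFin n
    W = words V m
    t = 4 * K * s

  fibre : Fin n → ℕ
  fibre v = ∑ W (λ y → ι (X (v ∷ y)))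

  dense? : ∀ v → Dec (n ^ m ≤ 2 * K * fibre v)
  dense? v = n ^ m ℕ.≤? 2 * K * fibre v

  -- Fibres that are not dense contribute at most half of the total, and a dense one contributes at
  -- most n^m, so about n/(2K) dense ones are needed.
  dense-many : .{{_ : NonZero n}} → n ^ suc m ≤ K * ∑ (words V (suc m)) (ι ∘ X) →
               n ≤ 2 * K * length (filter dense? V)
  dense-many large = ℕ.*-cancelʳ-≤ _ _ (n ^ m) {{ℕ.m^n≢0 n m}} (ℕ.+-cancelʳ-≤ (n * n ^ m) _ _ (begin
    n * n ^ m + n * n ^ m                        ≡⟨ cong (n * n ^ m +_) (ℕ.+-identityʳ _) ⟨
    2 * (n * n ^ m)                              ≤⟨ ℕ.*-monoʳ-≤ 2 large ⟩
    2 * (K * ∑ (words V (suc m)) (ι ∘ X))        ≡⟨ ℕ.*-assoc 2 K _ ⟨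
    2 * K * ∑ (words V (suc m)) (ι ∘ X)          ≡⟨ cong (2 * K *_) (∑-words V _) ⟩
    2 * K * ∑ V fibre                            ≡⟨ ∑-*ˡ V (2 * K) fibre ⟨
    ∑ V (λ v → 2 * K * fibre v)                  ≤⟨ ∑-mono V bound ⟩
    ∑ V (λ v → ι (does (dense? v)) * (2 * K * n ^ m) + n ^ m)
      ≡⟨ trans (∑-+ V _ _) (cong₂ _+_ (∑-*ʳ V (2 * K * n ^ m) (ι ∘ does ∘ dense?)) (∑-const V (n ^ m))) ⟩
    ∑ V (ι ∘ does ∘ dense?) * (2 * K * n ^ m) + length V * n ^ m
      ≡⟨ cong₂ _+_ (regroup (∑ V (ι ∘ does ∘ dense?)) K (n ^ m)) (cong (_* n ^ m) (List.length-tabulate {n = n} id)) ⟩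
    2 * K * ∑ V (ι ∘ does ∘ dense?) * n ^ m + n * n ^ m
      ≡⟨ cong (λ l → 2 * K * l * n ^ m + n * n ^ m) (length-filter dense? V) ⟨
    2 * K * length (filter dense? V) * n ^ m + n * n ^ m ∎))
    where
    open ℕ.≤-Reasoning
    regroup : ∀ a K p → a * (2 * K * p) ≡ 2 * K * a * p
    regroup = solve-∀
    fibre≤ : ∀ v → fibre v ≤ n ^ m
    fibre≤ v = ℕ.≤-trans (∑-≤ W (λ y → ι≤1 (X (v ∷ y))))
      (ℕ.≤-reflexive (trans (ℕ.*-identityʳ _) (length-words-allFin n m)))
    bound : ∀ v → 2 * K * fibre v ≤ ι (does (dense? v)) * (2 * K * n ^ m) + n ^ m
    bound v = by-cases (dense? v)
      where
      by-cases : (d : Dec (n ^ m ≤ 2 * K * fibre v)) → 2 * K * fibre v ≤ ι (does d) * (2 * K * n ^ m) + n ^ m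
      by-cases (yes _) = ℕ.≤-trans (ℕ.*-monoʳ-≤ (2 * K) (fibre≤ v))
        (ℕ.≤-trans (ℕ.≤-reflexive (sym (ℕ.+-identityʳ _))) (ℕ.m≤m+n _ (n ^ m)))
      by-cases (no ¬d) = ℕ.<⇒≤ (ℕ.≰⇒> ¬d)

  box-suc : .{{_ : NonZero n}} → n ^ suc m ≤ K * ∑ (words V (suc m)) (ι ∘ X) → 2 * K * t ≤ n →
            (∀ Y → n ^ m ≤ 4 * K * 2 ^ t * ∑ W (ι ∘ Y) → Box m s n Y) → Box (suc m) s n X
  box-suc large t≤n box = result
    where
    vs : List (Fin n)
    vs = List.take t (filter dense? V)

    length-vs : length vs ≡ t
    length-vs = trans (List.length-take t (filter dense? V)) (ℕ.m≤n⇒m⊓n≡m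
      (ℕ.*-cancelˡ-≤ (2 * K) {{ℕ.m*n≢0 2 K {{_}} {{ℕ.>-nonZero 1≤K}}}} (ℕ.≤-trans t≤n (dense-many large))))

    covering : Vec (Fin n) m → ℕ
    covering y = ∑ vs (λ v → ι (X (v ∷ y)))

    Y : Vec (Fin n) m → Bool
    Y y = does (s ℕ.≤? covering y)

    -- The coverings sum to at least t n^m/(2K) = 2s n^m by the choice t = 4Ks. Words covered fewer
    -- than s times account for at most s n^m, and each remaining word for at most t.
    Y-large : n ^ m ≤ 4 * K * ∑ W (ι ∘ Y)
    Y-large = ℕ.*-cancelˡ-≤ (2 * K * s) {{ℕ.m*n≢0 (2 * K) s {{ℕ.m*n≢0 2 K {{_}} {{ℕ.>-nonZero 1≤K}}}} {{ℕ.>-nonZero 1≤s}}}}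
      (ℕ.+-cancelʳ-≤ (2 * K * s * n ^ m) _ _ (begin
      2 * K * s * n ^ m + 2 * K * s * n ^ m       ≡⟨ double K s (n ^ m) ⟩
      t * n ^ m                                   ≡⟨ cong (_* n ^ m) length-vs ⟨
      length vs * n ^ m                           ≤⟨ ∑-≥-All (All.take⁺ t (All.all-filter dense? V)) ⟩
      ∑ vs (λ v → 2 * K * fibre v)                ≡⟨ ∑-*ˡ vs (2 * K) fibre ⟩
      2 * K * ∑ vs fibre                          ≡⟨ cong (2 * K *_) (∑-swap vs W _) ⟩
      2 * K * ∑ W covering                        ≤⟨ ℕ.*-monoʳ-≤ (2 * K) (∑-mono W bound) ⟩
      2 * K * ∑ W (λ y → ι (Y y) * t + s)         ≡⟨ cong (2 * K *_) (trans (∑-+ W _ _) (cong₂ _+_ (∑-*ʳ W t (ι ∘ Y)) (trans (∑-const W s) (cong (_* s) (length-words-allFin n m))))) ⟩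
      2 * K * (∑ W (ι ∘ Y) * t + n ^ m * s)       ≡⟨ regroup K s (∑ W (ι ∘ Y)) (n ^ m) ⟩
      2 * K * s * (4 * K * ∑ W (ι ∘ Y)) + 2 * K * s * n ^ m ∎))
      where
      open ℕ.≤-Reasoning
      double : ∀ K s p → 2 * K * s * p + 2 * K * s * p ≡ 4 * K * s * p
      double = solve-∀
      regroup : ∀ K s y p → 2 * K * (y * (4 * K * s) + p * s) ≡ 2 * K * s * (4 * K * y) + 2 * K * s * p
      regroup = solve-∀
      bound : ∀ y → covering y ≤ ι (Y y) * t + s
      bound y = by-cases (s ℕ.≤? covering y)
        where
        by-cases : (d : Dec (s ≤ covering y)) → covering y ≤ ι (does d) * t + s
        by-cases (yes _) = ℕ.≤-trans (∑-≤ vs (λ v → ι≤1 (X (v ∷ y)))) (ℕ.≤-trans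
          (ℕ.≤-reflexive (trans (ℕ.*-identityʳ _) (trans length-vs (sym (ℕ.+-identityʳ t))))) (ℕ.m≤m+n _ s))
        by-cases (no ¬s) = ℕ.<⇒≤ (ℕ.≰⇒> ¬s)

    Z-large : ∀ Z → ∑ W (ι ∘ Y) ≤ 2 ^ length vs * ∑ W (ι ∘ Z) → n ^ m ≤ 4 * K * 2 ^ t * ∑ W (ι ∘ Z)
    Z-large Z Y≤Z = begin
      n ^ m                                       ≤⟨ Y-large ⟩
      4 * K * ∑ W (ι ∘ Y)                         ≤⟨ ℕ.*-monoʳ-≤ (4 * K) Y≤Z ⟩
      4 * K * (2 ^ length vs * ∑ W (ι ∘ Z))       ≡⟨ cong (λ l → 4 * K * (2 ^ l * ∑ W (ι ∘ Z))) length-vs ⟩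
      4 * K * (2 ^ t * ∑ W (ι ∘ Z))               ≡⟨ ℕ.*-assoc (4 * K) (2 ^ t) _ ⟨
      4 * K * 2 ^ t * ∑ W (ι ∘ Z)                 ∎
      where open ℕ.≤-Reasoning

    result : Box (suc m) s n X
    result with Z , Z⇒Y , agree , Y≤Z ← agreeing W (λ v y → X (v ∷ y)) vs Y
           with S , S-inj , S⊆Z ← box Z (Z-large Z Y≤Z)
      = S′ , S′-inj , S′⊆X
      where
      -- A reference word: all of `Z` lies in the same fibres, so the first coordinates that work
      -- for `y₀` work for the whole box.
      y₀ : Vec (Fin n) m
      y₀ = Vec.tabulate (λ i → S i (Fin.fromℕ< 1≤s))

      Zy₀ : T (Z y₀)
      Zy₀ = S⊆Z y₀ (λ i → Fin.fromℕ< 1≤s , Vec.lookup∘tabulate _ i)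

      us : List (Fin n)
      us = filter (λ v → T? (X (v ∷ y₀))) vs

      s≤us : s ≤ length us
      s≤us = ℕ.≤-trans (T-does⁻ (s ℕ.≤? covering y₀) (Z⇒Y y₀ Zy₀))
        (ℕ.≤-reflexive (sym (length-filter (λ v → T? (X (v ∷ y₀))) vs)))

      S′ : Fin (suc m) → Fin s → Fin n
      S′ zero    r = List.lookup us (Fin.inject≤ r s≤us)
      S′ (suc i) r = S i r

      S′-inj : ∀ i → Injective _≡_ _≡_ (S′ i)
      S′-inj zero    eq = Fin.inject≤-injective s≤us s≤us _ _ (unique-lookup-injective
        (Unique.filter⁺ (λ v → T? (X (v ∷ y₀))) (Unique.take⁺ t (Unique.filter⁺ dense? (Unique.allFin⁺ n)))) eq)
      S′-inj (suc i) eq = S-inj i eq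

      S′⊆X : ∀ x → (∀ i → ∃ λ r → lookup x i ≡ S′ i r) → T (X x)
      S′⊆X (v ∷ y) on with r , refl ← on zero
                      with v∈vs , Xv ← List∈.∈-filter⁻ (λ v → T? (X (v ∷ y₀))) {xs = vs} (List∈.∈-lookup {xs = us} (Fin.inject≤ r s≤us)) =
        subst T (agree Zy₀ (S⊆Z y (on ∘ suc)) v∈vs) Xv

abstract
  box : ∀ m K s → 1 ≤ K → 1 ≤ s → ∃ λ N → ∀ n → N ≤ n → 1 ≤ n → ∀ X →
        n ^ m ≤ K * ∑ (words (allFin n) m) (ι ∘ X) → Box m s n X
  box zero    K s _   _   = 0 , λ n _ _ X large → (λ ()) , (λ ()) , λ { [] _ → nonempty (X []) large }
    where
    nonempty : ∀ b → 1 ≤ K * (ι b + 0) → T b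
    nonempty true  _  = tt
    nonempty false le = contradiction (ℕ.≤-trans le (ℕ.≤-reflexive (ℕ.*-zeroʳ K))) λ ()
  box (suc m) K s 1≤K 1≤s =
    -- The factor `4 * K` is lost in `Y-large`, and 2^t with t = 4Ks in `agreeing`.
    let N , rec = box m (4 * K * 2 ^ (4 * K * s)) s
                    (ℕ.*-mono-≤ (ℕ.*-mono-≤ {1} {4} (s≤s z≤n) 1≤K) (ℕ.m^n>0 2 (4 * K * s))) 1≤s in
    N + 2 * K * (4 * K * s) , λ n N≤n 1≤n X large →
      BoxStep.box-suc m K s 1≤K 1≤s n X {{ℕ.>-nonZero 1≤n}} large (ℕ.≤-trans (ℕ.m≤n+m _ N) N≤n)
        (rec n (ℕ.≤-trans (ℕ.m≤m+n N _) N≤n) 1≤n)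

-- Blow-ups

module _ {s : ℕ} (1≤s : 1 ≤ s) {F : KGraph k f} {G : KGraph k m} {H : KGraph k n}
         (φ : Embedding F G) (S : Fin m → Fin s → Fin n) (S-inj : ∀ i → Injective _≡_ _≡_ (S i))
         (transversal : ∀ x → (∀ i → ∃ λ r → lookup x i ≡ S i r) →
                        Injective _≡_ _≡_ (lookup x) × (∀ e → T (edge G e) → T (edge H (image (lookup x) e))))
         where

  private
    class : Fin (f * s) → Fin f
    class = quotient s

    index : Fin (f * s) → Fin s
    index = remainder {f} s

    ψ : Fin (f * s) → Fin n
    ψ i = S (to φ (class i)) (index i)

    φ-injective : Injective _≡_ _≡_ (to φ)
    φ-injective = Injection.injective (injection φ)

    choose : (Fin m → Fin s) → Vec (Fin n) m
    choose c = Vec.tabulate (λ a → S a (c a))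

    choose-transversal : ∀ c i → ∃ λ r → lookup (choose c) i ≡ S i r
    choose-transversal c i = c i , Vec.lookup∘tabulate _ i

    same-class : ∀ {i i′} → class i ≡ class i′ → index i ≡ index i′ → i ≡ i′
    same-class {i} {i′} q≡ r≡ = trans (sym (Fin.combine-remQuot {f} s i))
      (trans (cong₂ combine q≡ r≡) (Fin.combine-remQuot {f} s i′))

    -- Two vertices in different parts lie on a common transversal word, and transversal words are
    -- injective.
    parts-disjoint : ∀ {a a′ r r′} → S a r ≡ S a′ r′ → a ≡ a′
    parts-disjoint {a} {a′} {r} {r′} eq with a Fin.≟ a′
    ... | yes a≡a′ = a≡a′
    ... | no  a≢a′ = proj₁ (transversal (choose c) (choose-transversal c))
      (trans (at a r (c-a)) (trans eq (sym (at a′ r′ c-a′))))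
      where
      c : Fin m → Fin s
      c i = if does (i Fin.≟ a) then r else r′
      at : ∀ i r → c i ≡ r → lookup (choose c) i ≡ S i r
      at i r refl = Vec.lookup∘tabulate _ i
      c-a : c a ≡ r
      c-a with a Fin.≟ a
      ... | yes _  = refl
      ... | no a≢a = contradiction refl a≢a
      c-a′ : c a′ ≡ r′
      c-a′ with a′ Fin.≟ a
      ... | yes a′≡a = contradiction (sym a′≡a) a≢a′
      ... | no _     = refl

    ψ-injective : Injective _≡_ _≡_ ψ
    ψ-injective {i} {i′} eq = same-class class≡ (S-inj _ (trans eq (cong (λ a → S a (index i′)) (sym (cong (to φ) class≡)))))
      where
      class≡ : class i ≡ class i′
      class≡ = φ-injective (parts-disjoint eq)

    -- An edge of the blow-up projects onto k vertices and so meets each class at most once. Hence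
    -- some transversal word passes through all its vertices, and that word carries the
    -- corresponding edge of G into H. On positions that the edge does not use, `c` takes an
    -- arbitrary index.
    ψ-preserves : ∀ e → T (edge (blowUp s F) e) → T (edge H (image ψ e))
    ψ-preserves e t = subst (T ∘ edge H) image≡
      (proj₂ (transversal (choose c) (choose-transversal c)) _ (preserves φ _ Fe))
      where
      Fe : T (edge F (image class e))
      Fe = proj₂ (T-∧⁻ {∣ e ∣ ≡ᵇ k} t)
      class-injective : ∀ {i i′} → i ∈ e → i′ ∈ e → class i ≡ class i′ → i ≡ i′
      class-injective = ∣image∣≡⇒injective class e (trans (uniform F _ Fe) (sym (uniform (blowUp s F) e t)))
      hit? : ∀ a → Dec (∃ λ i → i ∈ e × to φ (class i) ≡ a)
      hit? a = Fin.any? λ i → (i Subset.∈? e) ×-dec (to φ (class i) Fin.≟ a)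
      c : Fin m → Fin s
      c a with hit? a
      ... | yes (i , _) = index i
      ... | no _        = Fin.fromℕ< 1≤s
      c-class : ∀ i → i ∈ e → c (to φ (class i)) ≡ index i
      c-class i i∈e with hit? (to φ (class i))
      ... | yes (i′ , i′∈e , eq) = cong index (class-injective i′∈e i∈e (φ-injective eq))
      ... | no ¬hit              = contradiction (i , i∈e , refl) ¬hit
      image≡ : image (lookup (choose c)) (image (to φ) (image class e)) ≡ image ψ e
      image≡ = trans (cong (image _) (sym (image-∘ (to φ) class e))) (trans (sym (image-∘ _ (to φ ∘ class) e))
        (image-cong (λ i i∈e → trans (Vec.lookup∘tabulate _ (to φ (class i))) (cong (S _) (c-class i i∈e)))))

  blowUp-embedding : Embedding (blowUp s F) H
  blowUp-embedding = record { injection = mk↣ ψ-injective ; preserves = ψ-preserves }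

-- Taking the vertex of index 0 from every class gives a copy of F inside F(s).
embedding-from-blowUp : ∀ {s} → 1 ≤ s → {F : KGraph k f} {H : KGraph k n} →
                        Embedding (blowUp s F) H → Embedding F H
embedding-from-blowUp {k} {f} {s = s} 1≤s {F} {H} φ = record
  { injection = mk↣ (λ {i} {i′} eq → base-injective (Injection.injective (injection φ) eq))
  ; preserves = λ e t → subst (T ∘ edge H) (sym (image-∘ (to φ) base e)) (preserves φ (image base e) (T-∧⁺
      (ℕ.≡⇒≡ᵇ ∣ image base e ∣ k (trans (∣image∣≡ base-injective e) (uniform F e t)))
      (subst (T ∘ edge F) (sym (trans (sym (image-∘ (quotient s) base e)) (image-id e class-base))) t)))
  }
  where
  base : Fin f → Fin (f * s)
  base i = combine i (Fin.fromℕ< 1≤s)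
  class-base : ∀ i → quotient s (base i) ≡ i
  class-base i = cong proj₁ (Fin.remQuot-combine i (Fin.fromℕ< 1≤s))
  base-injective : Injective _≡_ _≡_ base
  base-injective {i} {i′} eq = trans (sym (class-base i)) (trans (cong (quotient s) eq) (class-base i′))

-- Counting copies

unique-subsets : ∀ n → Unique (subsets n)
unique-subsets zero    = [] ∷ []
unique-subsets (suc n) = Unique.++⁺ (Unique.map⁺ Vec.∷-injectiveʳ (unique-subsets n))
  (Unique.map⁺ Vec.∷-injectiveʳ (unique-subsets n)) λ (∈in , ∈out) → disjoint ∈in ∈out
  where
  disjoint : ∀ {S} → S ∈ˡ map (inside ∷_) (subsets n) → ¬ S ∈ˡ map (outside ∷_) (subsets n)
  disjoint ∈in ∈out with _ , _ , refl ← List∈.∈-map⁻ (inside ∷_) ∈in with _ , _ , () ← List∈.∈-map⁻ (outside ∷_) ∈out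

module _ {F : KGraph k f} {H : KGraph k n} where

  Spans : Subset n → Set
  Spans A = Σ (Embedding F H) λ ψ → imageVertices ψ ≡ A

  spanning : ∀ {As} → All Spans As → List (Embedding F H)
  spanning = All.reduce proj₁

  length-spanning : ∀ {As} (σ : All Spans As) → length (spanning σ) ≡ length As
  length-spanning []       = refl
  length-spanning (_ ∷ σ) = cong suc (length-spanning σ)

  -- One copy is kept for each vertex set, so copies differ because their vertex sets do.
  spanning-distinct : ∀ {As} (σ : All Spans As) → Unique As → AllPairs (λ φ ψ → ¬ SameCopy φ ψ) (spanning σ)
  spanning-distinct []                 []        = []
  spanning-distinct ((φ , refl) ∷ σ) (A≢ ∷ u) = apart σ A≢ ∷ spanning-distinct σ u
    where
    apart : ∀ {As} (σ : All Spans As) → All (imageVertices φ ≢_) As → All (λ ψ → ¬ SameCopy φ ψ) (spanning σ)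
    apart []                []         = []
    apart ((ψ , refl) ∷ σ) (A≢ ∷ A≢s) = (A≢ ∘ proj₁) ∷ apart σ A≢s

-- A vertex set A of size at most f accounts for at most f^f n^(m − f) of the x.
module _ {F : KGraph k f} {H : KGraph k n} (1≤n : 1 ≤ n) (1≤m : 1 ≤ m) (φ : Fin f → Fin m)
         (φ-inj : Injective _≡_ _≡_ φ) (X : Vec (Fin n) m → Bool)
         (embed : ∀ x → T (X x) → Σ (Embedding F H) λ ψ → ∀ i → to ψ i ≡ lookup x (φ i)) where

  private
    V = allFin n
    W = words V m
    P = image φ Subset.⊤

    ∣P∣≡f : ∣ P ∣ ≡ f
    ∣P∣≡f = trans (∣image∣≡ φ-inj Subset.⊤) (Subset.∣⊤∣≡n f)

    Hit : Subset n → Vec (Fin n) m → Set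
    Hit A x = T (X x) × set (sel P x) ≡ A

    hit? : ∀ A x → Dec (Hit A x)
    hit? A x = T? (X x) ×-dec Vec.≡-dec Bool._≟_ (set (sel P x)) A

    any-hit? : ∀ A → Dec (Any.Any (Hit A) W)
    any-hit? A = Any.any? (hit? A) W

    As : List (Subset n)
    As = filter any-hit? (subsets n)

    spans : ∀ {A} → Any.Any (Hit A) W → Spans {F = F} {H} A
    spans hit with x , _ , Xx , refl ← find hit = proj₁ (embed x Xx) ,
      trans (image-cong (λ i _ → proj₂ (embed x Xx) i))
        (trans (image-∘ (lookup x) φ Subset.⊤) (image-lookup x P))

    inside-count : ∀ {j} → Subset n → Vec (Fin n) j → ℕ
    inside-count A = ∏ (λ _ v → ι (lookup A v))

    ∑-inside : ∀ A j → ∑ (words V j) (inside-count A) ≡ ∣ A ∣ ^ j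
    ∑-inside A zero    = refl
    ∑-inside A (suc j) = trans (∑-∏ V {j} (λ _ v → ι (lookup A v))) (cong₂ _*_ (sym (∣S∣≡∑ A)) (∑-inside A j))

    1≤inside : ∀ {j} A (y : Vec (Fin n) j) → (∀ i → lookup y i ∈ A) → 1 ≤ inside-count A y
    1≤inside A []      _   = ℕ.≤-refl
    1≤inside A (v ∷ y) y⊆A = ℕ.*-mono-≤ (T⇒1≤ι (∈⇒T (y⊆A zero))) (1≤inside A y (y⊆A ∘ suc))

    X≤hits : ∀ x → ι (X x) ≤ ∑ As (λ A → inside-count A (sel P x))
    X≤hits x = ι≤ (X x) λ Xx → ℕ.≤-trans (1≤inside (set (sel P x)) (sel P x) (∈-set⁺ (sel P x)))
      (∑-∈ (λ A → inside-count A (sel P x)) (List∈.∈-filter⁺ any-hit? (∈-subsets _)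
        (lose (∈-words x (λ i → List∈.∈-allFin (lookup x i))) (Xx , refl))))

    -- The power ∣A∣^f is relaxed to m^m so that the constant is the same for every member of the
    -- family that may occur.
    hits : ∀ {A} → Any.Any (Hit A) W → ∑ W (λ x → inside-count A (sel P x)) ≤ m ^ m * n ^ (m ∸ f)
    hits {A} hit = begin
      ∑ W (λ x → inside-count A (sel P x))
        ≡⟨ ∑-sel V P (λ u _ → inside-count A u) ⟩
      ∑ (words V ∣ P ∣) (λ u → ∑ (words V ∣ ∁ P ∣) (λ _ → inside-count A u))
        ≡⟨ ∑-cong (words V ∣ P ∣) (λ u → trans (∑-const (words V ∣ ∁ P ∣) (inside-count A u)) (cong (_* inside-count A u) (length-words-allFin n ∣ ∁ P ∣))) ⟩
      ∑ (words V ∣ P ∣) (λ u → n ^ ∣ ∁ P ∣ * inside-count A u)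
        ≡⟨ trans (∑-*ˡ (words V ∣ P ∣) (n ^ ∣ ∁ P ∣) (inside-count A)) (cong (n ^ ∣ ∁ P ∣ *_) (∑-inside A ∣ P ∣)) ⟩
      n ^ ∣ ∁ P ∣ * ∣ A ∣ ^ ∣ P ∣
        ≡⟨ cong₂ (λ p q → n ^ p * ∣ A ∣ ^ q) (trans (Subset.∣∁p∣≡n∸∣p∣ P) (cong (m ∸_) ∣P∣≡f)) ∣P∣≡f ⟩
      n ^ (m ∸ f) * ∣ A ∣ ^ f
        ≤⟨ ℕ.*-monoʳ-≤ (n ^ (m ∸ f)) (ℕ.≤-trans (ℕ.^-monoˡ-≤ f ∣A∣≤m) (ℕ.^-monoʳ-≤ m {{ℕ.>-nonZero 1≤m}} f≤m)) ⟩
      n ^ (m ∸ f) * m ^ m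
        ≡⟨ ℕ.*-comm (n ^ (m ∸ f)) _ ⟩
      m ^ m * n ^ (m ∸ f) ∎
      where
      open ℕ.≤-Reasoning
      f≤m : f ≤ m
      f≤m = ℕ.≤-trans (ℕ.≤-reflexive (sym ∣P∣≡f)) (Subset.∣p∣≤n P)
      ∣A∣≤m : ∣ A ∣ ≤ m
      ∣A∣≤m with x , _ , _ , refl ← find hit = ℕ.≤-trans (∣set∣≤ (sel P x)) (Subset.∣p∣≤n P)

    spanned : All (λ A → Any.Any (Hit A) W) As
    spanned = All.all-filter any-hit? (subsets n)

  copies : ∀ K → n ^ m ≤ K * ∑ W (ι ∘ X) →
           Σ (List (Embedding F H)) λ φs → AllPairs (λ φ ψ → ¬ SameCopy φ ψ) φs × n C f ≤ K * m ^ m * length φs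
  copies K large = spanning σ , spanning-distinct σ (Unique.filter⁺ any-hit? (unique-subsets n)) ,
    ℕ.≤-trans (C≤^ n f) (ℕ.*-cancelʳ-≤ _ _ (n ^ (m ∸ f)) {{ℕ.m^n≢0 n (m ∸ f) {{ℕ.>-nonZero 1≤n}}}} (begin
      n ^ f * n ^ (m ∸ f)                        ≡⟨ trans (sym (ℕ.^-distribˡ-+-* n f (m ∸ f))) (cong (n ^_) (ℕ.m+[n∸m]≡n f≤m)) ⟩
      n ^ m                                      ≤⟨ large ⟩
      K * ∑ W (ι ∘ X)                            ≤⟨ ℕ.*-monoʳ-≤ K (∑-mono W X≤hits) ⟩
      K * ∑ W (λ x → ∑ As (λ A → inside-count A (sel P x)))
        ≡⟨ cong (K *_) (∑-swap W As (λ x A → inside-count A (sel P x))) ⟩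
      K * ∑ As (λ A → ∑ W (λ x → inside-count A (sel P x)))
        ≤⟨ ℕ.*-monoʳ-≤ K (∑-≤-All (All.map hits spanned)) ⟩
      K * (length As * (m ^ m * n ^ (m ∸ f)))    ≡⟨ regroup K (length As) (m ^ m) _ ⟩
      K * m ^ m * length As * n ^ (m ∸ f)        ≡⟨ cong (λ l → K * m ^ m * l * n ^ (m ∸ f)) (length-spanning σ) ⟨
      K * m ^ m * length (spanning σ) * n ^ (m ∸ f) ∎))
    where
    open ℕ.≤-Reasoning
    σ = All.map spans spanned
    f≤m : f ≤ m
    f≤m = ℕ.≤-trans (ℕ.≤-reflexive (sym ∣P∣≡f)) (Subset.∣p∣≤n P)
    regroup : ∀ K a p q → K * (a * (p * q)) ≡ K * p * a * q
    regroup = solve-∀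

-- Supersaturation

Contains : Family k → KGraph k n → Set
Contains {k} 𝓕 G = ∃ λ f → Σ (KGraph k f) λ F → 𝓕 F × Embedding F G

-- The common source of both assertions. One graph G on the positions serves all words of `X`; G, F
-- and the order of F may depend on H, whereas m and K are parameters fixed beforehand.
record Saturated {k n} (𝓕 : Family k) (m K : ℕ) (H : KGraph k n) : Set where
  field
    {order}  : ℕ
    G        : KGraph k m
    F        : KGraph k order
    F∈𝓕      : 𝓕 F
    F⊆       : Embedding F G
    X        : Vec (Fin n) m → Bool
    large    : n ^ m ≤ K * ∑ (words (allFin n) m) (ι ∘ X)
    induced  : ∀ x → T (X x) → Injective _≡_ _≡_ (lookup x) ×
                 (∀ e → T (edge G e) → T (edge H (image (lookup x) e)))

∑-positive : ∀ (W : List A) (X : A → Bool) → 1 ≤ ∑ W (ι ∘ X) → ∃ λ x → T (X x)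
∑-positive (x ∷ W) X 1≤ with T? (X x)
... | yes t = x , t
... | no ¬t = ∑-positive W X (ℕ.≤-trans 1≤ (ℕ.≤-reflexive (cong (_+ ∑ W (ι ∘ X)) (ι-false ¬t))))

-- One test for each subset of the positions makes H[x] constant on a 2^(-2^m) fraction of the good
-- words; the additional factor 2 in K accounts for only half of all words being good.
saturate : ∀ {𝓕 : Family k} (H : KGraph k n) (good : Vec (Fin n) m → Bool) → 1 ≤ n →
           n ^ m ≤ 2 * ∑ (words (allFin n) m) (ι ∘ good) →
           (∀ x → T (good x) → T (distinct x) × Contains 𝓕 (pullback H x)) →
           Saturated 𝓕 m (2 ^ suc (length (subsets m))) H
saturate {k} {n} {m} {𝓕} H good 1≤n half good⇒ =
  let Y , Y⇒good , agree , most = agreeing W (λ e x → edge (pullback H x) e) (subsets m) good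
  in  assemble Y Y⇒good agree (ℕ.≤-trans half (ℕ.≤-trans (ℕ.*-monoʳ-≤ 2 most)
        (ℕ.≤-reflexive (sym (ℕ.*-assoc 2 (2 ^ length (subsets m)) _)))))
  where
  W = words (allFin n) m
  K = 2 ^ suc (length (subsets m))
  module _ (Y : Vec (Fin n) m → Bool) (Y⇒good : ∀ x → T (Y x) → T (good x))
           (agree : ∀ {x x′} → T (Y x) → T (Y x′) → ∀ {e} → e ∈ˡ subsets m →
                    edge (pullback H x) e ≡ edge (pullback H x′) e)
           (large : n ^ m ≤ K * ∑ W (ι ∘ Y)) where
    member : ∃ λ x → T (Y x)
    member = ∑-positive W Y (ℕ.n≢0⇒n>0 λ eq → ℕ.<⇒≱ (ℕ.m^n>0 n {{ℕ.>-nonZero 1≤n}} m)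
      (ℕ.≤-trans large (ℕ.≤-reflexive (trans (cong (K *_) eq) (ℕ.*-zeroʳ K)))))
    x₀ = proj₁ member
    Yx₀ = proj₂ member
    contains : Contains 𝓕 (pullback H x₀)
    contains = proj₂ (good⇒ x₀ (Y⇒good x₀ Yx₀))
    assemble : Saturated 𝓕 m K H
    assemble = record
      { G        = pullback H x₀
      ; F        = proj₁ (proj₂ contains)
      ; F∈𝓕      = proj₁ (proj₂ (proj₂ contains))
      ; F⊆       = proj₂ (proj₂ (proj₂ contains))
      ; X        = Y
      ; large    = large
      ; induced  = λ x Yx → distinct⇒injective x (proj₁ (good⇒ x (Y⇒good x Yx))) ,
          λ e t → proj₂ (T-∧⁻ {∣ e ∣ ≡ᵇ k} (subst T (agree Yx₀ Yx (∈-subsets e)) t))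
      }

module _ (k ℓ : ℕ) (ℓ<k : ℓ < k) (u Q : ℕ) (1≤Q : 1 ≤ Q) (𝓕 : Family k) (M : ℕ)
         (unavoidable : ∀ m → M ≤ m → (G : KGraph k m) → u * (m C (k ∸ ℓ)) < Q * minDegree ℓ G → Contains 𝓕 G)
         where

  abstract
    supersaturation : ∃ λ m → ∃ λ K → ∃ λ N → 1 ≤ m × 1 ≤ K × (∀ n → N ≤ n → 1 ≤ n → (H : KGraph k n) →
                        suc u * (n C (k ∸ ℓ)) ≤ Q * minDegree ℓ H → Saturated 𝓕 m K H)
    supersaturation = size , 2 ^ suc (length (subsets size)) , threshold ,
      ℕ.≤-trans (s≤s z≤n) B≤size , ℕ.m^n>0 2 (suc (length (subsets size))) ,
      λ n N≤n 1≤n H dense → saturate H (good H) 1≤n (good-count N≤n H dense) (λ x t →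
        proj₁ (T-∧⁻ t) , unavoidable size (ℕ.≤-trans (ℕ.n≤1+n M) B≤size) (pullback H x)
          (T-does⁻ (u * (size C (k ∸ ℓ)) ℕ.<? Q * minDegree ℓ (pullback H x)) (proj₂ (T-∧⁻ {distinct x} t))))
      -- Asking for `suc M` positions also makes the sample size positive.
      where open Sampling k ℓ ℓ<k u Q 1≤Q (suc M)

module _ {𝓕 : Family k} {K : ℕ} {H : KGraph k n} (sat : Saturated 𝓕 m K H) where
  open Saturated sat

  saturated-copies : 1 ≤ n → 1 ≤ m →
    Σ (List (Embedding F H)) λ φs → AllPairs (λ φ ψ → ¬ SameCopy φ ψ) φs × n C order ≤ K * m ^ m * length φs
  saturated-copies 1≤n 1≤m = copies 1≤n 1≤m (to F⊆) F⊆-injective X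
    (λ x Xx → record
      { injection = mk↣ {to = lookup x ∘ to F⊆} (F⊆-injective ∘ proj₁ (induced x Xx))
      ; preserves = λ e t → subst (T ∘ edge H) (sym (image-∘ (lookup x) (to F⊆) e)) (proj₂ (induced x Xx) _ (preserves F⊆ e t))
      } , λ _ → refl) K large
    where
    F⊆-injective : Injective _≡_ _≡_ (to F⊆)
    F⊆-injective = Injection.injective (injection F⊆)

  saturated-blowUp : ∀ {s} → 1 ≤ s → Box m s n X → Embedding (blowUp s F) H
  saturated-blowUp 1≤s (S , S-inj , S⊆X) = blowUp-embedding 1≤s F⊆ S S-inj (λ x on → induced x (S⊆X x on))

-- Rational and real numbers

-- r = a/(b + 1), not necessarily in lowest terms, with the denominator stored minus one as in
-- `mkℚᵘ`. It turns comparisons of rationals into inequalities in ℕ.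
record Fraction (r : ℚ) (a b : ℕ) : Set where
  constructor fraction
  field
    equal : ℚ.toℚᵘ r ℚᵘ.≃ ℚᵘ.mkℚᵘ (ℤ.+ a) b

open Fraction

ratio-fraction : ∀ a b → Fraction (ratio a (suc b)) a b
ratio-fraction a b = fraction (ℚ.toℚᵘ-fromℚᵘ (ℚᵘ.mkℚᵘ (ℤ.+ a) b))

ℕ-fraction : ∀ a → Fraction (ℕ⇒ℚ a) a 0
ℕ-fraction a = fraction (ℚ.toℚᵘ-fromℚᵘ (ℚᵘ.mkℚᵘ (ℤ.+ a) 0))

*-fraction : ∀ {r s a b c} → Fraction r a b → Fraction s c 0 → Fraction (r ℚ.* s) (a * c) b
*-fraction {r} {s} {a} {b} {c} p q = fraction (ℚᵘ.≃-trans (ℚ.toℚᵘ-homo-* r s)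
  (ℚᵘ.≃-trans (ℚᵘ.*-cong (equal p) (equal q)) (ℚᵘ.*≡* (cong₂ ℤ._*_ (sym (ℤ.pos-* a c))
    (cong ℤ.+_ (sym (ℕ.*-identityʳ (suc b))))))))

fraction-≤⁻ : ∀ {r s a b c d} → Fraction r a b → Fraction s c d → r ℚ.≤ s → a * suc d ≤ c * suc b
fraction-≤⁻ {a = a} {b} {c} {d} p q r≤s = ℤ.drop‿+≤+ (subst₂ ℤ._≤_ (sym (ℤ.pos-* a (suc d))) (sym (ℤ.pos-* c (suc b)))
  (ℚᵘ.drop-*≤* (ℚᵘ.≤-respˡ-≃ (equal p) (ℚᵘ.≤-respʳ-≃ (equal q) (ℚ.toℚᵘ-mono-≤ r≤s)))))

fraction-≤⁺ : ∀ {r s a b c d} → Fraction r a b → Fraction s c d → a * suc d ≤ c * suc b → r ℚ.≤ s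
fraction-≤⁺ {a = a} {b} {c} {d} p q le = ℚ.toℚᵘ-cancel-≤ (ℚᵘ.≤-respˡ-≃ (ℚᵘ.≃-sym (equal p))
  (ℚᵘ.≤-respʳ-≃ (ℚᵘ.≃-sym (equal q)) (ℚᵘ.*≤* (subst₂ ℤ._≤_ (ℤ.pos-* a (suc d)) (ℤ.pos-* c (suc b)) (ℤ.+≤+ le)))))

fraction-<⁻ : ∀ {r s a b c d} → Fraction r a b → Fraction s c d → r ℚ.< s → a * suc d < c * suc b
fraction-<⁻ p q r<s = ℕ.≰⇒> λ le → ℚ.<-irrefl refl (ℚ.<-≤-trans r<s (fraction-≤⁺ q p le))

nonNegative-fraction : ∀ {r} → 0ℚ ℚ.≤ r → ∃ λ a → ∃ λ b → Fraction r a b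
nonNegative-fraction {ℚ.mkℚ (ℤ.+ a)    b _} _ = a , b , fraction ℚᵘ.≃-refl
nonNegative-fraction {ℚ.mkℚ ℤ.-[1+ a ] b _} (ℚ.*≤* ())

ratio-mono : ∀ {a b} d → a ≤ b → ratio a d ℚ.≤ ratio b d
ratio-mono zero    a≤b = ℚ.≤-refl
ratio-mono {a} {b} (suc d) a≤b =
  fraction-≤⁺ (ratio-fraction a d) (ratio-fraction b d) (ℕ.*-monoˡ-≤ (suc d) a≤b)

ℕ⇒ℚ-suc : ∀ n → ℕ⇒ℚ (suc n) ≡ 1ℚ ℚ.+ ℕ⇒ℚ n
ℕ⇒ℚ-suc n = ℚ.toℚᵘ-injective (ℚᵘ.≃-trans (equal (ℕ-fraction (suc n))) (ℚᵘ.≃-sym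
  (ℚᵘ.≃-trans (ℚ.toℚᵘ-homo-+ 1ℚ (ℕ⇒ℚ n)) (ℚᵘ.≃-trans (ℚᵘ.+-congʳ (ℚ.toℚᵘ 1ℚ) (equal (ℕ-fraction n)))
    (ℚᵘ.*≡* (cong (ℤ._* ℤ.1ℤ) (cong (λ z → ℤ.1ℤ ℤ.+ z) (ℤ.*-identityʳ (ℤ.+ n)))))))))

archimedean : ∀ {d h} → 0ℚ ℚ.≤ d → 0ℚ ℚ.< h → ∃ λ n → d ℚ.≤ ℕ⇒ℚ n ℚ.* h
archimedean {d} {h} 0≤d 0<h with a , b , d≡ ← nonNegative-fraction 0≤d
                            with c , e , h≡ ← nonNegative-fraction (ℚ.<⇒≤ 0<h) =
  -- With d = a/(b + 1), h = c/(e + 1) and c ≥ 1, this multiple of h equals ac, which is at least d.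
  a * suc e , ℚ.≤-trans (fraction-≤⁺ d≡ (*-fraction h≡ (ℕ-fraction (a * suc e))) (begin
    a * suc e                      ≤⟨ ℕ.m≤n*m (a * suc e) c {{ℕ.>-nonZero 1≤c}} ⟩
    c * (a * suc e)                ≤⟨ ℕ.m≤m*n _ (suc b) ⟩
    c * (a * suc e) * suc b        ∎)) (ℚ.≤-reflexive (ℚ.*-comm h _))
  where
  open ℕ.≤-Reasoning
  1≤c : 1 ≤ c
  1≤c = ℕ.≤-trans (fraction-<⁻ (ℕ-fraction 0) h≡ 0<h) (ℕ.≤-reflexive (ℕ.*-identityʳ c))

∉-mono : ∀ (x : ℝ) {p q} → p ℚ.≤ q → ¬ Below x p → ¬ Below x q
∉-mono x {p} {q} p≤q p∉ q∈ with p ℚ.<? q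
... | yes p<q = p∉ (lower x p<q q∈)
... | no  p≮q = p∉ (subst (Below x) (ℚ.≤-antisym (ℚ.≮⇒≥ p≮q) p≤q) q∈)

+-cancel-minus : ∀ p s → p ℚ.+ (s ℚ.- p) ≡ s
+-cancel-minus p s = trans (cong (p ℚ.+_) (ℚ.+-comm s (ℚ.- p))) (trans (sym (ℚ.+-assoc p (ℚ.- p) s))
  (trans (cong (ℚ._+ s) (ℚ.+-inverseʳ p)) (ℚ.+-identityˡ s)))

-- Cuts, `ex` and `π` in the presence of excluded middle

module _ (em : ExcludedMiddle 0ℓ) where

  -- Recovers locatedness of a cut: walk upwards from a point below x in steps of h, deciding at
  -- each step whether x has been passed. By `archimedean` the walk ends.
  within : ∀ (x : ℝ) {h} → 0ℚ ℚ.< h → ∃ λ p → Below x p × ¬ Below x (p ℚ.+ h)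
  within x {h} 0<h = let n , far = archimedean 0≤s-p 0<h in
    walk n p p∈ (∉-mono x (ℚ.≤-trans (ℚ.≤-reflexive (sym (+-cancel-minus p s))) (ℚ.+-monoʳ-≤ p far)) s∉)
    where
    p = proj₁ (inhabited x)
    p∈ = proj₂ (inhabited x)
    s = proj₁ (proper x)
    s∉ = proj₂ (proper x)
    p≤s : p ℚ.≤ s
    p≤s = ℚ.≮⇒≥ λ s<p → s∉ (lower x s<p p∈)
    0≤s-p : 0ℚ ℚ.≤ s ℚ.- p
    0≤s-p = ℚ.≤-trans (ℚ.≤-reflexive (sym (ℚ.+-inverseʳ p))) (ℚ.+-monoˡ-≤ (ℚ.- p) p≤s)
    step : ∀ n p → p ℚ.+ ℕ⇒ℚ (suc n) ℚ.* h ≡ (p ℚ.+ h) ℚ.+ ℕ⇒ℚ n ℚ.* h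
    step n p = trans (cong (λ z → p ℚ.+ z ℚ.* h) (ℕ⇒ℚ-suc n))
      (trans (cong (p ℚ.+_) (trans (ℚ.*-distribʳ-+ h 1ℚ (ℕ⇒ℚ n)) (cong (ℚ._+ ℕ⇒ℚ n ℚ.* h) (ℚ.*-identityˡ h))))
        (sym (ℚ.+-assoc p h (ℕ⇒ℚ n ℚ.* h))))
    walk : ∀ n p → Below x p → ¬ Below x (p ℚ.+ ℕ⇒ℚ n ℚ.* h) → ∃ λ p → Below x p × ¬ Below x (p ℚ.+ h)
    walk zero    p p∈ end∉ = contradiction
      (subst (Below x) (sym (trans (cong (p ℚ.+_) (ℚ.*-zeroˡ h)) (ℚ.+-identityʳ p))) p∈) end∉
    walk (suc n) p p∈ end∉ with em {Below x (p ℚ.+ h)}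
    ... | yes p+h∈ = walk n (p ℚ.+ h) p+h∈ (subst (¬_ ∘ Below x) (step n p) end∉)
    ... | no  p+h∉ = p , p∈ , p+h∉

  -- If the ratio exceeded r beyond every bound, r would witness that q is below the limit superior.
  π-eventually : ∀ {k} ℓ (𝓕 : Family k) {q r} → ¬ Below (π em ℓ 𝓕) q → q ℚ.< r →
                 ∃ λ M → ∀ n → M ≤ n → ratio (ex em ℓ 𝓕 n) (n C (k ∸ ℓ)) ℚ.≤ r
  π-eventually {k} ℓ 𝓕 {q} {r} q∉ q<r with em {∃ λ M → ∀ n → M ≤ n → ratio (ex em ℓ 𝓕 n) (n C (k ∸ ℓ)) ℚ.≤ r}
  ... | yes eventually = eventually
  ... | no ¬eventually = contradiction (r , q<r , frequently) q∉
    where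
    frequently : ∀ N → ∃ λ n → N ≤ n × r ℚ.< ratio (ex em ℓ 𝓕 n) (n C (k ∸ ℓ))
    frequently N with em {∃ λ n → N ≤ n × r ℚ.< ratio (ex em ℓ 𝓕 n) (n C (k ∸ ℓ))}
    ... | yes found = found
    ... | no ¬found = contradiction (N , λ n N≤n → ℚ.≮⇒≥ λ r<xn → ¬found (n , N≤n , r<xn)) ¬eventually

  -- The first alternative covers the default 0 of the maximum, which is all that remains when there
  -- is no free graph.
  ex-attained : ∀ {k} ℓ (𝓕 : Family k) n → ex em ℓ 𝓕 n ≡ 0 ⊎ Attained em ℓ 𝓕 n (ex em ℓ 𝓕 n)
  ex-attained {k} ℓ 𝓕 n with Extrema.argmax-sel id 0 (filter (λ d → em {Attained em ℓ 𝓕 n d}) (upTo (suc (n C (k ∸ ℓ)))))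
  ... | inj₁ eq = inj₁ eq
  ... | inj₂ ∈f = inj₂ (proj₂ (List∈.∈-filter⁻ (λ d → em {Attained em ℓ 𝓕 n d}) {xs = upTo (suc (n C (k ∸ ℓ)))} ∈f))

  minDegree>ex⇒contains : ∀ {k n} ℓ (𝓕 : Family k) (G : KGraph k n) → ex em ℓ 𝓕 n < minDegree ℓ G → Contains 𝓕 G
  minDegree>ex⇒contains ℓ 𝓕 G ex<d with em {Contains 𝓕 G}
  ... | yes contains = contains
  ... | no ¬contains = contradiction (minDegree≤ex em ℓ 𝓕 G λ F F∈𝓕 φ → ¬contains (_ , F , F∈𝓕 , φ)) (ℕ.<⇒≱ ex<d)

  -- r′ = u/Q, and r exceeds it by at least 1/Q.
  density-gap : ∀ {k} ℓ (𝓕 : Family k) {r′ r a′ b′ a b} → Fraction r′ a′ b′ → Fraction r a b → r′ ℚ.< r →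
    (M : ℕ) → (∀ n → M ≤ n → ratio (ex em ℓ 𝓕 n) (n C (k ∸ ℓ)) ℚ.≤ r′) →
    ∃ λ u → ∃ λ Q → 1 ≤ Q ×
      (∀ m → M ≤ m → (G : KGraph k m) → u * (m C (k ∸ ℓ)) < Q * minDegree ℓ G → Contains 𝓕 G) ×
      (∀ c d → r ℚ.* ℕ⇒ℚ c ℚ.≤ ℕ⇒ℚ d → suc u * c ≤ Q * d)
  density-gap {k} ℓ 𝓕 {r′} {r} {a′} {b′} {a} {b} r′≡ r≡ r′<r M below = u , Q , s≤s z≤n , unavoidable , gap
    where
    open ℕ.≤-Reasoning
    u = a′ * suc b
    Q = suc b′ * suc b
    unavoidable : ∀ m → M ≤ m → (G : KGraph k m) → u * (m C (k ∸ ℓ)) < Q * minDegree ℓ G → Contains 𝓕 G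
    unavoidable m M≤m G = by-total (m C (k ∸ ℓ)) (below m M≤m) (minDegree≤C ℓ G)
      where
      by-total : ∀ c → ratio (ex em ℓ 𝓕 m) c ℚ.≤ r′ → minDegree ℓ G ≤ c → u * c < Q * minDegree ℓ G → Contains 𝓕 G
      -- A zero binomial makes the ratio junk, but then the minimum degree is 0 as well and cannot
      -- satisfy the strict inequality.
      by-total zero    _   d≤0 d-large = contradiction d-large (ℕ.≤⇒≯ (begin
        Q * minDegree ℓ G  ≤⟨ ℕ.*-monoʳ-≤ Q d≤0 ⟩
        Q * 0              ≡⟨ ℕ.*-zeroʳ Q ⟩
        0                  ≤⟨ z≤n ⟩
        u * 0              ∎))
      by-total (suc c) ex≤ _   d-large = minDegree>ex⇒contains ℓ 𝓕 G (ℕ.*-cancelˡ-< Q (ex em ℓ 𝓕 m) (minDegree ℓ G) (begin-strict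
        suc b′ * suc b * ex em ℓ 𝓕 m   ≡⟨ regroup (suc b′) (suc b) _ ⟩
        ex em ℓ 𝓕 m * suc b′ * suc b   ≤⟨ ℕ.*-monoˡ-≤ (suc b) (fraction-≤⁻ (ratio-fraction (ex em ℓ 𝓕 m) c) r′≡ ex≤) ⟩
        a′ * suc c * suc b             ≡⟨ swap a′ (suc c) (suc b) ⟩
        a′ * suc b * suc c             <⟨ d-large ⟩
        Q * minDegree ℓ G              ∎))
        where
        regroup : ∀ p q e → p * q * e ≡ e * p * q
        regroup = solve-∀
        swap : ∀ p q e → p * q * e ≡ p * e * q
        swap = solve-∀
    gap : ∀ c d → r ℚ.* ℕ⇒ℚ c ℚ.≤ ℕ⇒ℚ d → suc u * c ≤ Q * d
    gap c d rc≤d = begin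
      suc u * c              ≤⟨ ℕ.*-monoˡ-≤ c (fraction-<⁻ r′≡ r≡ r′<r) ⟩
      a * suc b′ * c         ≡⟨ swap a (suc b′) c ⟩
      suc b′ * (a * c * 1)   ≤⟨ ℕ.*-monoʳ-≤ (suc b′) (fraction-≤⁻ (*-fraction r≡ (ℕ-fraction c)) (ℕ-fraction d) rc≤d) ⟩
      suc b′ * (d * suc b)   ≡⟨ regroup (suc b′) d (suc b) ⟩
      Q * d                  ∎
      where
      swap : ∀ a p c → a * p * c ≡ p * (a * c * 1)
      swap = solve-∀
      regroup : ∀ p d q → p * (d * q) ≡ p * q * d
      regroup = solve-∀

  -- Supersaturation at real densities and the two assertions

  module _ (k ℓ : ℕ) (ℓ<k : ℓ < k) (𝓕 : Family k) where

    Saturating : ℚ → Set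
    Saturating r = ∃ λ m → ∃ λ K → ∃ λ N → 1 ≤ m × 1 ≤ K × (∀ n → N ≤ n → 1 ≤ n → (H : KGraph k n) →
      r ℚ.* ℕ⇒ℚ (n C (k ∸ ℓ)) ℚ.≤ ℕ⇒ℚ (minDegree ℓ H) → Saturated 𝓕 m K H)

    abstract
      -- The slack q < r is split at r′: the ratios are eventually at most r′ = u/Q, and r′ < r
      -- gives r ≥ (u + 1)/Q.
      saturating : ∀ {q r} → ¬ Below (π em ℓ 𝓕) q → q ℚ.< r → 0ℚ ℚ.≤ r × Saturating r
      saturating {q} {r} q∉ q<r =
        let r′ , q<r′ , r′<r = ℚ.<-dense q<r
            M , below        = π-eventually ℓ 𝓕 q∉ q<r′
            -- Some ratio is at most r′, so r′ and r are nonnegative and have natural numerators.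
            0≤r′             = ℚ.≤-trans (0≤ratio (ex em ℓ 𝓕 M) (M C (k ∸ ℓ))) (below M ℕ.≤-refl)
            0≤r              = ℚ.≤-trans 0≤r′ (ℚ.<⇒≤ r′<r)
            _ , _ , r′≡      = nonNegative-fraction 0≤r′
            _ , _ , r≡       = nonNegative-fraction 0≤r
            u , Q , 1≤Q , unavoidable , gap       = density-gap ℓ 𝓕 r′≡ r≡ r′<r M below
            m , K , N , 1≤m , 1≤K , saturated     = supersaturation k ℓ ℓ<k u Q 1≤Q 𝓕 M unavoidable
        in  0≤r , m , K , N , 1≤m , 1≤K ,
            λ n N≤n 1≤n H dense → saturated n N≤n 1≤n H (gap (n C (k ∸ ℓ)) (minDegree ℓ H) dense)

    ManyCopies : ℝ → Set₁
    ManyCopies ε = Σ ℝ λ δ → 0ᴿ <ᴿ δ × ∃ λ N →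
      (n : ℕ) → n > N → (H : KGraph k n) →
      (π em ℓ 𝓕 +ᴿ ε) · (n C (k ∸ ℓ)) <ᴿ fromℕ (minDegree ℓ H) →
      ∃ λ f → Σ (KGraph k f) λ F → 𝓕 F × AtLeastCopies (δ · (n C f)) F H

    -- A rational r is needed below π + ε yet above a point outside π. With p below π, p + h not
    -- below it and h < e < ε, any r between p + h and p + e will do.
    copies-lower-bound : (ε : ℝ) → 0ᴿ <ᴿ ε → ManyCopies ε
    copies-lower-bound ε (q₀ , q₀≮0 , q₀∈ε) =
      let e , q₀<e , e∈ε   = rounded ε q₀∈ε
          h , 0<h , h<e    = ℚ.<-dense (ℚ.≤-<-trans (ℚ.≮⇒≥ q₀≮0) q₀<e)
          p , p∈ , p+h∉    = within (π em ℓ 𝓕) 0<h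
          r , p+h<r , r<p+e = ℚ.<-dense (ℚ.+-monoʳ-< p h<e)
          _ , sat          = saturating p+h∉ p+h<r
      in  from-saturating r (p , e , p∈ , e∈ε , r<p+e) sat
      where
      module _ (r : ℚ) (r∈ : Below (π em ℓ 𝓕 +ᴿ ε) r) where
        from-saturating : Saturating r → ManyCopies ε
        from-saturating (m , K , N , 1≤m , 1≤K , saturated) =
          -- δ = 1/(K m^m), the constant from `saturated-copies`, whatever the order of the member
          -- found.
          fromℚ (ratio 1 L) , (0ℚ , ℚ.<-irrefl refl , 0<δ) , N , bound
          where
          L = K * m ^ m
          1≤L : 1 ≤ L
          1≤L = ℕ.*-mono-≤ 1≤K (ℕ.m^n>0 m {{ℕ.>-nonZero 1≤m}} m)
          δ≡ : Fraction (ratio 1 L) 1 (ℕ.pred L)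
          δ≡ = subst (λ l → Fraction (ratio 1 l) 1 (ℕ.pred L)) (ℕ.suc-pred L {{ℕ.>-nonZero 1≤L}}) (ratio-fraction 1 (ℕ.pred L))
          0<δ : 0ℚ ℚ.< ratio 1 L
          0<δ = ℚ.≰⇒> λ δ≤0 → contradiction (fraction-≤⁻ δ≡ (ℕ-fraction 0) δ≤0) λ ()
          many : ∀ c len → c ≤ L * len → fromℚ (ratio 1 L) · c ≤ᴿ fromℕ len
          many c len c≤ q (a , a<δ , q<ac) = ℚ.<-≤-trans q<ac (ℚ.≤-trans
            (ℚ.*-monoʳ-≤-nonNeg (ℕ⇒ℚ c) {{ℚ.normalize-nonNeg c 1}} (ℚ.<⇒≤ a<δ))
            (fraction-≤⁺ (*-fraction δ≡ (ℕ-fraction c)) (ℕ-fraction len) (begin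
              1 * c * 1              ≡⟨ trans (ℕ.*-identityʳ _) (ℕ.*-identityˡ c) ⟩
              c                      ≤⟨ c≤ ⟩
              L * len                ≡⟨ ℕ.*-comm L _ ⟩
              len * L                ≡⟨ cong (len *_) (ℕ.suc-pred L {{ℕ.>-nonZero 1≤L}}) ⟨
              len * suc (ℕ.pred L)   ∎)))
            where open ℕ.≤-Reasoning
          bound : (n : ℕ) → n > N → (H : KGraph k n) →
            (π em ℓ 𝓕 +ᴿ ε) · (n C (k ∸ ℓ)) <ᴿ fromℕ (minDegree ℓ H) →
            ∃ λ f → Σ (KGraph k f) λ F → 𝓕 F × AtLeastCopies (fromℚ (ratio 1 L) · (n C f)) F H
          bound n n>N H (q , q∉ , q<d) =
            let 1≤n = ℕ.≤-trans (s≤s z≤n) n>N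
                -- As r is below π + ε and q is not below the multiple of it, r C(n, k - ℓ) ≤ q, and
                -- q is less than the minimum degree.
                sat = saturated n (ℕ.<⇒≤ n>N) 1≤n H (ℚ.≤-trans (ℚ.≮⇒≥ λ q<rC → q∉ (r , r∈ , q<rC)) (ℚ.<⇒≤ q<d))
                φs , different , C≤ = saturated-copies sat 1≤n 1≤m
            in  _ , Saturated.F sat , Saturated.F∈𝓕 sat , φs , different , many _ (length φs) C≤

    module _ (s : ℕ) (1≤s : 1 ≤ s) where

      -- F(s) contains F, so every 𝓕-free graph is also free of the blow-ups.
      ex≤ex-blowUps : ∀ n → ex em ℓ 𝓕 n ≤ ex em ℓ (BlowUps s 𝓕) n
      ex≤ex-blowUps n with ex-attained ℓ 𝓕 n
      ... | inj₁ ex≡0              = ℕ.≤-trans (ℕ.≤-reflexive ex≡0) z≤n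
      ... | inj₂ (H , free , d≡ex) = ℕ.≤-trans (ℕ.≤-reflexive (sym d≡ex))
        (minDegree≤ex em ℓ (BlowUps s 𝓕) H λ { _ (blow {F = F} F∈𝓕) φ → free F F∈𝓕 (embedding-from-blowUp 1≤s φ) })

      π≤π-blowUps : π em ℓ 𝓕 ≤ᴿ π em ℓ (BlowUps s 𝓕)
      π≤π-blowUps q (r , q<r , frequently) = r , q<r , λ N →
        let n , N≤n , r<x = frequently N in
        n , N≤n , ℚ.<-≤-trans r<x (ratio-mono (n C (k ∸ ℓ)) (ex≤ex-blowUps n))

      -- A graph attaining `ex` for the blow-ups with a ratio above r would be saturated; for large
      -- n its set `X` contains a box, and the box spans some F(s).
      blowUps-ratio≤ : ∀ {r} → 0ℚ ℚ.≤ r → Saturating r →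
                       ∃ λ N → ∀ n → N ≤ n → ratio (ex em ℓ (BlowUps s 𝓕) n) (n C (k ∸ ℓ)) ℚ.≤ r
      blowUps-ratio≤ {r} 0≤r (m , K , N , 1≤m , 1≤K , saturated) = suc (N + N′) ,
        λ n N≤n → ℚ.≮⇒≥ (impossible n N≤n (n C (k ∸ ℓ)) refl (ex-attained ℓ (BlowUps s 𝓕) n))
        where
        N′ = proj₁ (box m K s 1≤K 1≤s)
        contains : ∀ n → suc (N + N′) ≤ n → (H : KGraph k n) →
                   r ℚ.* ℕ⇒ℚ (n C (k ∸ ℓ)) ℚ.≤ ℕ⇒ℚ (minDegree ℓ H) → ¬ Free (BlowUps s 𝓕) H
        contains n N≤n H dense free =
          let 1≤n = ℕ.≤-trans (s≤s z≤n) N≤n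
              N+N′≤n = ℕ.≤-trans (ℕ.n≤1+n _) N≤n
              sat = saturated n (ℕ.≤-trans (ℕ.m≤m+n N N′) N+N′≤n) 1≤n H dense
          in  free _ (blow (Saturated.F∈𝓕 sat)) (saturated-blowUp sat 1≤s
                (proj₂ (box m K s 1≤K 1≤s) n (ℕ.≤-trans (ℕ.m≤n+m N′ N) N+N′≤n) 1≤n (Saturated.X sat) (Saturated.large sat)))
        impossible : ∀ n → suc (N + N′) ≤ n → ∀ c → n C (k ∸ ℓ) ≡ c → let x = ex em ℓ (BlowUps s 𝓕) n in
                     x ≡ 0 ⊎ Attained em ℓ (BlowUps s 𝓕) n x → ¬ r ℚ.< ratio x c
        -- The binomial is passed as a variable `c` so that the junk denominator can be split off;
        -- there the ratio is 0, which does not exceed r ≥ 0.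
        impossible n _   zero    _   _          r<0 = ℚ.<-irrefl refl (ℚ.≤-<-trans 0≤r r<0)
        impossible n _   (suc c) _   (inj₁ x≡0) r<x = ℚ.<-irrefl refl (ℚ.≤-<-trans 0≤r (ℚ.<-≤-trans r<x
          (fraction-≤⁺ (ratio-fraction (ex em ℓ (BlowUps s 𝓕) n) c) (ℕ-fraction 0) (ℕ.≤-reflexive (cong (_* 1) x≡0)))))
        impossible n N≤n (suc c) C≡c (inj₂ (H , free , d≡x)) r<x = contains n N≤n H (ℚ.≤-trans
          (ℚ.*-monoʳ-≤-nonNeg (ℕ⇒ℚ total) {{ℚ.normalize-nonNeg total 1}} (ℚ.<⇒≤ r<x))
          (fraction-≤⁺ (*-fraction (ratio-fraction x c) (ℕ-fraction total)) (ℕ-fraction (minDegree ℓ H))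
            (ℕ.≤-reflexive (trans (ℕ.*-identityʳ _) (cong₂ _*_ (sym d≡x) C≡c))))) free
          where
          x = ex em ℓ (BlowUps s 𝓕) n
          total = n C (k ∸ ℓ)

      -- If q were not below π, the ratios for the blow-ups would eventually be at most r, while r
      -- is a witness that they exceed r infinitely often.
      π-blowUps≤π : π em ℓ (BlowUps s 𝓕) ≤ᴿ π em ℓ 𝓕
      π-blowUps≤π q (r , q<r , frequently) with em {Below (π em ℓ 𝓕) q}
      ... | yes q∈ = q∈
      ... | no q∉  = contradiction (ℚ.<-≤-trans r<x (bounded n₀ N≤n₀)) (ℚ.<-irrefl refl)
        where
        sat = saturating q∉ q<r
        eventually = blowUps-ratio≤ (proj₁ sat) (proj₂ sat)
        bounded = proj₂ eventually
        n₀ = proj₁ (frequently (proj₁ eventually))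
        N≤n₀ = proj₁ (proj₂ (frequently (proj₁ eventually)))
        r<x = proj₂ (proj₂ (frequently (proj₁ eventually)))

proposition1p6 : (em : ExcludedMiddle 0ℓ) →
    (k ℓ : ℕ) → 1 ≤ ℓ → ℓ < k →
    (𝓕 : Family k) →
    ((ε : ℝ) → 0ᴿ <ᴿ ε →
    Σ ℝ λ δ → 0ᴿ <ᴿ δ × ∃ λ N →
    (n : ℕ) → n > N → (H : KGraph k n) →
    (π em ℓ 𝓕 +ᴿ ε) · (n C (k ∸ ℓ)) <ᴿ fromℕ (minDegree ℓ H) →
    ∃ λ f → Σ (KGraph k f) λ F → 𝓕 F × AtLeastCopies (δ · (n C f)) F H)
    × ((s : ℕ) → 1 ≤ s → π em ℓ 𝓕 ≈ᴿ π em ℓ (BlowUps s 𝓕))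
proposition1p6 em k ℓ _ ℓ<k 𝓕 =
  copies-lower-bound em k ℓ ℓ<k 𝓕 ,
  λ s 1≤s → π≤π-blowUps em k ℓ ℓ<k 𝓕 s 1≤s , π-blowUps≤π em k ℓ ℓ<k 𝓕 s 1≤s
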